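{- Let $E/\mathbb{Q}$ be an elliptic curve with conductor $N_E$, and let $K = \mathbb{Q}(\sqrt{d})$, with $d$ a square-free integer, be a quadratic number field such that $E_\mathrm{tors}(\mathbb{Q}) \neq E_\mathrm{tors}(K)$. If $2 \mid d$, then $2 \mid N_E$.
   Context: For a number field $F$, $E_\mathrm{tors}(F)$ denotes the torsion subgroup of $E(F)$. -}

module Defs where

open import Data.Nat as ℕ using (ℕ; suc)
open import Data.Nat.Divisibility as ℕD using ()
open import Data.Integer as ℤ using (ℤ; +_)
open import Data.Integer.Divisibility as ℤD using ()
open import Data.Rational as ℚ using (ℚ; 0ℚ; 1ℚ; _+_; _*_; _-_; -_; _/_; 1/_; ≢-nonZero)
open import Data.Rational.Properties using (_≟_)
open import Data.Product using (Σ; ∃; _×_; _,_)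
open import Relation.Binary.PropositionalEquality using (_≡_; _≢_; refl)
open import Relation.Nullary using (¬_; yes; no; Dec)
open import Data.Unit using (⊤)

-- d is square-free: the only natural number whose square divides d is 1.
-- (This excludes d = 0, since 2*2 ∣ 0.)
SquareFree : ℤ → Set
SquareFree d = ∀ (n : ℕ) → (n ℕ.* n) ℕD.∣ ℤ.∣ d ∣ → n ≡ 1

c : ℕ → ℚ
c n = + n / 1

ℤ→ℚ : ℤ → ℚ
ℤ→ℚ z = z / 1

-- total inverse on ℚ (inv 0 = 0); only used where the argument is nonzero
inv : ℚ → ℚ
inv q with q ≟ 0ℚ
... | yes _ = 0ℚ
... | no q≢0 = 1/_ q {{≢-nonZero q≢0}}

-- Elliptic curves over ℚ in general Weierstrass form
--   y² + a1 x y + a3 y = x³ + a2 x² + a4 x + a6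

record Weierstrass : Set where
  constructor mkW
  field
    a1 a2 a3 a4 a6 : ℚ

module _ (W : Weierstrass) where
  open Weierstrass W
  b2 b4 b6 b8 : ℚ
  b2 = a1 * a1 + c 4 * a2
  b4 = c 2 * a4 + a1 * a3
  b6 = a3 * a3 + c 4 * a6
  b8 = a1 * a1 * a6 + c 4 * a2 * a6 - a1 * a3 * a4 + a2 * a3 * a3 - a4 * a4

  Δ : ℚ
  Δ = - (b2 * b2 * b8) - c 8 * b4 * b4 * b4 - c 27 * b6 * b6 + c 9 * b2 * b4 * b6

record EllipticCurve : Set where
  constructor mkE
  field
    eqn  : Weierstrass
    Δ≢0  : Δ eqn ≢ 0ℚ

Integral : ℕ → ℚ → Set
Integral p q = ¬ (p ℕD.∣ ℚ.↧ₙ q)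

PUnit : ℕ → ℚ → Set
PUnit p q = Integral p q × ¬ ((+ p) ℤD.∣ ℚ.↥ q)

-- The Weierstrass equation obtained by the change of variables
--   x = u² x' + r,  y = u³ y' + s u² x' + t   (u ≠ 0)
transform : Weierstrass → (u r s t : ℚ) → Weierstrass
transform (mkW a1 a2 a3 a4 a6) u r s t = mkW a1' a2' a3' a4' a6'
  where
  u⁻¹ = inv u
  pw : ℚ → ℕ → ℚ
  pw x 0 = 1ℚ
  pw x (suc n) = x * pw x n
  a1' = pw u⁻¹ 1 * (a1 + c 2 * s)
  a2' = pw u⁻¹ 2 * (a2 - s * a1 + c 3 * r - s * s)
  a3' = pw u⁻¹ 3 * (a3 + r * a1 + c 2 * t)
  a4' = pw u⁻¹ 4 * (a4 - s * a3 + c 2 * r * a2 - (t + r * s) * a1 + c 3 * r * r - c 2 * s * t)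
  a6' = pw u⁻¹ 6 * (a6 + r * a4 + r * r * a2 + r * r * r - t * a3 - t * t - r * t * a1)

GoodReductionAt : ℕ → EllipticCurve → Set
GoodReductionAt p E =
  Σ ℚ λ u → Σ ℚ λ r → Σ ℚ λ s → Σ ℚ λ t →
    u ≢ 0ℚ ×
    (let W' = transform (EllipticCurve.eqn E) u r s t
         open Weierstrass W'
     in Integral p a1 × Integral p a2 × Integral p a3 × Integral p a4 ×
        Integral p a6 × PUnit p (Δ W'))

-- p ∣ N_E  (p divides the conductor of E): by definition of the conductor
-- N_E = ∏ p^{f_p}, f_p = 0 exactly at primes of good reduction.
DividesConductor : ℕ → EllipticCurve → Set
DividesConductor p E = ¬ GoodReductionAt p E

record K (d : ℤ) : Set where
  constructor _+√_
  field
    re im : ℚ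

module QuadField (d : ℤ) where
  infixl 6 _⊕_ _⊖_
  infixl 7 _⊗_
  _⊕_ _⊖_ _⊗_ : K d → K d → K d
  (a +√ b) ⊕ (a' +√ b') = (a + a') +√ (b + b')
  (a +√ b) ⊖ (a' +√ b') = (a - a') +√ (b - b')
  (a +√ b) ⊗ (a' +√ b') = (a * a' + ℤ→ℚ d * b * b') +√ (a * b' + b * a')

  ι : ℚ → K d
  ι q = q +√ 0ℚ

  -- inverse: (a - b√d)/(a² - d b²)  (d not a square, so norm ≠ 0 for x ≠ 0)
  kinv : K d → K d
  kinv (a +√ b) = let n = inv (a * a - ℤ→ℚ d * b * b) in (a * n) +√ (- (b * n))

  _≟K_ : (x y : K d) → Dec (x ≡ y)
  (a +√ b) ≟K (a' +√ b') with a ≟ a' | b ≟ b'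
  ... | yes refl | yes refl = yes refl
  ... | no ne | _ = no λ { refl → ne refl }
  ... | yes _ | no ne = no λ { refl → ne refl }

  data Pt : Set where
    O  : Pt
    af : K d → K d → Pt

  module _ (W : Weierstrass) where
    open Weierstrass W
    private
      A1 A2 A3 A4 A6 : K d
      A1 = ι a1
      A2 = ι a2
      A3 = ι a3
      A4 = ι a4
      A6 = ι a6

    OnCurve : Pt → Set
    OnCurve O = ⊤
    OnCurve (af x y) = y ⊗ y ⊕ A1 ⊗ x ⊗ y ⊕ A3 ⊗ y ≡ x ⊗ x ⊗ x ⊕ A2 ⊗ x ⊗ x ⊕ A4 ⊗ x ⊕ A6

    -- chord-and-tangent group law (Silverman, AEC III.2.3)
    private
      finish : (x1 x2 λ' ν : K d) → Pt
      finish x1 x2 λ' ν = af x3 y3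
        where
        x3 = λ' ⊗ λ' ⊕ A1 ⊗ λ' ⊖ A2 ⊖ x1 ⊖ x2
        y3 = ι 0ℚ ⊖ (λ' ⊕ A1) ⊗ x3 ⊖ ν ⊖ A3

    _⊞_ : Pt → Pt → Pt
    O ⊞ Q = Q
    P ⊞ O = P
    af x1 y1 ⊞ af x2 y2 with x1 ≟K x2
    ... | no _ =
      let den = kinv (x2 ⊖ x1) in
      finish x1 x2 ((y2 ⊖ y1) ⊗ den) ((y1 ⊗ x2 ⊖ y2 ⊗ x1) ⊗ den)
    ... | yes _ with (y1 ⊕ y2 ⊕ A1 ⊗ x2 ⊕ A3) ≟K ι 0ℚ
    ...   | yes _ = O
    ...   | no _ =
      let den = kinv (ι (c 2) ⊗ y1 ⊕ A1 ⊗ x1 ⊕ A3) in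
      finish x1 x2
        ((ι (c 3) ⊗ x1 ⊗ x1 ⊕ ι (c 2) ⊗ A2 ⊗ x1 ⊕ A4 ⊖ A1 ⊗ y1) ⊗ den)
        ((ι 0ℚ ⊖ x1 ⊗ x1 ⊗ x1 ⊕ A4 ⊗ x1 ⊕ ι (c 2) ⊗ A6 ⊖ A3 ⊗ y1) ⊗ den)

    _·_ : ℕ → Pt → Pt
    0 · P = O
    suc n · P = P ⊞ (n · P)

    IsTorsion : Pt → Set
    IsTorsion P = Σ ℕ λ n → (n ℕ.> 0) × (n · P ≡ O)

    Rational : Pt → Set
    Rational O = ⊤
    Rational (af x y) = K.im x ≡ 0ℚ × K.im y ≡ 0ℚ

-- E_tors(ℚ) ≠ E_tors(K) for K = ℚ(√d): viewing E_tors(ℚ) ⊆ E_tors(K),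
-- some torsion point of E(K) is not defined over ℚ.
TorsionGrows : ℤ → EllipticCurve → Set
TorsionGrows d E =
  Σ (QuadField.Pt d) λ P →
    QuadField.OnCurve d W P × QuadField.IsTorsion d W P × ¬ QuadField.Rational d W P
  where
  W = EllipticCurve.eqn E

{-# OPTIONS --safe #-}
module Submission where

-- Write π = √d, a uniformiser of 𝒪 = ℤ₍₂₎[√d] because d is twice a 2-adic unit, and P̄ for the
-- conjugate of a point P of E(K).  Suppose that E has good reduction at 2, and let P be torsion.
-- Then Q = P − P̄ is torsion.  Conjugation is the identity modulo 2π on 𝒪, so on a model with good
-- reduction P and P̄ agree to third order at the prime π: either Q = O or 1/x(Q) ∈ 8 𝒪.  Precisely,
-- the slope of the line through P and −P̄ is (y + ȳ + …)/(x − x̄) = (x² + x x̄ + x̄² + …)/(y − ȳ),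
-- and by nonsingularity modulo π one of these has a unit numerator over a denominator in 2π 𝒪 (near
-- the point O, the second one after scaling by t = x/y).  By the duplication formula, 1/x(2R) is 4/x(R)
-- times a unit for such points R, so no two of the points 2ⁱQ coincide, contradicting torsion.  Hence
-- Q = O and P is rational.
--
-- Associativity of the group law: P + Q + R = O means that y² = f(x) restricted to some line
-- y = m x + n factors as ∏ (x − xᵢ).  If A + B = S and S + C = −T, the two lines multiply to (x − s) g
-- with g = x² + βx + γ + δy, and g(x, y) g(x, −y) = (x − a)(x − b)(x − c)(x − t) is symmetric in the four points;
-- dividing g by the line through B and C yields the line through A, T and B + C.

-- Third order is exactly what the argument needs. For the valuation v of π one has v(2) = 2, so the
-- formal group of E can have 2-power torsion only up to level v(2)/(2 - 1) = 2, while conjugation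
-- moves integral elements by multiples of 2π, of valuation 3. The 8 in 1/x ∈ 8 𝒪 is (2π)² up to a
-- unit, x having a double pole in the formal parameter. In place of the formal group the proof
-- follows only the abscissa, and only under doubling, which serves torsion of odd and of even order
-- alike.
--
-- The group law is studied after completing the square, which is harmless over K but not integral
-- at 2. Integrality is therefore read off in the coordinates of the model with good reduction, to
-- which lines are carried over and where the square is undone. No completion of K is taken:
-- integrality and parity are conditions on rational numbers with odd denominator, imposed on the
-- rational and the irrational part of an element of K.

open import Algebra.Bundles using (CommutativeRing; AbelianGroup)
open import Algebra.Consequences.Propositional using (comm∧idˡ⇒id; comm∧invˡ⇒inv; comm∧distrˡ⇒distrʳ)
import Algebra.Properties.CommutativeMonoid.Mult as CommutativeMultiples
import Algebra.Properties.CommutativeSemigroup as SemigroupProperties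
import Algebra.Properties.Group as GroupProperties
import Algebra.Properties.Monoid.Mult as Multiples
import Algebra.Properties.Ring as RingProperties
open import Algebra.Structures using (IsCommutativeRing)
open import Data.Bool using (Bool; true; false; T; not; _∧_; _∨_; _xor_; if_then_else_)
open import Data.Bool.Properties using (T-∧; xor-identityʳ)
open import Data.Empty using (⊥; ⊥-elim)
import Data.Empty.Irrelevant as Irrelevant
open import Data.Fin using (Fin; zero; suc; toℕ; fromℕ<)
open import Data.Fin.Properties using (pigeonhole; toℕ-fromℕ<)
open import Data.Integer as ℤ using (ℤ; +_; -[1+_]; ∣_∣)
open import Data.Integer.DivMod as ℤDM using (a≡a%n+[a/n]*n; n%d<d)
open import Data.Integer.Divisibility.Signed using (divides; ∣ᵤ⇒∣)
import Data.Integer.Properties as ℤₚ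
import Data.Integer.Tactic.RingSolver as ℤ-Solver
open import Data.List using (List; []; _∷_)
open import Data.Nat as ℕ using (ℕ; zero; suc)
import Data.Nat.DivMod as ℕDM
import Data.Nat.Divisibility as ℕD
import Data.Nat.Properties as ℕₚ
open import Data.Product using (Σ; ∃; ∃₂; _×_; _,_; proj₁; proj₂)
open import Data.Sum using (_⊎_; inj₁; inj₂)
open import Data.Unit using (⊤; tt)
open import Data.Vec using (Vec; []; _∷_; lookup; allFin) renaming (map to mapᵥ)
open import Data.Vec.N-ary using (N-ary; _$ⁿ_)
open import Data.Vec.Properties using (lookup-map)
open import Function.Bundles using (Equivalence)
open import Level using (0ℓ)
open import Relation.Binary.Definitions using (DecidableEquality)
open import Relation.Binary.PropositionalEquality hiding (setoid)
open import Relation.Nullary using (¬_; yes; no)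

-- Polynomial identities over a field

-- Subtraction and the integer constants `φ` belong to the structure, so that interpreted
-- expressions agree definitionally with the formulas that define the curve and the arithmetic of K.
record Field : Set₁ where
  infix  8 -_
  infixl 7 _*_
  infixl 6 _+_ _-_
  infix  4 _≟_
  field
    Carrier           : Set
    _+_ _*_ _-_       : Carrier → Carrier → Carrier
    -_ inv            : Carrier → Carrier
    φ                 : ℤ → Carrier
    isCommutativeRing : IsCommutativeRing _≡_ _+_ _*_ -_ (φ (+ 0)) (φ (+ 1))
    x-y≡x+-y          : ∀ x y → x - y ≡ x + - y
    φ-+               : ∀ m n → φ (m ℤ.+ n) ≡ φ m + φ n
    φ-*               : ∀ m n → φ (m ℤ.* n) ≡ φ m * φ n
    _≟_               : DecidableEquality Carrier
    inverseʳ          : ∀ {x} → x ≢ φ (+ 0) → x * inv x ≡ φ (+ 1)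

-- Polynomial identities with integer coefficients are decided by expanding
-- into dense iterated Horner form.

infix  8 :-_
infixl 7 _:*_
infixl 6 _:+_ _:-_
infix  5 _⊜_
infix  4 _by_ ⊢_
infixr 3 _⇒_

data Expr (n : ℕ) : Set where
  var            : Fin n → Expr n
  con            : ℤ → Expr n
  _:+_ _:*_ _:-_ : Expr n → Expr n → Expr n
  :-_            : Expr n → Expr n

record Equation (n : ℕ) : Set where
  constructor _⊜_
  field lhs rhs : Expr n

record Hypothesis (n : ℕ) : Set where
  constructor _by_
  field
    equation : Equation n
    cofactor : Expr n

-- Each hypothesis carries the multiplier with which it enters the linear
-- combination that yields the conclusion.
data Sequent (n : ℕ) : Set where
  ⊢_  : Equation n → Sequent n
  _⇒_ : Hypothesis n → Sequent n → Sequent n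

Poly : ℕ → Set
Poly zero    = ℤ
Poly (suc n) = List (Poly n)

constant : ∀ n → ℤ → Poly n
constant zero    z = z
constant (suc n) z = constant n z ∷ []

zero-poly : ∀ n → Poly n
zero-poly zero    = + 0
zero-poly (suc n) = []

variable-poly : ∀ {n} → Fin n → Poly n
variable-poly {suc n} zero    = zero-poly n ∷ constant n (+ 1) ∷ []
variable-poly {suc n} (suc i) = variable-poly i ∷ []

add : ∀ n → Poly n → Poly n → Poly n
add zero    p        q        = p ℤ.+ q
add (suc n) []       q        = q
add (suc n) (a ∷ p)  []       = a ∷ p
add (suc n) (a ∷ p)  (b ∷ q)  = add n a b ∷ add (suc n) p q

mul : ∀ n → Poly n → Poly n → Poly n
scale : ∀ n → Poly n → List (Poly n) → List (Poly n)
mul zero    p       q = p ℤ.* q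
mul (suc n) []      q = []
mul (suc n) (a ∷ p) q = add (suc n) (scale n a q) (zero-poly n ∷ mul (suc n) p q)
scale n a []      = []
scale n a (b ∷ q) = mul n a b ∷ scale n a q

expand : ∀ {n} → Expr n → Poly n
expand {n} (var i)  = variable-poly i
expand {n} (con z)  = constant n z
expand {n} (e :+ f) = add n (expand e) (expand f)
expand {n} (e :* f) = mul n (expand e) (expand f)
expand {n} (e :- f) = add n (expand e) (mul n (constant n -[1+ 0 ]) (expand f))
expand {n} (:- e)   = mul n (constant n -[1+ 0 ]) (expand e)

-- `add` and `mul` never trim trailing zeros, so zero has many representations and every coefficient
-- is inspected.
isZero : ∀ n → Poly n → Bool
isZero zero    (+ 0)    = true
isZero zero    _        = false
isZero (suc n) []       = true
isZero (suc n) (a ∷ p)  = isZero n a ∧ isZero (suc n) p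

-- `c` accumulates the sum of m · (l - r) over the hypotheses met so far. The sequent is valid if
-- this sum and the difference of the two sides of the conclusion have the same expansion.
residue : ∀ {n} → Expr n → Sequent n → Expr n
residue c (⊢ (l ⊜ r))            = (l :- r) :- c
residue c (((l ⊜ r) by m) ⇒ s) = residue (c :+ m :* (l :- r)) s

valid : ∀ n → N-ary n (Expr n) (Sequent n) → Bool
valid n s = isZero n (expand (residue (con (+ 0)) (s $ⁿ mapᵥ var (allFin n))))

module Identities (F : Field) where
  open Field F

  commutativeRing : CommutativeRing 0ℓ 0ℓ
  commutativeRing = record { isCommutativeRing = isCommutativeRing }

  open CommutativeRing commutativeRing public
    using ( +-assoc; +-comm; +-identityˡ; +-identityʳ; *-assoc; *-comm; *-identityˡ; *-identityʳ
          ; distribˡ; distribʳ; zeroˡ; zeroʳ; -‿inverseˡ; -‿inverseʳ; ring; +-commutativeSemigroup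
          ; *-commutativeSemigroup )
  open RingProperties ring using () renaming (+-inverseˡ-unique to inverseˡ-unique)
  open SemigroupProperties +-commutativeSemigroup using () renaming (interchange to +-interchange)
  open SemigroupProperties *-commutativeSemigroup using (x∙yz≈y∙xz)

  0# 1# : Carrier
  0# = φ (+ 0)
  1# = φ (+ 1)

  private
    -1*x≡-x : ∀ x → φ -[1+ 0 ] * x ≡ - x
    -1*x≡-x x = inverseˡ-unique _ _ (begin
      φ -[1+ 0 ] * x + x        ≡⟨ cong (λ u → φ -[1+ 0 ] * x + u) (sym (*-identityˡ x)) ⟩
      φ -[1+ 0 ] * x + 1# * x   ≡⟨ sym (distribʳ x _ _) ⟩
      (φ -[1+ 0 ] + 1#) * x     ≡⟨ cong (_* x) (sym (φ-+ -[1+ 0 ] (+ 1))) ⟩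
      0# * x                    ≡⟨ zeroˡ x ⟩
      0#                        ∎)
      where open ≡-Reasoning

  ⟦_⟧ : ∀ {n} → Expr n → Vec Carrier n → Carrier
  ⟦ var i ⟧  ρ = lookup ρ i
  ⟦ con z ⟧  ρ = φ z
  ⟦ e :+ f ⟧ ρ = ⟦ e ⟧ ρ + ⟦ f ⟧ ρ
  ⟦ e :* f ⟧ ρ = ⟦ e ⟧ ρ * ⟦ f ⟧ ρ
  ⟦ e :- f ⟧ ρ = ⟦ e ⟧ ρ - ⟦ f ⟧ ρ
  ⟦ :- e ⟧   ρ = - ⟦ e ⟧ ρ

  ⟦_⟧ˢ : ∀ {n} → Sequent n → Vec Carrier n → Set
  ⟦ ⊢ (l ⊜ r) ⟧ˢ            ρ = ⟦ l ⟧ ρ ≡ ⟦ r ⟧ ρ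
  ⟦ ((l ⊜ r) by m) ⇒ s ⟧ˢ ρ = ⟦ l ⟧ ρ ≡ ⟦ r ⟧ ρ → ⟦ s ⟧ˢ ρ

  private
    eval : ∀ n → Poly n → Vec Carrier n → Carrier
    eval zero    z       []      = φ z
    eval (suc n) []      (x ∷ ρ) = 0#
    eval (suc n) (a ∷ p) (x ∷ ρ) = eval n a ρ + x * eval (suc n) p (x ∷ ρ)

    open ≡-Reasoning

    eval-singleton : ∀ n a x (ρ : Vec Carrier n) → eval (suc n) (a ∷ []) (x ∷ ρ) ≡ eval n a ρ
    eval-singleton n a x ρ = trans (cong (λ u → eval n a ρ + u) (zeroʳ x)) (+-identityʳ _)

    eval-constant : ∀ n z ρ → eval n (constant n z) ρ ≡ φ z
    eval-constant zero    z []      = refl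
    eval-constant (suc n) z (x ∷ ρ) = trans (eval-singleton n _ x ρ) (eval-constant n z ρ)

    eval-zero : ∀ n ρ → eval n (zero-poly n) ρ ≡ 0#
    eval-zero zero    []      = refl
    eval-zero (suc n) (x ∷ ρ) = refl

    eval-variable : ∀ {n} (i : Fin n) ρ → eval n (variable-poly i) ρ ≡ lookup ρ i
    eval-variable {suc n} zero (x ∷ ρ) = begin
      eval n (zero-poly n) ρ + x * eval (suc n) (constant n (+ 1) ∷ []) (x ∷ ρ)
        ≡⟨ cong₂ (λ a b → a + x * b) (eval-zero n ρ) (eval-constant (suc n) _ (x ∷ ρ)) ⟩
      0# + x * 1#  ≡⟨ +-identityˡ _ ⟩
      x * 1#       ≡⟨ *-identityʳ x ⟩
      x            ∎
    eval-variable {suc n} (suc i) (x ∷ ρ) = trans (eval-singleton n _ x ρ) (eval-variable i ρ)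

    eval-add : ∀ n p q ρ → eval n (add n p q) ρ ≡ eval n p ρ + eval n q ρ
    eval-add zero    p       q       []      = φ-+ p q
    eval-add (suc n) []      q       (x ∷ ρ) = sym (+-identityˡ _)
    eval-add (suc n) (a ∷ p) []      (x ∷ ρ) = sym (+-identityʳ _)
    eval-add (suc n) (a ∷ p) (b ∷ q) (x ∷ ρ) = begin
      eval n (add n a b) ρ + x * eval (suc n) (add (suc n) p q) (x ∷ ρ)
        ≡⟨ cong₂ (λ u v → u + x * v) (eval-add n a b ρ) (eval-add (suc n) p q (x ∷ ρ)) ⟩
      (eval n a ρ + eval n b ρ) + x * (eval (suc n) p (x ∷ ρ) + eval (suc n) q (x ∷ ρ))
        ≡⟨ cong (λ u → eval n a ρ + eval n b ρ + u) (distribˡ x _ _) ⟩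
      (eval n a ρ + eval n b ρ) + (x * eval (suc n) p (x ∷ ρ) + x * eval (suc n) q (x ∷ ρ))
        ≡⟨ +-interchange _ _ _ _ ⟩
      _ ∎

    eval-mul : ∀ n p q ρ → eval n (mul n p q) ρ ≡ eval n p ρ * eval n q ρ
    eval-scale : ∀ n a q x ρ →
      eval (suc n) (scale n a q) (x ∷ ρ) ≡ eval n a ρ * eval (suc n) q (x ∷ ρ)
    eval-mul zero    p       q []      = φ-* p q
    eval-mul (suc n) []      q (x ∷ ρ) = sym (zeroˡ _)
    eval-mul (suc n) (a ∷ p) q (x ∷ ρ) = begin
      eval (suc n) (add (suc n) (scale n a q) (zero-poly n ∷ mul (suc n) p q)) (x ∷ ρ)
        ≡⟨ eval-add (suc n) (scale n a q) _ (x ∷ ρ) ⟩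
      eval (suc n) (scale n a q) (x ∷ ρ)
        + (eval n (zero-poly n) ρ + x * eval (suc n) (mul (suc n) p q) (x ∷ ρ))
        ≡⟨ cong₂ _+_ (eval-scale n a q x ρ)
             (trans (cong₂ (λ u v → u + x * v) (eval-zero n ρ) (eval-mul (suc n) p q (x ∷ ρ)))
                    (+-identityˡ _)) ⟩
      eval n a ρ * eval (suc n) q (x ∷ ρ) + x * (eval (suc n) p (x ∷ ρ) * eval (suc n) q (x ∷ ρ))
        ≡⟨ cong (λ u → eval n a ρ * eval (suc n) q (x ∷ ρ) + u) (sym (*-assoc x _ _)) ⟩
      eval n a ρ * eval (suc n) q (x ∷ ρ) + x * eval (suc n) p (x ∷ ρ) * eval (suc n) q (x ∷ ρ)
        ≡⟨ sym (distribʳ _ _ _) ⟩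
      _ ∎
    eval-scale n a []      x ρ = sym (zeroʳ _)
    eval-scale n a (b ∷ q) x ρ = begin
      eval n (mul n a b) ρ + x * eval (suc n) (scale n a q) (x ∷ ρ)
        ≡⟨ cong₂ (λ u v → u + x * v) (eval-mul n a b ρ) (eval-scale n a q x ρ) ⟩
      eval n a ρ * eval n b ρ + x * (eval n a ρ * eval (suc n) q (x ∷ ρ))
        ≡⟨ cong (λ u → eval n a ρ * eval n b ρ + u) (x∙yz≈y∙xz x _ _) ⟩
      eval n a ρ * eval n b ρ + eval n a ρ * (x * eval (suc n) q (x ∷ ρ))
        ≡⟨ sym (distribˡ _ _ _) ⟩
      _ ∎

    eval-neg : ∀ n p ρ → eval n (mul n (constant n -[1+ 0 ]) p) ρ ≡ - eval n p ρ
    eval-neg n p ρ = begin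
      eval n (mul n (constant n -[1+ 0 ]) p) ρ        ≡⟨ eval-mul n _ p ρ ⟩
      eval n (constant n -[1+ 0 ]) ρ * eval n p ρ     ≡⟨ cong (_* eval n p ρ) (eval-constant n _ ρ) ⟩
      φ -[1+ 0 ] * eval n p ρ                         ≡⟨ -1*x≡-x _ ⟩
      - eval n p ρ                                    ∎

    eval-expand : ∀ {n} (e : Expr n) ρ → eval n (expand e) ρ ≡ ⟦ e ⟧ ρ
    eval-expand (var i)  ρ = eval-variable i ρ
    eval-expand (con z)  ρ = eval-constant _ z ρ
    eval-expand (e :+ f) ρ =
      trans (eval-add _ (expand e) (expand f) ρ) (cong₂ _+_ (eval-expand e ρ) (eval-expand f ρ))
    eval-expand (e :* f) ρ =
      trans (eval-mul _ (expand e) (expand f) ρ) (cong₂ _*_ (eval-expand e ρ) (eval-expand f ρ))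
    eval-expand (e :- f) ρ =
      trans (eval-add _ (expand e) _ ρ)
        (trans (cong₂ _+_ (eval-expand e ρ) (trans (eval-neg _ (expand f) ρ) (cong -_ (eval-expand f ρ))))
          (sym (x-y≡x+-y _ _)))
    eval-expand (:- e)   ρ = trans (eval-neg _ (expand e) ρ) (cong -_ (eval-expand e ρ))

    eval-isZero : ∀ n p ρ → T (isZero n p) → eval n p ρ ≡ 0#
    eval-isZero zero    (+ 0)   []      _ = refl
    eval-isZero (suc n) []      (x ∷ ρ) _ = refl
    eval-isZero (suc n) (a ∷ p) (x ∷ ρ) t with isZero n a in eq
    ... | true = begin
      eval n a ρ + x * eval (suc n) p (x ∷ ρ)
        ≡⟨ cong₂ (λ u v → u + x * v) (eval-isZero n a ρ (subst T (sym eq) _)) (eval-isZero (suc n) p (x ∷ ρ) t) ⟩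
      0# + x * 0#  ≡⟨ +-identityˡ _ ⟩
      x * 0#       ≡⟨ zeroʳ x ⟩
      0#           ∎

  x-y≡0⇒x≡y : ∀ {x y} → x - y ≡ 0# → x ≡ y
  x-y≡0⇒x≡y {x} {y} eq = begin
    x              ≡⟨ sym (+-identityʳ x) ⟩
    x + 0#         ≡⟨ cong (λ u → x + u) (sym (-‿inverseˡ y)) ⟩
    x + (- y + y)  ≡⟨ sym (+-assoc x (- y) y) ⟩
    x + - y + y    ≡⟨ cong (_+ y) (trans (sym (x-y≡x+-y x y)) eq) ⟩
    0# + y         ≡⟨ +-identityˡ y ⟩
    y              ∎
    where open ≡-Reasoning

  x≡y⇒x-y≡0 : ∀ {x y} → x ≡ y → x - y ≡ 0#
  x≡y⇒x-y≡0 {x} refl = trans (x-y≡x+-y x x) (-‿inverseʳ x)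

  private
    sound : ∀ {n} (c : Expr n) (s : Sequent n) ρ → ⟦ c ⟧ ρ ≡ 0# →
            ⟦ residue c s ⟧ ρ ≡ 0# → ⟦ s ⟧ˢ ρ
    sound c (⊢ (l ⊜ r)) ρ c≡0 z =
      x-y≡0⇒x≡y (trans (x-y≡0⇒x≡y z) c≡0)
    sound c (((l ⊜ r) by m) ⇒ s) ρ c≡0 z l≡r = sound (c :+ m :* (l :- r)) s ρ
      (trans (cong₂ _+_ c≡0 (trans (cong (⟦ m ⟧ ρ *_) (x≡y⇒x-y≡0 l≡r)) (zeroʳ _))) (+-identityˡ _)) z

  ∀[_]_ : ∀ n → (Vec Carrier n → Set) → Set
  ∀[ zero ] P  = P []
  ∀[ suc n ] P = ∀ x → ∀[ n ] λ ρ → P (x ∷ ρ)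

  generalise : ∀ n {P : Vec Carrier n → Set} → (∀ ρ → P ρ) → ∀[ n ] P
  generalise zero    p   = p []
  generalise (suc n) p x = generalise n (λ ρ → p (x ∷ ρ))

  -- The implicit argument has type `⊤` once `valid` evaluates to `true`: type checking carries out
  -- the expansion, and a wrong multiplier is a type error.
  entail : ∀ n (s : N-ary n (Expr n) (Sequent n)) {_ : T (valid n s)} →
           ∀[ n ] ⟦ s $ⁿ mapᵥ var (allFin n) ⟧ˢ
  entail n s {t} = generalise n λ ρ → sound (con (+ 0)) s′ ρ refl
      (trans (sym (eval-expand (residue (con (+ 0)) s′) ρ))
             (eval-isZero n (expand (residue (con (+ 0)) s′)) ρ t))
    where s′ = s $ⁿ mapᵥ var (allFin n)

  0≢⇒cancel : ∀ {x y} → x ≢ 0# → x * y ≡ 0# → y ≡ 0#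
  0≢⇒cancel {x} {y} x≢0 =
    (entail 3 λ x y i → x :* i ⊜ con (+ 1) by :- y ⇒ x :* y ⊜ con (+ 0) by i ⇒ ⊢ y ⊜ con (+ 0))
      x y (inv x) (inverseʳ x≢0)

module Homomorphism
  (F G : Field) (f : Field.Carrier F → Field.Carrier G)
  (f-+ : ∀ x y → f (Field._+_ F x y) ≡ Field._+_ G (f x) (f y))
  (f-* : ∀ x y → f (Field._*_ F x y) ≡ Field._*_ G (f x) (f y))
  (f-neg : ∀ x → f (Field.-_ F x) ≡ Field.-_ G (f x))
  (f-φ : ∀ z → f (Field.φ F z) ≡ Field.φ G z)
  where

  private
    module F = Field F
    module G = Field G
    module F′ = Identities F
    module G′ = Identities G

  homo : ∀ {n} (e : Expr n) ρ → f (F′.⟦ e ⟧ ρ) ≡ G′.⟦ e ⟧ (mapᵥ f ρ)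
  homo (var i)  ρ = sym (lookup-map i f ρ)
  homo (con z)  ρ = f-φ z
  homo (e :+ e′) ρ = trans (f-+ _ _) (cong₂ G._+_ (homo e ρ) (homo e′ ρ))
  homo (e :* e′) ρ = trans (f-* _ _) (cong₂ G._*_ (homo e ρ) (homo e′ ρ))
  homo (e :- e′) ρ = begin
    f (F′.⟦ e ⟧ ρ F.- F′.⟦ e′ ⟧ ρ)           ≡⟨ cong f (F.x-y≡x+-y _ _) ⟩
    f (F′.⟦ e ⟧ ρ F.+ F.- F′.⟦ e′ ⟧ ρ)       ≡⟨ f-+ _ _ ⟩
    f (F′.⟦ e ⟧ ρ) G.+ f (F.- F′.⟦ e′ ⟧ ρ)   ≡⟨ cong₂ G._+_ (homo e ρ) (trans (f-neg _) (cong G.-_ (homo e′ ρ))) ⟩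
    _                                        ≡⟨ sym (G.x-y≡x+-y _ _) ⟩
    _                                        ∎
    where open ≡-Reasoning
  homo (:- e)   ρ = trans (f-neg _) (cong G.-_ (homo e ρ))

  -- Serves the embedding of ℚ in K and conjugation, either of which it moves past a whole
  -- polynomial at once.
  transport : ∀ n (g : N-ary n (Expr n) (Expr n)) →
              F′.∀[ n ] λ ρ → f (F′.⟦ g $ⁿ mapᵥ var (allFin n) ⟧ ρ) ≡ G′.⟦ g $ⁿ mapᵥ var (allFin n) ⟧ (mapᵥ f ρ)
  transport n g = F′.generalise n λ ρ → homo (g $ⁿ mapᵥ var (allFin n)) ρ

-- The group law by collinearity

module Cubic (F : Field) where

  open Field F
  open Identities F

  module Curve
    (2≢0 : φ (+ 2) ≢ 0#) (A B C : Carrier)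
    (smooth : ∀ x → x * x * x + A * x * x + B * x + C ≡ 0# →
                    φ (+ 3) * x * x + φ (+ 2) * A * x + B ≢ 0#)
    where

    infix 4 _∼_∼_

    record Affine : Set where
      constructor ⟨_,_⟩
      field x y : Carrier
    open Affine

    opposite : Affine → Affine
    opposite ⟨ x , y ⟩ = ⟨ x , - y ⟩

    -- The cubic restricted to the line y = m x + n is the product of the x − xᵢ.
    record _∼_∼_ (P Q R : Affine) : Set where
      constructor line
      field
        m n : Carrier
        on₁ : y P ≡ m * x P + n
        on₂ : y Q ≡ m * x Q + n
        on₃ : y R ≡ m * x R + n
        σ₁  : x P + x Q + x R + A ≡ m * m
        σ₂  : x P * x Q + x Q * x R + x R * x P + φ (+ 2) * m * n ≡ B
        σ₃  : x P * x Q * x R + C ≡ n * n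

    ∼-rotate : ∀ {P Q R} → P ∼ Q ∼ R → Q ∼ R ∼ P
    ∼-rotate {⟨ a , _ ⟩} {⟨ b , _ ⟩} {⟨ c , _ ⟩} (line m n on₁ on₂ on₃ σ₁ σ₂ σ₃) =
      line m n on₂ on₃ on₁
        ((entail 5 λ a b c m A → a :+ b :+ c :+ A ⊜ m :* m by con (+ 1) ⇒ ⊢ b :+ c :+ a :+ A ⊜ m :* m)
          a b c m A σ₁)
        ((entail 5 λ a b c k B → a :* b :+ b :* c :+ c :* a :+ k ⊜ B by con (+ 1) ⇒
          ⊢ b :* c :+ c :* a :+ a :* b :+ k ⊜ B) a b c _ B σ₂)
        ((entail 5 λ a b c n C → a :* b :* c :+ C ⊜ n :* n by con (+ 1) ⇒ ⊢ b :* c :* a :+ C ⊜ n :* n)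
          a b c n C σ₃)

    ∼-swap : ∀ {P Q R} → P ∼ Q ∼ R → Q ∼ P ∼ R
    ∼-swap {⟨ a , _ ⟩} {⟨ b , _ ⟩} {⟨ c , _ ⟩} (line m n on₁ on₂ on₃ σ₁ σ₂ σ₃) =
      line m n on₂ on₁ on₃
        ((entail 5 λ a b c m A → a :+ b :+ c :+ A ⊜ m :* m by con (+ 1) ⇒ ⊢ b :+ a :+ c :+ A ⊜ m :* m)
          a b c m A σ₁)
        ((entail 5 λ a b c k B → a :* b :+ b :* c :+ c :* a :+ k ⊜ B by con (+ 1) ⇒
          ⊢ b :* a :+ a :* c :+ c :* b :+ k ⊜ B) a b c _ B σ₂)
        ((entail 5 λ a b c n C → a :* b :* c :+ C ⊜ n :* n by con (+ 1) ⇒ ⊢ b :* a :* c :+ C ⊜ n :* n)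
          a b c n C σ₃)

    ∼-opposite : ∀ {P Q R} → P ∼ Q ∼ R → opposite P ∼ opposite Q ∼ opposite R
    ∼-opposite {⟨ a , y₁ ⟩} {⟨ b , y₂ ⟩} {⟨ c , y₃ ⟩} (line m n on₁ on₂ on₃ σ₁ σ₂ σ₃) =
      line (- m) (- n) (negate a y₁ m n on₁) (negate b y₂ m n on₂) (negate c y₃ m n on₃)
        (trans σ₁ ((entail 1 λ m → ⊢ m :* m ⊜ (:- m) :* (:- m)) m))
        ((entail 4 λ k m n B → k :+ con (+ 2) :* m :* n ⊜ B by con (+ 1) ⇒
          ⊢ k :+ con (+ 2) :* (:- m) :* (:- n) ⊜ B) _ m n B σ₂)
        (trans σ₃ ((entail 1 λ n → ⊢ n :* n ⊜ (:- n) :* (:- n)) n))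
      where
      negate = entail 4 λ x y m n → y ⊜ m :* x :+ n by con -[1+ 0 ] ⇒ ⊢ :- y ⊜ (:- m) :* x :+ (:- n)

    OnCubic : Affine → Set
    OnCubic ⟨ x , y ⟩ = y * y ≡ x * x * x + A * x * x + B * x + C

    ∼⇒OnCubic : ∀ {P Q R} → P ∼ Q ∼ R → OnCubic P
    ∼⇒OnCubic {⟨ a , y₁ ⟩} {⟨ b , _ ⟩} {⟨ c , _ ⟩} (line m n on₁ on₂ on₃ σ₁ σ₂ σ₃) =
      (entail 9 λ a b c y m n A B C →
        y ⊜ m :* a :+ n by y :+ m :* a :+ n ⇒
        a :+ b :+ c :+ A ⊜ m :* m by :- a :* a ⇒
        a :* b :+ b :* c :+ c :* a :+ con (+ 2) :* m :* n ⊜ B by a ⇒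
        a :* b :* c :+ C ⊜ n :* n by con -[1+ 0 ] ⇒
        ⊢ y :* y ⊜ a :* a :* a :+ A :* a :* a :+ B :* a :+ C)
        a b c y₁ m n A B C on₁ σ₁ σ₂ σ₃

    -- Differentiating f − (m x + n)² = (x − a)(x − b)(x − c) at x = b.
    derivative : ∀ {P Q R} (l : P ∼ Q ∼ R) → let open _∼_∼_ l in
      φ (+ 3) * x Q * x Q + φ (+ 2) * A * x Q + B
        ≡ φ (+ 2) * y Q * m + (x Q - x P) * (x Q - x R)
    derivative {⟨ a , _ ⟩} {⟨ b , y₂ ⟩} {⟨ c , _ ⟩} (line m n on₁ on₂ on₃ σ₁ σ₂ σ₃) =
      (entail 8 λ a b c y m n A B →
        y ⊜ m :* b :+ n by con -[1+ 1 ] :* m ⇒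
        a :+ b :+ c :+ A ⊜ m :* m by con (+ 2) :* b ⇒
        a :* b :+ b :* c :+ c :* a :+ con (+ 2) :* m :* n ⊜ B by con -[1+ 0 ] ⇒
        ⊢ con (+ 3) :* b :* b :+ con (+ 2) :* A :* b :+ B
          ⊜ con (+ 2) :* y :* m :+ (b :- a) :* (b :- c))
        a b c y₂ m n A B on₂ σ₁ σ₂

    x≡⇒y≡ : ∀ {P Q R} → P ∼ Q ∼ R → x P ≡ x Q → y P ≡ y Q
    x≡⇒y≡ l refl = trans (_∼_∼_.on₁ l) (sym (_∼_∼_.on₂ l))

    -- A double root of f - (m x + n)² where y vanishes would be a double root of f, by
    -- `derivative`.
    tangent-y≢0 : ∀ {P Q R} → P ∼ Q ∼ R → x P ≡ x Q → φ (+ 2) * y Q ≢ 0#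
    tangent-y≢0 {⟨ a , y₁ ⟩} {⟨ b , y₂ ⟩} {⟨ c , _ ⟩} l refl 2y≡0 =
      smooth a (trans (sym (∼⇒OnCubic (∼-swap l))) y²≡0)
        (trans (derivative l)
          ((entail 4 λ t m a c → t ⊜ con (+ 0) by m ⇒ ⊢ t :* m :+ (a :- a) :* (a :- c) ⊜ con (+ 0))
            _ (_∼_∼_.m l) a c 2y≡0))
      where
      y²≡0 : y₂ * y₂ ≡ 0#
      y²≡0 = trans (cong (_* y₂) (0≢⇒cancel 2≢0 2y≡0)) (zeroˡ y₂)

    -- The line through P and -P is vertical unless y = 0, and y = 0 is excluded by `tangent-y≢0`.
    ∼-opposite-absurd : ∀ {P R} → P ∼ opposite P ∼ R → ⊥
    ∼-opposite-absurd {⟨ a , y₁ ⟩} l = tangent-y≢0 l refl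
      ((entail 1 λ y → y ⊜ :- y by con -[1+ 0 ] ⇒ ⊢ con (+ 2) :* (:- y) ⊜ con (+ 0)) y₁ (x≡⇒y≡ l refl))

    -- The slope is (y₁ - y₂)/(a - b), or f′/(2y) when a = b. It determines the intercept, then the
    -- third abscissa through `σ₁`, then the ordinate.
    ∼-unique : ∀ {P Q R S} → P ∼ Q ∼ R → P ∼ Q ∼ S → R ≡ S
    ∼-unique {⟨ a , y₁ ⟩} {⟨ b , y₂ ⟩} {⟨ c , y₃ ⟩} {⟨ d , y₄ ⟩}
             l@(line m n on₁ on₂ on₃ σ₁ σ₂ σ₃) l′@(line m′ n′ on₁′ on₂′ on₃′ σ₁′ σ₂′ σ₃′)
      with m≡m′
      where
      m≡m′ : m ≡ m′
      m≡m′ with a ≟ b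
      ... | no a≢b = x-y≡0⇒x≡y (0≢⇒cancel (λ eq → a≢b (x-y≡0⇒x≡y eq))
        ((entail 8 λ a b y₁ y₂ m n m′ n′ →
          y₁ ⊜ m :* a :+ n by con -[1+ 0 ] ⇒ y₂ ⊜ m :* b :+ n by con (+ 1) ⇒
          y₁ ⊜ m′ :* a :+ n′ by con (+ 1) ⇒ y₂ ⊜ m′ :* b :+ n′ by con -[1+ 0 ] ⇒
          ⊢ (a :- b) :* (m :- m′) ⊜ con (+ 0)) a b y₁ y₂ m n m′ n′ on₁ on₂ on₁′ on₂′))
      ... | yes refl = x-y≡0⇒x≡y (0≢⇒cancel (tangent-y≢0 l refl)
        ((entail 7 λ a c d t m m′ k →
          k ⊜ t :* m :+ (a :- a) :* (a :- c) by con -[1+ 0 ] ⇒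
          k ⊜ t :* m′ :+ (a :- a) :* (a :- d) by con (+ 1) ⇒
          ⊢ t :* (m :- m′) ⊜ con (+ 0)) a c d (φ (+ 2) * y₂) m m′ _ (derivative l) (derivative l′)))
    ... | refl with (entail 5 λ a y m n n′ →
          y ⊜ m :* a :+ n by con -[1+ 0 ] ⇒ y ⊜ m :* a :+ n′ by con (+ 1) ⇒ ⊢ n ⊜ n′) a y₁ m n n′ on₁ on₁′
    ... | refl with (entail 6 λ a b c d A k → a :+ b :+ c :+ A ⊜ k by con (+ 1) ⇒
          a :+ b :+ d :+ A ⊜ k by con -[1+ 0 ] ⇒ ⊢ c ⊜ d) a b c d A _ σ₁ σ₁′
    ... | refl = cong ⟨ c ,_⟩ (trans on₃ (sym on₃′))

    private
      -- With P at (a,y), the lines through P and S and through −S and T multiply to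
      -- (x − s)(x² + βx + γ + δy) on the cubic.
      vanishing = entail 10 λ a b s y z m n m′ A B →
        y ⊜ m :* a :+ n by :- (m :+ m′) ⇒
        z ⊜ m :* s :+ n by m′ :- m ⇒
        a :+ b :+ s :+ A ⊜ m :* m by a :+ s ⇒
        a :* b :+ b :* s :+ s :* a :+ con (+ 2) :* m :* n ⊜ B by con -[1+ 0 ] ⇒
        ⊢ a :* a :+ (s :+ A :+ m :* m′) :* a
            :+ (s :* s :+ A :* s :+ B :+ z :* (m′ :- m) :- m :* m′ :* s) :+ (:- (m :+ m′)) :* y ⊜ con (+ 0)

      vanishing′ = entail 10 λ c t s y z m m′ n′ A B →
        y ⊜ m′ :* c :+ n′ by :- (m :+ m′) ⇒
        :- z ⊜ m′ :* s :+ n′ by m :- m′ ⇒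
        s :+ c :+ t :+ A ⊜ m′ :* m′ by c :+ s ⇒
        s :* c :+ c :* t :+ t :* s :+ con (+ 2) :* m′ :* n′ ⊜ B by con -[1+ 0 ] ⇒
        ⊢ c :* c :+ (s :+ A :+ m :* m′) :* c
            :+ (s :* s :+ A :* s :+ B :+ z :* (m′ :- m) :- m :* m′ :* s) :+ (:- (m :+ m′)) :* y ⊜ con (+ 0)

      -- This and `norm₂` compare the coefficients of x³ and x² in (x² + βx + γ)² - δ² f = (x - a)(x
      -- - b)(x - c)(x - t), whose left side is g(x, y) g(x, -y).
      norm₃ = entail 8 λ a b c s t m m′ A →
        a :+ b :+ s :+ A ⊜ m :* m by con (+ 1) ⇒
        s :+ c :+ t :+ A ⊜ m′ :* m′ by con (+ 1) ⇒
        ⊢ con (+ 2) :* (s :+ A :+ m :* m′) :+ a :+ b :+ c :+ t ⊜ (:- (m :+ m′)) :* (:- (m :+ m′))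

      norm₂ = entail 12 λ a b c s t z m n m′ n′ A B →
        z ⊜ m :* s :+ n by con -[1+ 1 ] :* m ⇒
        :- z ⊜ m′ :* s :+ n′ by con -[1+ 1 ] :* m′ ⇒
        a :+ b :+ s :+ A ⊜ m :* m by A :+ con (+ 2) :* s :- m′ :* m′ ⇒
        s :+ c :+ t :+ A ⊜ m′ :* m′ by s :- a :- b ⇒
        a :* b :+ b :* s :+ s :* a :+ con (+ 2) :* m :* n ⊜ B by con -[1+ 0 ] ⇒
        s :* c :+ c :* t :+ t :* s :+ con (+ 2) :* m′ :* n′ ⊜ B by con -[1+ 0 ] ⇒
        ⊢ (s :+ A :+ m :* m′) :* (s :+ A :+ m :* m′)
            :+ con (+ 2) :* (s :* s :+ A :* s :+ B :+ z :* (m′ :- m) :- m :* m′ :* s)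
            :- (:- (m :+ m′)) :* (:- (m :+ m′)) :* A
          ⊜ b :* c :+ a :* t :+ (b :+ c) :* (a :+ t)

      tangential = entail 13 λ a b s t y z m n m′ n′ k A m₂ →
        k ⊜ con (+ 2) :* y :* m :+ (b :- a) :* (b :- s) by :- m′ ⇒
        k ⊜ con (+ 2) :* y :* m′ :+ (b :- s) :* (b :- t) by :- m ⇒
        k ⊜ con (+ 2) :* y :* m₂ by m :+ m′ ⇒
        y ⊜ m :* b :+ n by con (+ 2) :* b :+ s :+ A :- m :* m′ ⇒
        y ⊜ m′ :* b :+ n′ by con (+ 2) :* b :+ s :+ A :- m :* m′ ⇒
        z ⊜ m :* s :+ n by :- (con (+ 2) :* b :+ s :+ A :- m :* m′) ⇒
        :- z ⊜ m′ :* s :+ n′ by :- (con (+ 2) :* b :+ s :+ A :- m :* m′) ⇒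
        a :+ b :+ s :+ A ⊜ m :* m by m′ :* (b :- s) ⇒
        s :+ b :+ t :+ A ⊜ m′ :* m′ by m :* (b :- s) ⇒
        ⊢ con (+ 2) :* y :* (b :+ b :+ (s :+ A :+ m :* m′) :+ :- (m :+ m′) :* m₂) ⊜ con (+ 0)

      -- On the line y = m x + n through B and C, g becomes a monic quadratic with roots b and c.
      -- Its two Vieta relations are obtained here, up to the factor b - c, and in `constant-term`.
      secant = entail 9 λ b c y₂ y₃ β γ δ m n →
        b :* b :+ β :* b :+ γ :+ δ :* y₂ ⊜ con (+ 0) by con (+ 1) ⇒
        c :* c :+ β :* c :+ γ :+ δ :* y₃ ⊜ con (+ 0) by con -[1+ 0 ] ⇒
        y₂ ⊜ m :* b :+ n by :- δ ⇒
        y₃ ⊜ m :* c :+ n by δ ⇒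
        ⊢ (b :- c) :* (b :+ c :+ β :+ δ :* m) ⊜ con (+ 0)

      constant-term = entail 8 λ b c y β γ δ m n →
        b :* b :+ β :* b :+ γ :+ δ :* y ⊜ con (+ 0) by con (+ 1) ⇒
        b :+ c :+ β :+ δ :* m ⊜ con (+ 0) by :- b ⇒
        y ⊜ m :* b :+ n by :- δ ⇒
        ⊢ γ :+ δ :* n ⊜ b :* c

      -- Put x² + βx + γ = (x - b)(x - c) - δ(m x + n) and f = (m x + n)² + (x - b)(x - c)(x - u)
      -- into the norm of g. Cancelling (x - b)(x - c) leaves (x - a)(x - t) = x² + βx + γ - δ(m x +
      -- n) - δ²(x - u); this is its constant term.
      δ²u = entail 10 λ a b c t u β γ δ m A →
        con (+ 2) :* β :+ a :+ b :+ c :+ t ⊜ δ :* δ by b :+ c ⇒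
        β :* β :+ con (+ 2) :* γ :- δ :* δ :* A ⊜ b :* c :+ a :* t :+ (b :+ c) :* (a :+ t) by con (+ 1) ⇒
        b :+ c :+ u :+ A ⊜ m :* m by δ :* δ ⇒
        b :+ c :+ β :+ δ :* m ⊜ con (+ 0) by δ :* m :- b :- c :- β ⇒
        ⊢ δ :* δ :* u ⊜ a :* t :+ b :* c :- con (+ 2) :* γ

      -- Where g and (x - a)(x - t) both vanish, the quotient identity behind `δ²u` reads δ y = -δ(m
      -- x + n) - δ²(x - u). Dividing by δ gives the new line, of slope -δ - m and intercept δ u -
      -- n, which visibly also contains -U.
      on-new-line = entail 12 λ x a b c t u β γ δ m n y →
        (x :- a) :* (x :- t) ⊜ con (+ 0) by con -[1+ 0 ] ⇒
        x :* x :+ β :* x :+ γ :+ δ :* y ⊜ con (+ 0) by con (+ 1) ⇒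
        con (+ 2) :* β :+ a :+ b :+ c :+ t ⊜ δ :* δ by :- x ⇒
        b :+ c :+ β :+ δ :* m ⊜ con (+ 0) by x ⇒
        δ :* δ :* u ⊜ a :* t :+ b :* c :- con (+ 2) :* γ by con -[1+ 0 ] ⇒
        γ :+ δ :* n ⊜ b :* c by con (+ 1) ⇒
        ⊢ δ :* (y :- ((:- δ :- m) :* x :+ (δ :* u :- n))) ⊜ con (+ 0)

      new-σ₁ = entail 9 λ a b c t u β δ m A →
        b :+ c :+ u :+ A ⊜ m :* m by con (+ 1) ⇒
        b :+ c :+ β :+ δ :* m ⊜ con (+ 0) by con -[1+ 1 ] ⇒
        con (+ 2) :* β :+ a :+ b :+ c :+ t ⊜ δ :* δ by con (+ 1) ⇒
        ⊢ a :+ u :+ t :+ A ⊜ (:- δ :- m) :* (:- δ :- m)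

      new-σ₂ = entail 11 λ a b c t u β γ δ m n B →
        b :* c :+ c :* u :+ u :* b :+ con (+ 2) :* m :* n ⊜ B by con (+ 1) ⇒
        γ :+ δ :* n ⊜ b :* c by con (+ 2) ⇒
        b :+ c :+ β :+ δ :* m ⊜ con (+ 0) by con -[1+ 1 ] :* u ⇒
        con (+ 2) :* β :+ a :+ b :+ c :+ t ⊜ δ :* δ by u ⇒
        δ :* δ :* u ⊜ a :* t :+ b :* c :- con (+ 2) :* γ by con -[1+ 0 ] ⇒
        ⊢ a :* u :+ u :* t :+ t :* a :+ con (+ 2) :* (:- δ :- m) :* (δ :* u :- n) ⊜ B

      new-σ₃ = entail 9 λ a b c t u γ δ n C →
        b :* c :* u :+ C ⊜ n :* n by con (+ 1) ⇒
        γ :+ δ :* n ⊜ b :* c by con (+ 2) :* u ⇒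
        δ :* δ :* u ⊜ a :* t :+ b :* c :- con (+ 2) :* γ by :- u ⇒
        ⊢ a :* u :* t :+ C ⊜ (δ :* u :- n) :* (δ :* u :- n)

      opposite-lines = entail 12 λ a b c s t z m n m′ n′ A B →
        z ⊜ m :* s :+ n by con (+ 2) :* m ⇒
        :- z ⊜ m′ :* s :+ n′ by con -[1+ 1 ] :* m′ ⇒
        a :+ b :+ s :+ A ⊜ m :* m by :- (c :+ s) ⇒
        s :+ c :+ t :+ A ⊜ m′ :* m′ by c :+ s ⇒
        a :* b :+ b :* s :+ s :* a :+ con (+ 2) :* m :* n ⊜ B by con (+ 1) ⇒
        s :* c :+ c :* t :+ t :* s :+ con (+ 2) :* m′ :* n′ ⊜ B by con -[1+ 0 ] ⇒
        :- (m :+ m′) ⊜ con (+ 0) by (c :- s) :* (m :- m′) :+ con (+ 2) :* z ⇒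
        ⊢ (c :- a) :* (c :- b) ⊜ con (+ 0)

      opposite-y = entail 8 λ a s z y m n m′ n′ →
        (z ⊜ m :* s :+ n by con -[1+ 0 ]) ⇒
        ((:- z) ⊜ m′ :* s :+ n′ by con -[1+ 0 ]) ⇒
        (:- (m :+ m′) ⊜ con (+ 0) by s :- a) ⇒
        (y ⊜ m :* a :+ n by con (+ 1)) ⇒
        ⊢ m′ :* a :+ n′ ⊜ :- y

      other-root = entail 8 λ a b c s t m m′ A →
        a :+ b :+ s :+ A ⊜ m :* m by con (+ 1) ⇒
        s :+ c :+ t :+ A ⊜ m′ :* m′ by con -[1+ 0 ] ⇒
        :- (m :+ m′) ⊜ con (+ 0) by m′ :- m ⇒
        ⊢ a :+ b ⊜ c :+ t

    -- Collinear triples sum to O, so `opposite S` is P + Q and `opposite U` is Q + R: both (P + Q)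
    -- + R and P + (Q + R) are opposite to T.
    ∼-assoc : ∀ {P Q R S T U} → P ∼ Q ∼ S → opposite S ∼ R ∼ T → Q ∼ R ∼ U → P ∼ opposite U ∼ T
    ∼-assoc {⟨ a , y₁ ⟩} {⟨ b , y₂ ⟩} {⟨ c , y₃ ⟩} {⟨ s , z ⟩} {⟨ t , y₄ ⟩} {⟨ u , y₅ ⟩}
            l₁@(line m n on₁ on₂ on₃ σ₁ σ₂ σ₃)
            l₃@(line m′ n′ on₁′ on₂′ on₃′ σ₁′ σ₂′ σ₃′)
            l₂@(line m₂ n₂ onQ onR onU τ₁ τ₂ τ₃) with - (m + m′) ≟ 0#
    ... | no δ≢0 = line (- δ - m₂) (δ * u - n₂)
        (on-line a y₁ ((entail 2 λ a t → ⊢ (a :- a) :* (a :- t) ⊜ con (+ 0)) a t) gP)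
        ((entail 5 λ u y m n δ → y ⊜ m :* u :+ n by con -[1+ 0 ] ⇒
          ⊢ :- y ⊜ (:- δ :- m) :* u :+ (δ :* u :- n)) u y₅ m₂ n₂ δ onU)
        (on-line t y₄ ((entail 2 λ a t → ⊢ (t :- a) :* (t :- t) ⊜ con (+ 0)) a t) gT)
        (new-σ₁ a b c t u β δ m₂ A τ₁ H N₃)
        (new-σ₂ a b c t u β γ δ m₂ n₂ B τ₂ cst H N₃ K)
        (new-σ₃ a b c t u γ δ n₂ C τ₃ cst K)
      where
      δ = - (m + m′)
      β = s + A + m * m′
      γ = s * s + A * s + B + z * (m′ - m) - m * m′ * s

      module l₁′ = _∼_∼_ (∼-swap l₁)
      module l₃′ = _∼_∼_ (∼-swap (∼-rotate (∼-rotate l₃)))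

      gP = vanishing a b s y₁ z m n m′ A B on₁ on₃ σ₁ σ₂
      gQ = vanishing b a s y₂ z m n m′ A B on₂ on₃ l₁′.σ₁ l₁′.σ₂
      gR = vanishing′ c t s y₃ z m m′ n′ A B on₂′ on₁′ σ₁′ σ₂′
      gT = vanishing′ t c s y₄ z m m′ n′ A B on₃′ on₁′ l₃′.σ₁ l₃′.σ₂
      N₃ = norm₃ a b c s t m m′ A σ₁ σ₁′
      N₂ = norm₂ a b c s t z m n m′ n′ A B on₃ on₁′ σ₁ σ₁′ σ₂ σ₂′

      H : b + c + β + δ * m₂ ≡ 0#
      H with b ≟ c
      ... | no b≢c = 0≢⇒cancel (λ eq → b≢c (x-y≡0⇒x≡y eq)) (secant b c y₂ y₃ β γ δ m₂ n₂ gQ gR onQ onR)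
      ... | yes refl = 0≢⇒cancel (tangent-y≢0 l₂ refl)
        (tangential a b s t y₃ z m n m′ n′ _ A m₂
          (subst (λ y → _ ≡ φ (+ 2) * y * m + (b - a) * (b - s)) y₂≡y₃ (derivative l₁))
          (derivative l₃)
          (trans (derivative l₂) ((entail 3 λ b u k → ⊢ k :+ (b :- b) :* (b :- u) ⊜ k) b u _))
          (trans (sym y₂≡y₃) on₂) on₂′ on₃ on₁′ σ₁ σ₁′)
        where
        y₂≡y₃ : y₂ ≡ y₃
        y₂≡y₃ = x≡⇒y≡ l₂ refl

      cst = constant-term b c y₂ β γ δ m₂ n₂ gQ H onQ
      K   = δ²u a b c t u β γ δ m₂ A N₃ N₂ τ₁ H

      on-line : ∀ x y → (x - a) * (x - t) ≡ 0# → x * x + β * x + γ + δ * y ≡ 0# →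
                y ≡ (- δ - m₂) * x + (δ * u - n₂)
      on-line x y root g =
        x-y≡0⇒x≡y (0≢⇒cancel δ≢0 (on-new-line x a b c t u β γ δ m₂ n₂ y root g N₃ H K cst))
    -- If m′ = -m, the second line is the mirror image of the first, so C and T are -A and -B in
    -- some order. C = -B would make the line through B and C vertical; in the other case the claim
    -- is the mirror image of the collinearity of B, C and U.
    ... | yes δ≡0 with c ≟ a | c ≟ b
    ...   | no c≢a | no c≢b = ⊥-elim (c≢b (x-y≡0⇒x≡y (0≢⇒cancel (λ eq → c≢a (x-y≡0⇒x≡y eq))
              (opposite-lines a b c s t z m n m′ n′ A B on₃ on₁′ σ₁ σ₁′ σ₂ σ₂′ δ≡0))))
    ...   | no _ | yes refl = ⊥-elim (tangent-y≢0 l₂ refl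
              ((entail 2 λ y₂ y₃ → y₂ ⊜ y₃ by con -[1+ 0 ] ⇒ y₃ ⊜ :- y₂ by con (+ 1) ⇒
                ⊢ con (+ 2) :* y₃ ⊜ con (+ 0)) y₂ y₃ (x≡⇒y≡ l₂ refl)
                (trans on₂′ (opposite-y b s z y₂ m n m′ n′ on₃ on₁′ δ≡0 on₂))))
    ...   | yes refl | _ with (entail 3 λ a b t → a :+ b ⊜ a :+ t by con (+ 1) ⇒ ⊢ b ⊜ t) a b t
                                (other-root a b a s t m m′ A σ₁ σ₁′ δ≡0)
    ...     | refl = subst₂ (λ P T → P ∼ opposite ⟨ u , y₅ ⟩ ∼ T)
                (cong ⟨ a ,_⟩ (trans (cong -_ y₃≡) ((entail 1 λ y → ⊢ :- (:- y) ⊜ y) y₁)))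
                (cong ⟨ b ,_⟩ (sym y₄≡))
                (∼-rotate (∼-opposite l₂))
      where
      y₃≡ : y₃ ≡ - y₁
      y₃≡ = trans on₂′ (opposite-y a s z y₁ m n m′ n′ on₃ on₁′ δ≡0 on₁)
      y₄≡ : y₄ ≡ - y₂
      y₄≡ = trans on₃′ (opposite-y b s z y₂ m n m′ n′ on₃ on₁′ δ≡0 on₂)

    data Point : Set where
      O   : Point
      aff : Affine → Point

    opp : Point → Point
    opp O       = O
    opp (aff P) = aff (opposite P)

    opposite-involutive : ∀ P → opposite (opposite P) ≡ P
    opposite-involutive ⟨ x , y ⟩ = cong ⟨ x ,_⟩ ((entail 1 λ y → ⊢ :- (:- y) ⊜ y) y)

    opp-involutive : ∀ P → opp (opp P) ≡ P
    opp-involutive O       = refl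
    opp-involutive (aff P) = cong aff (opposite-involutive P)

    opp-swap : ∀ {P Q} → P ≡ opp Q → Q ≡ opp P
    opp-swap refl = sym (opp-involutive _)

    -- The clauses with a point at infinity supply the vertical lines, which are not of the form y =
    -- m x + n.
    SumsToO : Point → Point → Point → Set
    SumsToO O       Q       R       = R ≡ opp Q
    SumsToO (aff P) O       R       = R ≡ opp (aff P)
    SumsToO (aff P) (aff Q) O       = aff Q ≡ opp (aff P)
    SumsToO (aff P) (aff Q) (aff R) = P ∼ Q ∼ R

    SumsToO-rotate : ∀ P Q R → SumsToO P Q R → SumsToO Q R P
    SumsToO-rotate O       O       R       refl = refl
    SumsToO-rotate O       (aff Q) O       ()
    SumsToO-rotate O       (aff Q) (aff R) eq   = eq
    SumsToO-rotate (aff P) O       R       eq   = opp-swap eq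
    SumsToO-rotate (aff P) (aff Q) O       eq   = opp-swap eq
    SumsToO-rotate (aff P) (aff Q) (aff R) l    = ∼-rotate l

    SumsToO-swap : ∀ P Q R → SumsToO P Q R → SumsToO Q P R
    SumsToO-swap O       O       R       eq = eq
    SumsToO-swap O       (aff Q) R       eq = eq
    SumsToO-swap (aff P) O       R       eq = eq
    SumsToO-swap (aff P) (aff Q) O       eq = opp-swap eq
    SumsToO-swap (aff P) (aff Q) (aff R) l  = ∼-swap l

    SumsToO-opp : ∀ P Q R → SumsToO P Q R → SumsToO (opp P) (opp Q) (opp R)
    SumsToO-opp O       Q       R       eq = cong opp eq
    SumsToO-opp (aff P) O       R       eq = cong opp eq
    SumsToO-opp (aff P) (aff Q) O       eq = cong opp eq
    SumsToO-opp (aff P) (aff Q) (aff R) l  = ∼-opposite l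

    SumsToO-inverse : ∀ P → SumsToO P (opp P) O
    SumsToO-inverse O       = refl
    SumsToO-inverse (aff P) = refl

    SumsToO-unique : ∀ P Q R S → SumsToO P Q R → SumsToO P Q S → R ≡ S
    SumsToO-unique O       Q       R       S       eq   eq′  = trans eq (sym eq′)
    SumsToO-unique (aff P) O       R       S       eq   eq′  = trans eq (sym eq′)
    SumsToO-unique (aff P) (aff Q) O       O       eq   eq′  = refl
    SumsToO-unique (aff P) (aff Q) O       (aff S) refl l    = ⊥-elim (∼-opposite-absurd l)
    SumsToO-unique (aff P) (aff Q) (aff R) O       l    refl = ⊥-elim (∼-opposite-absurd l)
    SumsToO-unique (aff P) (aff Q) (aff R) (aff S) l    l′   = cong aff (∼-unique l l′)

    SumsToO-identity : ∀ P R → SumsToO P O R → R ≡ opp P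
    SumsToO-identity O       R eq = eq
    SumsToO-identity (aff P) R eq = eq

    -- Only the last clause is geometric. When one of the six points is O, symmetry and the
    -- uniqueness of the third point suffice.
    SumsToO-assoc : ∀ P Q R {S T U} → SumsToO P Q S → SumsToO (opp S) R T → SumsToO Q R U →
                    SumsToO P (opp U) T
    SumsToO-assoc O Q R {T = T} {U} refl h k =
      trans (SumsToO-unique Q R T U (subst (λ Q → SumsToO Q R T) (opp-involutive Q) h) k)
            (sym (opp-involutive U))
    SumsToO-assoc P@(aff _) O R {T = T} refl h refl =
      subst₂ (λ P R → SumsToO P R T) (opp-involutive P) (sym (opp-involutive R)) h
    SumsToO-assoc P@(aff _) Q@(aff _) O {S} g h refl =
      subst₂ (SumsToO P) (sym (opp-involutive Q))
        (sym (trans (SumsToO-identity (opp S) _ h) (opp-involutive S))) g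
    SumsToO-assoc P@(aff _) (aff _) R@(aff _) {O} {T} {U} refl refl k =
      SumsToO-rotate (opp R) P (opp U) (SumsToO-swap P (opp R) (opp U)
        (subst (λ P → SumsToO P (opp R) (opp U)) (opp-involutive P) (SumsToO-opp (opp P) R U k)))
    SumsToO-assoc P@(aff _) Q@(aff _) (aff _) {S@(aff _)} {O} {U} g refl k =
      subst (λ U → SumsToO P (opp U) O)
        (SumsToO-unique Q S P U (SumsToO-rotate P Q S g)
          (subst (λ S → SumsToO Q S U) (opp-involutive S) k))
        (SumsToO-inverse P)
    SumsToO-assoc P@(aff _) Q@(aff _) (aff _) {S@(aff _)} {T@(aff _)} {O} g h refl =
      SumsToO-unique (opp S) (opp Q) T (opp P) h
        (SumsToO-swap (opp Q) (opp S) (opp P)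
          (SumsToO-rotate (opp P) (opp Q) (opp S) (SumsToO-opp P Q S g)))
    SumsToO-assoc (aff _) (aff _) (aff _) {aff _} {aff _} {aff _} g h k = ∼-assoc g h k

-- The discriminant of a cubic with a double root.

module Discriminant (F : Field) where
  open Field F
  open Identities F

  -- The two hypotheses express B and C as polynomials in x and A; after substitution the
  -- discriminant is identically zero.
  double-root : ∀ {x A B C} → x * x * x + A * x * x + B * x + C ≡ 0# →
                φ (+ 3) * x * x + φ (+ 2) * A * x + B ≡ 0# →
                φ (+ 16) * (A * A * B * B - φ (+ 4) * A * A * A * C - φ (+ 4) * B * B * B
                            - φ (+ 27) * C * C + φ (+ 18) * A * B * C) ≡ 0#
  double-root {x} {A} {B} {C} f≡0 f′≡0 = trans (cong₂ (λ B C →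
      φ (+ 16) * (A * A * B * B - φ (+ 4) * A * A * A * C - φ (+ 4) * B * B * B
                  - φ (+ 27) * C * C + φ (+ 18) * A * B * C))
      ((entail 3 λ x A B → con (+ 3) :* x :* x :+ con (+ 2) :* A :* x :+ B ⊜ con (+ 0) by con (+ 1) ⇒
        ⊢ B ⊜ :- (con (+ 3) :* x :* x :+ con (+ 2) :* A :* x)) x A B f′≡0)
      ((entail 4 λ x A B C → con (+ 3) :* x :* x :+ con (+ 2) :* A :* x :+ B ⊜ con (+ 0) by :- x ⇒
        x :* x :* x :+ A :* x :* x :+ B :* x :+ C ⊜ con (+ 0) by con (+ 1) ⇒
        ⊢ C ⊜ con (+ 2) :* x :* x :* x :+ A :* x :* x) x A B C f′≡0 f≡0))
    ((entail 2 λ x A → let B = :- (con (+ 3) :* x :* x :+ con (+ 2) :* A :* x)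
                           C = con (+ 2) :* x :* x :* x :+ A :* x :* x in
      ⊢ con (+ 16) :* (A :* A :* B :* B :- con (+ 4) :* A :* A :* A :* C :- con (+ 4) :* B :* B :* B
                       :- con (+ 27) :* C :* C :+ con (+ 18) :* A :* B :* C) ⊜ con (+ 0)) x A)

-- Chord and tangent formulas on a Weierstrass equation, as collinearity on the completed cubic.

module ChordTangent (F : Field) where

  open Field F
  open Identities F

  module Curve
    (2≢0 : φ (+ 2) ≢ 0#) (A B C : Carrier)
    (smooth : ∀ x → x * x * x + A * x * x + B * x + C ≡ 0# →
                    φ (+ 3) * x * x + φ (+ 2) * A * x + B ≢ 0#)
    (h a₁ a₂ a₃ a₄ a₆ : Carrier) (2h≡1 : φ (+ 2) * h ≡ 1#)
    (A≡ : A ≡ a₂ + h * h * a₁ * a₁) (B≡ : B ≡ a₄ + h * a₁ * a₃) (C≡ : C ≡ a₆ + h * h * a₃ * a₃)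
    where

    open Cubic.Curve F 2≢0 A B C smooth public renaming (O to ∞)

    OnWeierstrass : Carrier → Carrier → Set
    OnWeierstrass x y = y * y + a₁ * x * y + a₃ * y ≡ x * x * x + a₂ * x * x + a₄ * x + a₆

    complete : Carrier → Carrier → Affine
    complete x y = ⟨ x , y + h * (a₁ * x + a₃) ⟩

    complete-injective : ∀ {x y x′ y′} → complete x y ≡ complete x′ y′ → x ≡ x′ × y ≡ y′
    complete-injective {x} {y} {x′} {y′} eq with cong Affine.x eq
    ... | refl = refl , (entail 3 λ y y′ k → y :+ k ⊜ y′ :+ k by con (+ 1) ⇒ ⊢ y ⊜ y′)
                          y y′ (h * (a₁ * x + a₃)) (cong Affine.y eq)

    complete-opposite : ∀ x y → complete x (0# - y - a₁ * x - a₃) ≡ opposite (complete x y)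
    complete-opposite x y = cong ⟨ x ,_⟩
      ((entail 5 λ x y h a₁ a₃ → con (+ 2) :* h ⊜ con (+ 1) by a₁ :* x :+ a₃ ⇒
        ⊢ con (+ 0) :- y :- a₁ :* x :- a₃ :+ h :* (a₁ :* x :+ a₃) ⊜ :- (y :+ h :* (a₁ :* x :+ a₃)))
        x y h a₁ a₃ 2h≡1)

    private
      completed-square = entail 11 λ x y h a₁ a₂ a₃ a₄ a₆ A B C →
        con (+ 2) :* h ⊜ con (+ 1) by y :* (a₁ :* x :+ a₃) :+ h :* a₁ :* a₃ :* x ⇒
        A ⊜ a₂ :+ h :* h :* a₁ :* a₁ by :- x :* x ⇒
        B ⊜ a₄ :+ h :* a₁ :* a₃ by :- x ⇒
        C ⊜ a₆ :+ h :* h :* a₃ :* a₃ by con -[1+ 0 ] ⇒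
        ⊢ (y :+ h :* (a₁ :* x :+ a₃)) :* (y :+ h :* (a₁ :* x :+ a₃)) :- (x :* x :* x :+ A :* x :* x :+ B :* x :+ C)
        ⊜ (y :* y :+ a₁ :* x :* y :+ a₃ :* y) :- (x :* x :* x :+ a₂ :* x :* x :+ a₄ :* x :+ a₆)


      on-both : ∀ x y → let Y = y + h * (a₁ * x + a₃) in
        Y * Y - (x * x * x + A * x * x + B * x + C)
        ≡ (y * y + a₁ * x * y + a₃ * y) - (x * x * x + a₂ * x * x + a₄ * x + a₆)
      on-both x y = completed-square x y h a₁ a₂ a₃ a₄ a₆ A B C 2h≡1 A≡ B≡ C≡

    OnWeierstrass⇒OnCubic : ∀ {x y} → OnWeierstrass x y → OnCubic (complete x y)
    OnWeierstrass⇒OnCubic {x} {y} on = x-y≡0⇒x≡y (trans (on-both x y) (x≡y⇒x-y≡0 on))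

    OnCubic⇒OnWeierstrass : ∀ {x y} → OnCubic (complete x y) → OnWeierstrass x y
    OnCubic⇒OnWeierstrass {x} {y} on = x-y≡0⇒x≡y (trans (sym (on-both x y)) (x≡y⇒x-y≡0 on))

    OnAffine : Point → Set
    OnAffine ∞       = ⊤
    OnAffine (aff P) = OnCubic P

    OnAffine-opp : ∀ P → OnAffine P → OnAffine (opp P)
    OnAffine-opp ∞               _  = tt
    OnAffine-opp (aff ⟨ x , y ⟩) on = trans ((entail 1 λ y → ⊢ (:- y) :* (:- y) ⊜ y :* y) y) on

    SumsToO⇒OnAffine : ∀ P Q R → OnAffine P → OnAffine Q → SumsToO P Q R → OnAffine R
    SumsToO⇒OnAffine ∞       Q       R       p q refl = OnAffine-opp Q q
    SumsToO⇒OnAffine (aff P) ∞       R       p q refl = OnAffine-opp (aff P) p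
    SumsToO⇒OnAffine (aff P) (aff Q) ∞       p q eq   = tt
    SumsToO⇒OnAffine (aff P) (aff Q) (aff R) p q l    = ∼⇒OnCubic (∼-rotate (∼-rotate l))

    third-x third-y : (x₁ x₂ μ ν : Carrier) → Carrier
    third-x x₁ x₂ μ ν = μ * μ + a₁ * μ - a₂ - x₁ - x₂
    third-y x₁ x₂ μ ν = 0# - (μ + a₁) * third-x x₁ x₂ μ ν - ν - a₃

    private
      straighten = entail 7 λ x y μ ν h a₁ a₃ →
        y ⊜ μ :* x :+ ν by con (+ 1) ⇒
        ⊢ y :+ h :* (a₁ :* x :+ a₃) ⊜ (μ :+ h :* a₁) :* x :+ (ν :+ h :* a₃)

      -- Completing the square turns y = μ x + ν into a line of slope μ + a₁/2 and intercept ν +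
      -- a₃/2. The choice of x₃ gives `σ₁`; the other two coefficients are hypotheses, since chords
      -- and tangents reach the linear one differently.
      collinear : ∀ x₁ y₁ x₂ y₂ μ ν → y₁ ≡ μ * x₁ + ν → y₂ ≡ μ * x₂ + ν →
        let x₃ = third-x x₁ x₂ μ ν ; y₃ = third-y x₁ x₂ μ ν in
        x₁ * x₂ + x₂ * x₃ + x₃ * x₁ + φ (+ 2) * μ * ν + a₁ * ν + a₃ * μ ≡ a₄ →
        x₁ * x₂ * x₃ + a₆ ≡ ν * ν + a₃ * ν →
        complete x₁ y₁ ∼ complete x₂ y₂ ∼ opposite (complete x₃ y₃)
      collinear x₁ y₁ x₂ y₂ μ ν on₁ on₂ e₂ e₃ = line (μ + h * a₁) (ν + h * a₃)
        (straighten x₁ y₁ μ ν h a₁ a₃ on₁) (straighten x₂ y₂ μ ν h a₁ a₃ on₂)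
        ((entail 6 λ x μ ν h a₁ a₃ → con (+ 2) :* h ⊜ con (+ 1) by :- (a₁ :* x :+ a₃) ⇒
          ⊢ :- (con (+ 0) :- (μ :+ a₁) :* x :- ν :- a₃ :+ h :* (a₁ :* x :+ a₃))
            ⊜ (μ :+ h :* a₁) :* x :+ (ν :+ h :* a₃)) x₃ μ ν h a₁ a₃ 2h≡1)
        ((entail 7 λ x₁ x₂ μ h a₁ a₂ A → con (+ 2) :* h ⊜ con (+ 1) by :- (a₁ :* μ) ⇒
          A ⊜ a₂ :+ h :* h :* a₁ :* a₁ by con (+ 1) ⇒
          ⊢ x₁ :+ x₂ :+ (μ :* μ :+ a₁ :* μ :- a₂ :- x₁ :- x₂) :+ A ⊜ (μ :+ h :* a₁) :* (μ :+ h :* a₁))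
          x₁ x₂ μ h a₁ a₂ A 2h≡1 A≡)
        ((entail 10 λ x₁ x₂ x₃ μ ν h a₁ a₃ a₄ B →
          con (+ 2) :* h ⊜ con (+ 1) by a₃ :* μ :+ a₁ :* ν :+ h :* a₁ :* a₃ ⇒
          B ⊜ a₄ :+ h :* a₁ :* a₃ by con -[1+ 0 ] ⇒
          x₁ :* x₂ :+ x₂ :* x₃ :+ x₃ :* x₁ :+ con (+ 2) :* μ :* ν :+ a₁ :* ν :+ a₃ :* μ ⊜ a₄ by con (+ 1) ⇒
          ⊢ x₁ :* x₂ :+ x₂ :* x₃ :+ x₃ :* x₁ :+ con (+ 2) :* (μ :+ h :* a₁) :* (ν :+ h :* a₃) ⊜ B)
          x₁ x₂ x₃ μ ν h a₁ a₃ a₄ B 2h≡1 B≡ e₂)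
        ((entail 6 λ k ν h a₃ a₆ C →
          con (+ 2) :* h ⊜ con (+ 1) by :- (a₃ :* ν) ⇒
          C ⊜ a₆ :+ h :* h :* a₃ :* a₃ by con (+ 1) ⇒
          k :+ a₆ ⊜ ν :* ν :+ a₃ :* ν by con (+ 1) ⇒
          ⊢ k :+ C ⊜ (ν :+ h :* a₃) :* (ν :+ h :* a₃)) (x₁ * x₂ * x₃) ν h a₃ a₆ C 2h≡1 C≡ e₃)
        where x₃ = third-x x₁ x₂ μ ν

      -- The restriction of the Weierstrass equation to the line vanishes at x₁, so its
      -- constant coefficient is determined by the others.
      constant-coefficient = entail 11 λ x₁ y₁ x₂ x₃ μ ν a₁ a₂ a₃ a₄ a₆ →
        y₁ :* y₁ :+ a₁ :* x₁ :* y₁ :+ a₃ :* y₁ ⊜ x₁ :* x₁ :* x₁ :+ a₂ :* x₁ :* x₁ :+ a₄ :* x₁ :+ a₆ by con -[1+ 0 ] ⇒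
        y₁ ⊜ μ :* x₁ :+ ν by y₁ :+ μ :* x₁ :+ ν :+ a₁ :* x₁ :+ a₃ ⇒
        x₃ ⊜ μ :* μ :+ a₁ :* μ :- a₂ :- x₁ :- x₂ by :- (x₁ :* x₁) ⇒
        x₁ :* x₂ :+ x₂ :* x₃ :+ x₃ :* x₁ :+ con (+ 2) :* μ :* ν :+ a₁ :* ν :+ a₃ :* μ ⊜ a₄ by x₁ ⇒
        ⊢ x₁ :* x₂ :* x₃ :+ a₆ ⊜ ν :* ν :+ a₃ :* ν

      -- The difference of the curve equations at x₂ and x₁, in which the constant coefficient
      -- cancels.
      chord-linear-coefficient = entail 12 λ x₁ y₁ x₂ y₂ x₃ μ ν a₁ a₂ a₃ a₄ a₆ →
        y₁ :* y₁ :+ a₁ :* x₁ :* y₁ :+ a₃ :* y₁ ⊜ x₁ :* x₁ :* x₁ :+ a₂ :* x₁ :* x₁ :+ a₄ :* x₁ :+ a₆ by con -[1+ 0 ] ⇒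
        y₂ :* y₂ :+ a₁ :* x₂ :* y₂ :+ a₃ :* y₂ ⊜ x₂ :* x₂ :* x₂ :+ a₂ :* x₂ :* x₂ :+ a₄ :* x₂ :+ a₆ by con (+ 1) ⇒
        y₁ ⊜ μ :* x₁ :+ ν by y₁ :+ μ :* x₁ :+ ν :+ a₁ :* x₁ :+ a₃ ⇒
        y₂ ⊜ μ :* x₂ :+ ν by :- (y₂ :+ μ :* x₂ :+ ν :+ a₁ :* x₂ :+ a₃) ⇒
        x₃ ⊜ μ :* μ :+ a₁ :* μ :- a₂ :- x₁ :- x₂ by x₂ :* x₂ :- x₁ :* x₁ ⇒
        ⊢ (x₂ :- x₁) :* (x₁ :* x₂ :+ x₂ :* x₃ :+ x₃ :* x₁ :+ con (+ 2) :* μ :* ν :+ a₁ :* ν :+ a₃ :* μ :- a₄) ⊜ con (+ 0)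

      -- The limit of the chord case: the derivative at the double root x replaces the difference
      -- quotient.
      tangent-linear-coefficient = entail 9 λ x y x₃ μ ν a₁ a₂ a₃ a₄ →
        μ :* (con (+ 2) :* y :+ a₁ :* x :+ a₃) ⊜ con (+ 3) :* x :* x :+ con (+ 2) :* a₂ :* x :+ a₄ :- a₁ :* y by con (+ 1) ⇒
        y ⊜ μ :* x :+ ν by :- (con (+ 2) :* μ :+ a₁) ⇒
        x₃ ⊜ μ :* μ :+ a₁ :* μ :- a₂ :- x :- x by con (+ 2) :* x ⇒
        ⊢ x :* x :+ x :* x₃ :+ x₃ :* x :+ con (+ 2) :* μ :* ν :+ a₁ :* ν :+ a₃ :* μ ⊜ a₄


    private
      chord′ : ∀ {x₁ y₁ x₂ y₂ den} → OnWeierstrass x₁ y₁ → OnWeierstrass x₂ y₂ → x₁ ≢ x₂ →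
              (x₂ - x₁) * den ≡ 1# →
              let μ = (y₂ - y₁) * den ; ν = (y₁ * x₂ - y₂ * x₁) * den in
              complete x₁ y₁ ∼ complete x₂ y₂ ∼ opposite (complete (third-x x₁ x₂ μ ν) (third-y x₁ x₂ μ ν))
      chord′ {x₁} {y₁} {x₂} {y₂} {den} p q x₁≢x₂ den-inverse = collinear x₁ y₁ x₂ y₂ μ ν on₁ on₂ e₂
            (constant-coefficient x₁ y₁ x₂ x₃ μ ν a₁ a₂ a₃ a₄ a₆ p on₁ refl e₂)
        where
        μ = (y₂ - y₁) * den
        ν = (y₁ * x₂ - y₂ * x₁) * den
        x₃ = third-x x₁ x₂ μ ν
        on₁ : y₁ ≡ μ * x₁ + ν
        on₁ = (entail 5 λ x₁ y₁ x₂ y₂ i → (x₂ :- x₁) :* i ⊜ con (+ 1) by :- y₁ ⇒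
          ⊢ y₁ ⊜ (y₂ :- y₁) :* i :* x₁ :+ (y₁ :* x₂ :- y₂ :* x₁) :* i) x₁ y₁ x₂ y₂ den den-inverse
        on₂ : y₂ ≡ μ * x₂ + ν
        on₂ = (entail 5 λ x₁ y₁ x₂ y₂ i → (x₂ :- x₁) :* i ⊜ con (+ 1) by :- y₂ ⇒
          ⊢ y₂ ⊜ (y₂ :- y₁) :* i :* x₂ :+ (y₁ :* x₂ :- y₂ :* x₁) :* i) x₁ y₁ x₂ y₂ den den-inverse
        e₂ = x-y≡0⇒x≡y (0≢⇒cancel (λ eq → x₁≢x₂ (sym (x-y≡0⇒x≡y eq)))
          (chord-linear-coefficient x₁ y₁ x₂ y₂ x₃ μ ν a₁ a₂ a₃ a₄ a₆ p q on₁ on₂ refl))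

    chord : ∀ {x₁ y₁ x₂ y₂ den} μ ν x₃ y₃ → OnWeierstrass x₁ y₁ → OnWeierstrass x₂ y₂ → x₁ ≢ x₂ →
            (x₂ - x₁) * den ≡ 1# → μ ≡ (y₂ - y₁) * den → ν ≡ (y₁ * x₂ - y₂ * x₁) * den →
            x₃ ≡ μ * μ + a₁ * μ - a₂ - x₁ - x₂ → y₃ ≡ 0# - (μ + a₁) * x₃ - ν - a₃ →
            complete x₁ y₁ ∼ complete x₂ y₂ ∼ opposite (complete x₃ y₃)
    chord _ _ _ _ p q x₁≢x₂ den-inverse refl refl refl refl = chord′ p q x₁≢x₂ den-inverse

    vertical : ∀ {x y₁ y₂} → y₁ + y₂ + a₁ * x + a₃ ≡ 0# → complete x y₂ ≡ opposite (complete x y₁)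
    vertical {x} {y₁} {y₂} eq = cong ⟨ x ,_⟩
        ((entail 6 λ x y₁ y₂ h a₁ a₃ → con (+ 2) :* h ⊜ con (+ 1) by a₁ :* x :+ a₃ ⇒
          y₁ :+ y₂ :+ a₁ :* x :+ a₃ ⊜ con (+ 0) by con (+ 1) ⇒
          ⊢ y₂ :+ h :* (a₁ :* x :+ a₃) ⊜ :- (y₁ :+ h :* (a₁ :* x :+ a₃))) x y₁ y₂ h a₁ a₃ 2h≡1 eq)

    same-y : ∀ {x y₁ y₂} → OnWeierstrass x y₁ → OnWeierstrass x y₂ → y₁ + y₂ + a₁ * x + a₃ ≢ 0# → y₁ ≡ y₂
    same-y {x} {y₁} {y₂} p q ≢0 = x-y≡0⇒x≡y (0≢⇒cancel ≢0
        ((entail 8 λ x y₁ y₂ a₁ a₂ a₃ a₄ a₆ →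
          y₁ :* y₁ :+ a₁ :* x :* y₁ :+ a₃ :* y₁ ⊜ x :* x :* x :+ a₂ :* x :* x :+ a₄ :* x :+ a₆ by con (+ 1) ⇒
          y₂ :* y₂ :+ a₁ :* x :* y₂ :+ a₃ :* y₂ ⊜ x :* x :* x :+ a₂ :* x :* x :+ a₄ :* x :+ a₆ by con -[1+ 0 ] ⇒
          ⊢ (y₁ :+ y₂ :+ a₁ :* x :+ a₃) :* (y₁ :- y₂) ⊜ con (+ 0)) x y₁ y₂ a₁ a₂ a₃ a₄ a₆ p q))

    doubling-denominator : ∀ {x y} → y + y + a₁ * x + a₃ ≢ 0# → φ (+ 2) * y + a₁ * x + a₃ ≢ 0#
    doubling-denominator {x} {y} ≢0 η≡0 = ≢0 (trans
      ((entail 3 λ k y a → ⊢ y :+ y :+ k :+ a ⊜ con (+ 2) :* y :+ k :+ a) (a₁ * x) y a₃) η≡0)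

    private
      tangent′ : ∀ {x y den} → OnWeierstrass x y → (φ (+ 2) * y + a₁ * x + a₃) * den ≡ 1# →
                let μ = (φ (+ 3) * x * x + φ (+ 2) * a₂ * x + a₄ - a₁ * y) * den
                    ν = (0# - x * x * x + a₄ * x + φ (+ 2) * a₆ - a₃ * y) * den in
                complete x y ∼ complete x y ∼ opposite (complete (third-x x x μ ν) (third-y x x μ ν))
      tangent′ {x} {y} {den} p den-inverse = collinear x y x y μ ν on on e₂
            (constant-coefficient x y x x₃ μ ν a₁ a₂ a₃ a₄ a₆ p on refl e₂)
        where
        η = φ (+ 2) * y + a₁ * x + a₃
        μ = (φ (+ 3) * x * x + φ (+ 2) * a₂ * x + a₄ - a₁ * y) * den
        ν = (0# - x * x * x + a₄ * x + φ (+ 2) * a₆ - a₃ * y) * den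
        x₃ = third-x x x μ ν
        on : y ≡ μ * x + ν
        -- The intercept ν has a numerator of its own, so that the tangent passes through the point
        -- depends on the curve equation.
        on = (entail 8 λ x y a₁ a₂ a₃ a₄ a₆ i →
          (con (+ 2) :* y :+ a₁ :* x :+ a₃) :* i ⊜ con (+ 1) by :- y ⇒
          y :* y :+ a₁ :* x :* y :+ a₃ :* y ⊜ x :* x :* x :+ a₂ :* x :* x :+ a₄ :* x :+ a₆ by con (+ 2) :* i ⇒
          ⊢ y ⊜ (con (+ 3) :* x :* x :+ con (+ 2) :* a₂ :* x :+ a₄ :- a₁ :* y) :* i :* x
                 :+ (con (+ 0) :- x :* x :* x :+ a₄ :* x :+ con (+ 2) :* a₆ :- a₃ :* y) :* i)
          x y a₁ a₂ a₃ a₄ a₆ den den-inverse p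
        e₂ = tangent-linear-coefficient x y x₃ μ ν a₁ a₂ a₃ a₄
          ((entail 3 λ k η i → η :* i ⊜ con (+ 1) by k ⇒ ⊢ k :* i :* η ⊜ k) _ η den den-inverse)
          on refl

    tangent : ∀ {x y den} μ ν x₃ y₃ → OnWeierstrass x y → (φ (+ 2) * y + a₁ * x + a₃) * den ≡ 1# →
              μ ≡ (φ (+ 3) * x * x + φ (+ 2) * a₂ * x + a₄ - a₁ * y) * den →
              ν ≡ (0# - x * x * x + a₄ * x + φ (+ 2) * a₆ - a₃ * y) * den →
              x₃ ≡ μ * μ + a₁ * μ - a₂ - x - x → y₃ ≡ 0# - (μ + a₁) * x₃ - ν - a₃ →
              complete x y ∼ complete x y ∼ opposite (complete x₃ y₃)
    tangent _ _ _ _ p den-inverse refl refl refl refl = tangent′ p den-inverse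

    module Automorphism
      (f : Carrier → Carrier) (f-+ : ∀ x y → f (x + y) ≡ f x + f y) (f-* : ∀ x y → f (x * y) ≡ f x * f y)
      (f-neg : ∀ x → f (- x) ≡ - f x) (f-φ : ∀ z → f (φ z) ≡ φ z)
      (fA : f A ≡ A) (fB : f B ≡ B) (fC : f C ≡ C) (fh : f h ≡ h) (fa₁ : f a₁ ≡ a₁) (fa₃ : f a₃ ≡ a₃)
      where

      private module Hom = Homomorphism F F f f-+ f-* f-neg f-φ

      apply : Affine → Affine
      apply ⟨ x , y ⟩ = ⟨ f x , f y ⟩

      apply-opposite : ∀ P → apply (opposite P) ≡ opposite (apply P)
      apply-opposite ⟨ x , y ⟩ = cong ⟨ f x ,_⟩ (f-neg y)

      apply-complete : ∀ x y → apply (complete x y) ≡ complete (f x) (f y)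
      apply-complete x y = cong ⟨ f x ,_⟩ (begin
        f (y + h * (a₁ * x + a₃))             ≡⟨ Hom.transport 5 (λ x y h a₁ a₃ → y :+ h :* (a₁ :* x :+ a₃)) x y h a₁ a₃ ⟩
        f y + f h * (f a₁ * f x + f a₃)       ≡⟨ cong₂ (λ h k → f y + h * k) fh (cong₂ (λ a b → a * f x + b) fa₁ fa₃) ⟩
        f y + h * (a₁ * f x + a₃)             ∎)
        where open ≡-Reasoning

      apply-∼ : ∀ {P Q R} → P ∼ Q ∼ R → apply P ∼ apply Q ∼ apply R
      apply-∼ {⟨ x₁ , y₁ ⟩} {⟨ x₂ , y₂ ⟩} {⟨ x₃ , y₃ ⟩} (line m n on₁ on₂ on₃ σ₁ σ₂ σ₃) =
        line (f m) (f n) (on on₁) (on on₂) (on on₃)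
          (begin
            f x₁ + f x₂ + f x₃ + A           ≡⟨ cong (λ k → f x₁ + f x₂ + f x₃ + k) (sym fA) ⟩
            f x₁ + f x₂ + f x₃ + f A         ≡⟨ sym (Hom.transport 4 (λ a b c k → a :+ b :+ c :+ k) x₁ x₂ x₃ A) ⟩
            f (x₁ + x₂ + x₃ + A)             ≡⟨ cong f σ₁ ⟩
            f (m * m)                        ≡⟨ f-* m m ⟩
            f m * f m                        ∎)
          (begin
            f x₁ * f x₂ + f x₂ * f x₃ + f x₃ * f x₁ + φ (+ 2) * f m * f n
              ≡⟨ sym (Hom.transport 5 (λ a b c m n → a :* b :+ b :* c :+ c :* a :+ con (+ 2) :* m :* n) x₁ x₂ x₃ m n) ⟩
            f (x₁ * x₂ + x₂ * x₃ + x₃ * x₁ + φ (+ 2) * m * n) ≡⟨ cong f σ₂ ⟩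
            f B                              ≡⟨ fB ⟩
            B                                ∎)
          (begin
            f x₁ * f x₂ * f x₃ + C           ≡⟨ cong (λ k → f x₁ * f x₂ * f x₃ + k) (sym fC) ⟩
            f x₁ * f x₂ * f x₃ + f C         ≡⟨ sym (Hom.transport 4 (λ a b c k → a :* b :* c :+ k) x₁ x₂ x₃ C) ⟩
            f (x₁ * x₂ * x₃ + C)             ≡⟨ cong f σ₃ ⟩
            f (n * n)                        ≡⟨ f-* n n ⟩
            f n * f n                        ∎)
        where
        open ≡-Reasoning
        on : ∀ {x y} → y ≡ m * x + n → f y ≡ f m * f x + f n
        on {x} eq = trans (cong f eq) (trans (f-+ (m * x) n) (cong (_+ f n) (f-* m x)))

      applyₚ : Point → Point
      applyₚ ∞       = ∞
      applyₚ (aff P) = aff (apply P)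

      applyₚ-opp : ∀ P → applyₚ (opp P) ≡ opp (applyₚ P)
      applyₚ-opp ∞       = refl
      applyₚ-opp (aff P) = cong aff (apply-opposite P)

      applyₚ-SumsToO : ∀ P Q R → SumsToO P Q R → SumsToO (applyₚ P) (applyₚ Q) (applyₚ R)
      applyₚ-SumsToO ∞       Q       R       refl = applyₚ-opp Q
      applyₚ-SumsToO (aff P) ∞       R       refl = applyₚ-opp (aff P)
      applyₚ-SumsToO (aff P) (aff Q) ∞       eq   = trans (cong applyₚ eq) (applyₚ-opp (aff P))
      applyₚ-SumsToO (aff P) (aff Q) (aff R) l    = apply-∼ l

      applyₚ-OnAffine : ∀ P → OnAffine P → OnAffine (applyₚ P)
      applyₚ-OnAffine ∞               _  = tt
      applyₚ-OnAffine (aff ⟨ x , y ⟩) on = begin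
        f y * f y                                   ≡⟨ sym (f-* y y) ⟩
        f (y * y)                                   ≡⟨ cong f on ⟩
        f (x * x * x + A * x * x + B * x + C)
          ≡⟨ Hom.transport 4 (λ x A B C → x :* x :* x :+ A :* x :* x :+ B :* x :+ C) x A B C ⟩
        f x * f x * f x + f A * f x * f x + f B * f x + f C
          ≡⟨ cong₂ (λ A k → f x * f x * f x + A * f x * f x + k * f x + f C) fA fB ⟩
        f x * f x * f x + A * f x * f x + B * f x + f C
          ≡⟨ cong (λ k → f x * f x * f x + A * f x * f x + B * f x + k) fC ⟩
        f x * f x * f x + A * f x * f x + B * f x + C ∎
        where open ≡-Reasoning

-- Conjugation on a ramified quadratic extension

-- `Residue b x` means that x is integral with image b in the residue field 𝔽₂, so residues of
-- polynomial expressions are computed by `xor` and `∧`. The factor 2π in `x-conj` is the derivative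
-- of T² - 2ε at π and generates the different.
record RamifiedConjugation (F : Field) : Set₁ where
  open Field F
  open Identities F
  field
    conj    : Carrier → Carrier
    Residue : Bool → Carrier → Set

  𝒪 : Carrier → Set
  𝒪 = λ x → ∃ λ b → Residue b x

  𝔪 : Carrier → Set
  𝔪 = Residue false

  Unit : Carrier → Set
  Unit = Residue true

  field
    residue-+       : ∀ {a b x y} → Residue a x → Residue b y → Residue (a xor b) (x + y)
    residue--       : ∀ {a b x y} → Residue a x → Residue b y → Residue (a xor b) (x - y)
    residue-*       : ∀ {a b x y} → Residue a x → Residue b y → Residue (a ∧ b) (x * y)
    residue-conj    : ∀ {b x} → Residue b x → Residue b (conj x)
    residue-1       : Unit 1#
    residue-2       : 𝔪 (φ (+ 2))
    𝒪-φ             : ∀ n → 𝒪 (φ n)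
    𝔪⇒¬Unit         : ∀ {x} → 𝔪 x → ¬ Unit x
    Unit-inverse    : ∀ {x} → Unit x → ∃ λ y → x * y ≡ 1# × Unit y
    𝒪-or-inverse    : ∀ x → 𝒪 x ⊎ ∃ λ y → x * y ≡ 1# × 𝔪 y
    π ε             : Carrier
    π²≡2ε           : π * π ≡ φ (+ 2) * ε
    𝒪-ε             : 𝒪 ε
    𝔪-π             : 𝔪 π
    𝔪⇒π∣            : ∀ {x} → 𝔪 x → ∃ λ z → 𝒪 z × x ≡ π * z
    x-conj          : ∀ {x} → 𝒪 x → ∃ λ z → 𝒪 z × x - conj x ≡ φ (+ 2) * π * z
    -- This controls elements with poles as well. The modulus drops from 2π to 2, as it must: an
    -- element with x̄ = -x, such as √d, has z = 1.
    conj-ratio      : ∀ {x} → x ≢ 0# → ∃ λ z → 𝒪 z × conj x ≡ x * (1# - φ (+ 2) * z)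

-- Left unsimplified, to agree with the residues inferred for the corresponding expressions.
equation-residue ∂y-residue ∂x-residue : (r₁ r₂ r₃ r₄ r₆ X Y : Bool) → Bool
equation-residue r₁ r₂ r₃ r₄ r₆ X Y =
  (((Y ∧ Y) xor ((r₁ ∧ X) ∧ Y)) xor (r₃ ∧ Y)) xor
  (((((X ∧ X) ∧ X) xor ((r₂ ∧ X) ∧ X)) xor (r₄ ∧ X)) xor r₆)
∂y-residue r₁ r₂ r₃ r₄ r₆ X Y = ((Y xor Y) xor (r₁ ∧ X)) xor r₃
∂x-residue r₁ r₂ r₃ r₄ r₆ X Y =
  ((((((X ∧ X) xor (X ∧ X)) xor (X ∧ X)) xor (r₂ ∧ (X xor X))) xor r₄) xor (r₁ ∧ Y))

-- The difference of a point and its conjugate lies deep in the kernel of reduction.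

module ConjugateDifference (F : Field) (R : RamifiedConjugation F) where

  open Field F
  open Identities F
  open RamifiedConjugation R

  module Curve
    (a₁ a₂ a₃ a₄ a₆ : Carrier) {r₁ r₂ r₃ r₄ r₆ : Bool}
    (res₁ : Residue r₁ a₁) (res₂ : Residue r₂ a₂) (res₃ : Residue r₃ a₃)
    (res₄ : Residue r₄ a₄) (res₆ : Residue r₆ a₆)
    where

    module _
      (smooth : ∀ X Y → equation-residue r₁ r₂ r₃ r₄ r₆ X Y ≡ false → ∂y-residue r₁ r₂ r₃ r₄ r₆ X Y ≡ false → ∂x-residue r₁ r₂ r₃ r₄ r₆ X Y ≡ false → ⊥)
      {x y : Carrier}
      (on-curve : y * y + a₁ * x * y + a₃ * y ≡ x * x * x + a₂ * x * x + a₄ * x + a₆)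
      {μ x₃ : Carrier}
      (μ-x : (x - conj x) * μ ≡ y + conj y + a₁ * conj x + a₃)
      (μ-y : (y - conj y) * μ ≡ x * x + x * conj x + conj x * conj x + a₂ * (x + conj x) + a₄ - a₁ * y)
      (x₃≡ : x₃ ≡ μ * μ + a₁ * μ - a₂ - x - conj x)
      where

      private
        x̄ ȳ : Carrier
        x̄ = conj x
        ȳ = conj y

        infixl 7 _·_
        _·_ : ∀ {x y} → 𝒪 x → 𝒪 y → 𝒪 (x * y)
        (_ , p) · (_ , q) = _ , residue-* p q

        0-residue : ∀ {b x} → Residue b x → x ≡ 0# → b ≡ false
        0-residue {false} p refl = refl
        0-residue {true}  p refl = ⊥-elim (𝔪⇒¬Unit
          (subst 𝔪 ((entail 0 (⊢ con (+ 1) :- con (+ 1) ⊜ con (+ 0)))) (residue-- residue-1 residue-1)) p)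

        Goal : Set
        Goal = ∃ λ z → 𝒪 z × x₃ * (φ (+ 8) * z) ≡ 1#

        -- With κ = 1/μ, x₃ κ² = 1 + a₁κ - a₂κ² - κ²(x + x̄) is a unit, and κ² = (2πz)² = 8 ε z²,
        -- whence the 8 in `Goal`. The last hypothesis leaves room for x to have a pole.
        from-inverse-slope : ∀ κ z → 𝒪 z → κ ≡ φ (+ 2) * π * z → μ * κ ≡ 1# → 𝔪 (κ * κ * (x + x̄)) → Goal
        from-inverse-slope κ z 𝒪-z κ≡2πz μκ≡1 𝔪-κ²x = conclude (Unit-inverse unit)
          where
          𝔪-κ : 𝔪 κ
          𝔪-κ = subst 𝔪 (sym κ≡2πz) (residue-* (residue-* residue-2 𝔪-π) (proj₂ 𝒪-z))
          W = 1# + κ * a₁ - (κ * (κ * a₂) + κ * κ * (x + x̄))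
          unit : Unit W
          unit = residue-- (residue-+ residue-1 (residue-* 𝔪-κ res₁))
                   (residue-+ (residue-* 𝔪-κ (residue-* 𝔪-κ res₂)) 𝔪-κ²x)
          x₃κ²≡W : x₃ * κ * κ ≡ W
          x₃κ²≡W = (entail 7 λ x x̄ x₃ μ κ a₁ a₂ →
            x₃ ⊜ μ :* μ :+ a₁ :* μ :- a₂ :- x :- x̄ by κ :* κ ⇒
            μ :* κ ⊜ con (+ 1) by μ :* κ :+ con (+ 1) :+ a₁ :* κ ⇒
            ⊢ x₃ :* κ :* κ ⊜ con (+ 1) :+ κ :* a₁ :- (κ :* (κ :* a₂) :+ κ :* κ :* (x :+ x̄)))
            x x̄ x₃ μ κ a₁ a₂ x₃≡ μκ≡1
          conclude : (∃ λ i → W * i ≡ 1# × Unit i) → Goal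
          conclude (i , W*i≡1 , unit-i) = ε * (z * z * i) , 𝒪-ε · (𝒪-z · 𝒪-z · (true , unit-i)) ,
            (entail 7 λ x₃ κ z i W π ε →
              x₃ :* κ :* κ ⊜ W by i ⇒ W :* i ⊜ con (+ 1) by con (+ 1) ⇒
              κ ⊜ con (+ 2) :* π :* z by :- (x₃ :* i :* (κ :+ con (+ 2) :* π :* z)) ⇒
              π :* π ⊜ con (+ 2) :* ε by con -[1+ 3 ] :* x₃ :* i :* z :* z ⇒
              ⊢ x₃ :* (con (+ 8) :* (ε :* (z :* z :* i))) ⊜ con (+ 1))
              x₃ κ z i W π ε x₃κ²≡W W*i≡1 κ≡2πz π²≡2ε

        -- Here v is x or y, according to which form of the slope has a unit numerator D; then 1/μ =
        -- (v - v̄)/D is a multiple of 2π by `x-conj`.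
        from-unit-denominator : 𝒪 x → ∀ {v D} → 𝒪 v → Unit D → (v - conj v) * μ ≡ D → Goal
        from-unit-denominator 𝒪-x {v} {D} 𝒪-v unit-D eq =
          let z , 𝒪-z , diff = x-conj 𝒪-v
              i , D*i≡1 , unit-i = Unit-inverse unit-D
              𝒪-zi = 𝒪-z · (true , unit-i)
              κ = φ (+ 2) * π * (z * i)
              𝔪-κ = residue-* (residue-* residue-2 𝔪-π) (proj₂ 𝒪-zi)
          in from-inverse-slope κ (z * i) 𝒪-zi refl
            ((entail 7 λ v v̄ μ D π z i → v :- v̄ ⊜ con (+ 2) :* π :* z by :- (μ :* i) ⇒
              (v :- v̄) :* μ ⊜ D by i ⇒ D :* i ⊜ con (+ 1) by con (+ 1) ⇒
              ⊢ μ :* (con (+ 2) :* π :* (z :* i)) ⊜ con (+ 1)) v (conj v) μ D π z i diff eq D*i≡1)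
            (residue-* (residue-* 𝔪-κ 𝔪-κ) (residue-+ (proj₂ 𝒪-x) (residue-conj (proj₂ 𝒪-x))))

        -- Conjugation is trivial on 𝔽₂, so the numerators of the two forms of the slope reduce to
        -- the partial derivatives of the equation; at a nonsingular point one of them is a unit.
        integral-case : ∀ {X Y} → Residue X x → Residue Y y → Goal
        integral-case {X} {Y} res-x res-y = by-cases _ ∂y refl _ ∂x refl
          where
          ∂y : Residue (∂y-residue r₁ r₂ r₃ r₄ r₆ X Y) (y + ȳ + a₁ * x̄ + a₃)
          ∂y = residue-+ (residue-+ (residue-+ res-y (residue-conj res-y)) (residue-* res₁ (residue-conj res-x))) res₃
          ∂x : Residue (∂x-residue r₁ r₂ r₃ r₄ r₆ X Y) (x * x + x * x̄ + x̄ * x̄ + a₂ * (x + x̄) + a₄ - a₁ * y)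
          ∂x = residue-- (residue-+ (residue-+ (residue-+ (residue-+ (residue-* res-x res-x) (residue-* res-x res-x̄))
                 (residue-* res-x̄ res-x̄)) (residue-* res₂ (residue-+ res-x res-x̄))) res₄) (residue-* res₁ res-y)
            where res-x̄ = residue-conj res-x
          equation : equation-residue r₁ r₂ r₃ r₄ r₆ X Y ≡ false
          equation = 0-residue
            (residue-- (residue-+ (residue-+ (residue-* res-y res-y) (residue-* (residue-* res₁ res-x) res-y))
                                  (residue-* res₃ res-y))
              (residue-+ (residue-+ (residue-+ (residue-* (residue-* res-x res-x) res-x)
                (residue-* (residue-* res₂ res-x) res-x)) (residue-* res₄ res-x)) res₆))
            (x≡y⇒x-y≡0 on-curve)
          by-cases : ∀ b → Residue b (y + ȳ + a₁ * x̄ + a₃) → ∂y-residue r₁ r₂ r₃ r₄ r₆ X Y ≡ b →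
                     ∀ c → Residue c (x * x + x * x̄ + x̄ * x̄ + a₂ * (x + x̄) + a₄ - a₁ * y) → ∂x-residue r₁ r₂ r₃ r₄ r₆ X Y ≡ c →
                     Goal
          by-cases true  unit _  _     _    _   = from-unit-denominator (X , res-x) (X , res-x) unit μ-x
          by-cases false _    _  true  unit _   = from-unit-denominator (X , res-x) (Y , res-y) unit μ-y
          by-cases false _    eq false _    eq′ = ⊥-elim (smooth X Y equation eq eq′)

        -- The equation is monic in y: dividing it by y² with 1/y in 𝔪 would put 1 in 𝔪.
        integral-y : 𝒪 x → 𝒪 y
        integral-y (X , res-x) with 𝒪-or-inverse y
        ... | inj₁ 𝒪-y = 𝒪-y
        ... | inj₂ (v , yv≡1 , 𝔪-v) = ⊥-elim (𝔪⇒¬Unit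
          (subst 𝔪 (sym ((entail 8 λ x y v a₁ a₂ a₃ a₄ a₆ →
            y :* y :+ a₁ :* x :* y :+ a₃ :* y ⊜ x :* x :* x :+ a₂ :* x :* x :+ a₄ :* x :+ a₆ by v :* v ⇒
            y :* v ⊜ con (+ 1) by :- (y :* v :+ con (+ 1)) :- (a₁ :* x :+ a₃) :* v ⇒
            ⊢ con (+ 1) ⊜ v :* ((x :* x :* x :+ a₂ :* x :* x :+ a₄ :* x :+ a₆) :* v :- (a₁ :* x :+ a₃)))
            x y v a₁ a₂ a₃ a₄ a₆ on-curve yv≡1))
            (residue-* 𝔪-v (residue-- (residue-* (residue-+ (residue-+ (residue-+ (residue-* (residue-* res-x res-x) res-x)
                (residue-* (residue-* res₂ res-x) res-x)) (residue-* res₄ res-x)) res₆) 𝔪-v)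
              (residue-+ (residue-* res₁ res-x) res₃))))
          residue-1)

        -- Near the point at infinity t = x/y is a uniformiser: 1/x = μ′t² with μ′ a unit.
        module Infinite (w : Carrier) (xw≡1 : x * w ≡ 1#) (𝔪-w : 𝔪 w) where

          ε₂ = 1# + (w * a₂ + w * (w * a₄) + w * (w * (w * a₆)))

          unit-ε₂ : Unit ε₂
          unit-ε₂ = residue-+ residue-1 (residue-+ (residue-+ (residue-* 𝔪-w res₂) (residue-* 𝔪-w (residue-* 𝔪-w res₄)))
            (residue-* 𝔪-w (residue-* 𝔪-w (residue-* 𝔪-w res₆))))

          -- Dividing the equation by x² would make x integral, whereas 1/x lies in 𝔪.
          pole-of-y/x : 𝒪 (y * w) → ⊥
          pole-of-y/x (S , res-s) = 𝔪⇒¬Unit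
            (subst 𝔪 (sym ((entail 8 λ x y w a₁ a₂ a₃ a₄ a₆ →
              y :* y :+ a₁ :* x :* y :+ a₃ :* y ⊜ x :* x :* x :+ a₂ :* x :* x :+ a₄ :* x :+ a₆ by :- (w :* w :* w) ⇒
              x :* w ⊜ con (+ 1) by a₁ :* y :* w :* w :- (con (+ 1) :+ x :* w :+ x :* x :* w :* w)
                :- a₂ :* w :* (x :* w :+ con (+ 1)) :- a₄ :* w :* w ⇒
              ⊢ con (+ 1) ⊜ w :* ((y :* w) :* (y :* w) :+ a₁ :* (y :* w) :+ a₃ :* ((y :* w) :* w)
                                   :- (a₂ :+ a₄ :* w :+ a₆ :* (w :* w))))
              x y w a₁ a₂ a₃ a₄ a₆ on-curve xw≡1))
              (residue-* 𝔪-w (residue-- (residue-+ (residue-+ (residue-* res-s res-s) (residue-* res₁ res-s))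
                (residue-* res₃ (residue-* res-s 𝔪-w)))
                (residue-+ (residue-+ res₂ (residue-* res₄ 𝔪-w)) (residue-* res₆ (residue-* 𝔪-w 𝔪-w))))))
            residue-1

          module _ (t : Carrier) (ywt≡1 : y * w * t ≡ 1#) (𝔪-t : 𝔪 t) where

            ε₁ = 1# + t * a₁ + t * (w * a₃)

            unit-ε₁ : Unit ε₁
            unit-ε₁ = residue-+ (residue-+ residue-1 (residue-* 𝔪-t res₁)) (residue-* 𝔪-t (residue-* 𝔪-w res₃))

            -- The curve equation times w³t², simplified by x w = 1 and y w t = 1.
            wε₁≡t²ε₂ : w * ε₁ ≡ t * t * ε₂
            wε₁≡t²ε₂ = (entail 9 λ x y w t a₁ a₂ a₃ a₄ a₆ →
              y :* y :+ a₁ :* x :* y :+ a₃ :* y ⊜ x :* x :* x :+ a₂ :* x :* x :+ a₄ :* x :+ a₆ by w :* w :* w :* t :* t ⇒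
              y :* w :* t ⊜ con (+ 1) by :- (w :* (y :* w :* t :+ con (+ 1))) :- a₁ :* w :* t :- a₃ :* w :* w :* t ⇒
              x :* w ⊜ con (+ 1) by :- (a₁ :* w :* t :* (y :* w :* t)) :+ t :* t :* (con (+ 1) :+ x :* w :+ x :* x :* w :* w
                :+ a₂ :* w :* (x :* w :+ con (+ 1)) :+ a₄ :* w :* w) ⇒
              ⊢ w :* (con (+ 1) :+ t :* a₁ :+ t :* (w :* a₃))
                ⊜ t :* t :* (con (+ 1) :+ (w :* a₂ :+ w :* (w :* a₄) :+ w :* (w :* (w :* a₆)))))
              x y w t a₁ a₂ a₃ a₄ a₆ on-curve ywt≡1 xw≡1

            -- `conj-ratio` yields y - ȳ = 2 z₂ y, which contains only the factor 2; the missing π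
            -- comes from t, since y w² = tν. After scaling by w² the numerator of the second form
            -- of the slope is ω, congruent to 1 + ρ + ρ² and hence to 3 modulo π. In κ²(x + x̄) the
            -- pole of x is cancelled by t²ν = 1/x.
            infinite-case : Goal
            infinite-case =
              let i , ε₁i≡1 , unit-i = Unit-inverse unit-ε₁
                  ν = ε₂ * i
                  unit-ν = residue-* unit-ε₂ unit-i
                  w≡t²ν = (entail 5 λ w t i ε₁ ε₂ → w :* ε₁ ⊜ t :* t :* ε₂ by i ⇒ ε₁ :* i ⊜ con (+ 1) by :- w ⇒
                    ⊢ w ⊜ t :* t :* (ε₂ :* i)) w t i ε₁ ε₂ wε₁≡t²ε₂ ε₁i≡1
                  yw²≡tν = (entail 4 λ y w t ν → w ⊜ t :* t :* ν by y :* w ⇒ y :* w :* t ⊜ con (+ 1) by t :* ν ⇒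
                    ⊢ y :* w :* w ⊜ t :* ν) y w t ν w≡t²ν ywt≡1
                  z₁ , 𝒪-z₁ , x̄≡ = conj-ratio (λ x≡0 → 1≢0 (trans (sym xw≡1) (trans (cong (_* w) x≡0) (zeroˡ w))))
                  z₂ , 𝒪-z₂ , ȳ≡ = conj-ratio (λ y≡0 → 1≢0 (trans (sym ywt≡1)
                    ((entail 3 λ y w t → y ⊜ con (+ 0) by w :* t ⇒ ⊢ y :* w :* t ⊜ con (+ 0)) y w t y≡0)))
                  ρ = 1# - φ (+ 2) * z₁
                  unit-ρ = residue-- residue-1 (residue-* residue-2 (proj₂ 𝒪-z₁))
                  U = x * x + x * x̄ + x̄ * x̄ + a₂ * (x + x̄) + a₄ - a₁ * y
                  ω = (1# + ρ + ρ * ρ) + w * (a₂ * (1# + ρ)) + w * (w * a₄) - t * (ν * a₁)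
                  unit-ω = residue-- (residue-+ (residue-+ (residue-+ (residue-+ residue-1 unit-ρ) (residue-* unit-ρ unit-ρ))
                      (residue-* 𝔪-w (residue-* res₂ (residue-+ residue-1 unit-ρ)))) (residue-* 𝔪-w (residue-* 𝔪-w res₄)))
                      (residue-* 𝔪-t (residue-* unit-ν res₁))
                  Uw²≡ω = (entail 10 λ x x̄ y w t ν ρ a₁ a₂ a₄ →
                    x̄ ⊜ x :* ρ by (x :+ x̄ :+ x :* ρ :+ a₂) :* w :* w ⇒
                    x :* w ⊜ con (+ 1) by (x :* w :+ con (+ 1)) :* (con (+ 1) :+ ρ :+ ρ :* ρ) :+ a₂ :* w :* (con (+ 1) :+ ρ) ⇒
                    y :* w :* w ⊜ t :* ν by :- a₁ ⇒
                    ⊢ (x :* x :+ x :* x̄ :+ x̄ :* x̄ :+ a₂ :* (x :+ x̄) :+ a₄ :- a₁ :* y) :* w :* w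
                      ⊜ (con (+ 1) :+ ρ :+ ρ :* ρ) :+ w :* (a₂ :* (con (+ 1) :+ ρ)) :+ w :* (w :* a₄) :- t :* (ν :* a₁))
                    x x̄ y w t ν ρ a₁ a₂ a₄ x̄≡ xw≡1 yw²≡tν
                  j , ωj≡1 , unit-j = Unit-inverse unit-ω
                  t′ , 𝒪-t′ , t≡πt′ = 𝔪⇒π∣ 𝔪-t
                  𝒪-ν = true , unit-ν
                  𝒪-zj = 𝒪-z₂ · (true , unit-j)
                  q = z₂ * j
                  z = t′ * (ν * q)
                  κ = φ (+ 2) * π * z
                  μκ≡1 = (entail 12 λ y ȳ w t μ ν z₂ j U ω π t′ →
                    t ⊜ π :* t′ by con -[1+ 1 ] :* μ :* ν :* z₂ :* j ⇒
                    y :* w :* w ⊜ t :* ν by con -[1+ 1 ] :* μ :* z₂ :* j ⇒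
                    ȳ ⊜ y :* (con (+ 1) :- con (+ 2) :* z₂) by μ :* w :* w :* j ⇒
                    (y :- ȳ) :* μ ⊜ U by w :* w :* j ⇒
                    U :* w :* w ⊜ ω by j ⇒
                    ω :* j ⊜ con (+ 1) by con (+ 1) ⇒
                    ⊢ μ :* (con (+ 2) :* π :* (t′ :* (ν :* (z₂ :* j)))) ⊜ con (+ 1))
                    y ȳ w t μ ν z₂ j U ω π t′ t≡πt′ yw²≡tν ȳ≡ μ-y Uw²≡ω ωj≡1
                  κ≡2tνq = (entail 5 λ t ν q π t′ → t ⊜ π :* t′ by con -[1+ 1 ] :* ν :* q ⇒
                    ⊢ con (+ 2) :* π :* (t′ :* (ν :* q)) ⊜ con (+ 2) :* t :* (ν :* q)) t ν q π t′ t≡πt′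
                  κ²x≡ = (entail 8 λ x x̄ w t ν ρ q κ →
                    κ ⊜ con (+ 2) :* t :* (ν :* q) by (κ :+ con (+ 2) :* t :* (ν :* q)) :* (x :+ x̄) ⇒
                    x̄ ⊜ x :* ρ by con (+ 4) :* t :* t :* ν :* q :* ν :* q ⇒
                    w ⊜ t :* t :* ν by con -[1+ 3 ] :* ν :* q :* q :* x :* (con (+ 1) :+ ρ) ⇒
                    x :* w ⊜ con (+ 1) by con (+ 4) :* ν :* q :* q :* (con (+ 1) :+ ρ) ⇒
                    ⊢ κ :* κ :* (x :+ x̄) ⊜ con (+ 2) :* (con (+ 2) :* (ν :* (q :* q) :* (con (+ 1) :+ ρ))))
                    x x̄ w t ν ρ q κ κ≡2tνq x̄≡ w≡t²ν xw≡1
              in from-inverse-slope κ z (𝒪-t′ · (𝒪-ν · 𝒪-zj)) refl μκ≡1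
                (subst 𝔪 (sym κ²x≡) (residue-* residue-2 (residue-* residue-2
                  (residue-* (residue-* unit-ν (residue-* (proj₂ 𝒪-zj) (proj₂ 𝒪-zj))) (residue-+ residue-1 unit-ρ)))))
              where
              1≢0 : 1# ≢ 0#
              1≢0 1≡0 with 0-residue residue-1 1≡0
              ... | ()

      conjugate-difference : ∃ λ z → 𝒪 z × x₃ * (φ (+ 8) * z) ≡ 1#
      conjugate-difference with 𝒪-or-inverse x
      ... | inj₁ 𝒪-x = integral-case (proj₂ 𝒪-x) (proj₂ (integral-y 𝒪-x))
      ... | inj₂ (w , xw≡1 , 𝔪-w) with 𝒪-or-inverse (y * w)
      ...   | inj₁ 𝒪-s              = ⊥-elim (Infinite.pole-of-y/x w xw≡1 𝔪-w 𝒪-s)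
      ...   | inj₂ (t , ywt≡1 , 𝔪-t) = Infinite.infinite-case w xw≡1 𝔪-w t ywt≡1 𝔪-t

-- The duplication formula deep in the kernel of reduction.

module Doubling (F : Field) (R : RamifiedConjugation F) where

  open Field F
  open Identities F
  open RamifiedConjugation R

  module Curve
    {A B C b₂ b₄ b₆ b₈ : Carrier}
    (b₂≡ : b₂ ≡ φ (+ 4) * A) (b₄≡ : b₄ ≡ φ (+ 2) * B)
    (b₆≡ : b₆ ≡ φ (+ 4) * C) (b₈≡ : b₈ ≡ φ (+ 4) * A * C - B * B)
    (𝒪-b₂ : 𝒪 b₂) (𝒪-b₄ : 𝒪 b₄) (𝒪-b₆ : 𝒪 b₆) (𝒪-b₈ : 𝒪 b₈)
    {x z : Carrier} (𝒪-z : 𝒪 z) (x8z≡1 : x * (φ (+ 8) * z) ≡ 1#)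
    where

    private
      infixl 7 _·_
      _·_ : ∀ {x y} → 𝒪 x → 𝒪 y → 𝒪 (x * y)
      (_ , p) · (_ , q) = _ , residue-* p q
      infixl 6 _⊹_
      _⊹_ : ∀ {x y} → 𝒪 x → 𝒪 y → 𝒪 (x + y)
      (_ , p) ⊹ (_ , q) = _ , residue-+ p q

      -- With ξ = 8z = 1/x, division by x⁴ turns the denominator of the duplication formula into 32
      -- z V and its numerator into W; this fixes all the constants.
      V W : Carrier
      V = 1# + φ (+ 2) * (z * (b₂ + φ (+ 16) * (z * b₄) + φ (+ 64) * (z * z * b₆)))
      W = 1# - φ (+ 2) * (z * z * (φ (+ 32) * b₄ + φ (+ 512) * (z * b₆) + φ (+ 2048) * (z * z * b₈)))

      unit-V : Unit V
      unit-V = residue-+ residue-1 (residue-* residue-2 (proj₂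
        (𝒪-z · (𝒪-b₂ ⊹ 𝒪-φ (+ 16) · (𝒪-z · 𝒪-b₄) ⊹ 𝒪-φ (+ 64) · (𝒪-z · 𝒪-z · 𝒪-b₆)))))

      unit-W : Unit W
      unit-W = residue-- residue-1 (residue-* residue-2 (proj₂
        (𝒪-z · 𝒪-z · (𝒪-φ (+ 32) · 𝒪-b₄ ⊹ 𝒪-φ (+ 512) · (𝒪-z · 𝒪-b₆) ⊹ 𝒪-φ (+ 2048) · (𝒪-z · 𝒪-z · 𝒪-b₈)))))

      -- The duplication formula: multiply x₃ = m² - A - 2x by 4y² and replace 2 y m by f′.
      quartic : ∀ {y m x₃} → y * y ≡ x * x * x + A * x * x + B * x + C →
                φ (+ 3) * x * x + φ (+ 2) * A * x + B ≡ φ (+ 2) * y * m + (x - x) * (x - x₃) →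
                x + x + x₃ + A ≡ m * m →
                x₃ * (φ (+ 4) * x * x * x + b₂ * x * x + φ (+ 2) * b₄ * x + b₆)
                  ≡ x * x * x * x - b₄ * x * x - φ (+ 2) * b₆ * x - b₈
      quartic {y} {m} {x₃} on′ derivative σ₁ = (entail 11 λ x y m x₃ A B C b₂ b₄ b₆ b₈ →
        y :* y ⊜ x :* x :* x :+ A :* x :* x :+ B :* x :+ C by con -[1+ 3 ] :* (x₃ :+ con (+ 2) :* x :+ A) ⇒
        con (+ 3) :* x :* x :+ con (+ 2) :* A :* x :+ B ⊜ con (+ 2) :* y :* m :+ (x :- x) :* (x :- x₃)
          by :- (con (+ 3) :* x :* x :+ con (+ 2) :* A :* x :+ B :+ con (+ 2) :* y :* m) ⇒
        x :+ x :+ x₃ :+ A ⊜ m :* m by con (+ 4) :* y :* y ⇒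
        b₂ ⊜ con (+ 4) :* A by x₃ :* x :* x ⇒
        b₄ ⊜ con (+ 2) :* B by con (+ 2) :* x₃ :* x :+ x :* x ⇒
        b₆ ⊜ con (+ 4) :* C by x₃ :+ con (+ 2) :* x ⇒
        b₈ ⊜ con (+ 4) :* A :* C :- B :* B by con (+ 1) ⇒
        ⊢ x₃ :* (con (+ 4) :* x :* x :* x :+ b₂ :* x :* x :+ con (+ 2) :* b₄ :* x :+ b₆)
          ⊜ x :* x :* x :* x :- b₄ :* x :* x :- con (+ 2) :* b₆ :* x :- b₈)
        x y m x₃ A B C b₂ b₄ b₆ b₈ on′ derivative σ₁ b₂≡ b₄≡ b₆≡ b₈≡

    -- The exact factor is 4V/W. It is recorded as 2r with r integral, a form that persists when
    -- doubling is iterated.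
    double : ∀ {y m x₃} → y * y ≡ x * x * x + A * x * x + B * x + C →
             φ (+ 3) * x * x + φ (+ 2) * A * x + B ≡ φ (+ 2) * y * m + (x - x) * (x - x₃) →
             x + x + x₃ + A ≡ m * m →
             ∃ λ r → 𝒪 r × x₃ * (φ (+ 8) * (z * (φ (+ 2) * r))) ≡ 1#
    double {y} {m} {x₃} on-cubic derivative σ₁ =
      let i , W*i≡1 , unit-i = Unit-inverse unit-W
      in φ (+ 2) * (V * i) , 𝒪-φ (+ 2) · ((true , unit-V) · (true , unit-i)) ,
        (entail 8 λ x x₃ z b₂ b₄ b₆ b₈ i → let ξ = con (+ 8) :* z in
          x₃ :* (con (+ 4) :* x :* x :* x :+ b₂ :* x :* x :+ con (+ 2) :* b₄ :* x :+ b₆)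
            ⊜ x :* x :* x :* x :- b₄ :* x :* x :- con (+ 2) :* b₆ :* x :- b₈ by ξ :* ξ :* ξ :* ξ :* i ⇒
          x :* ξ ⊜ con (+ 1) by
            (:- (x₃ :* (con (+ 4) :* ξ :* (con (+ 1) :+ x :* ξ :+ x :* ξ :* x :* ξ)
                        :+ b₂ :* ξ :* ξ :* (con (+ 1) :+ x :* ξ) :+ con (+ 2) :* b₄ :* ξ :* ξ :* ξ))
             :+ (con (+ 1) :+ x :* ξ) :* (con (+ 1) :+ x :* ξ :* x :* ξ)
             :- b₄ :* ξ :* ξ :* (con (+ 1) :+ x :* ξ) :- con (+ 2) :* b₆ :* ξ :* ξ :* ξ) :* i ⇒
          (con (+ 1) :- con (+ 2) :* (z :* z :* (con (+ 32) :* b₄ :+ con (+ 512) :* (z :* b₆) :+ con (+ 2048) :* (z :* z :* b₈)))) :* i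
            ⊜ con (+ 1) by con (+ 1) ⇒
          ⊢ x₃ :* (con (+ 8) :* (z :* (con (+ 2) :* (con (+ 2) :*
              ((con (+ 1) :+ con (+ 2) :* (z :* (b₂ :+ con (+ 16) :* (z :* b₄) :+ con (+ 64) :* (z :* z :* b₆)))) :* i)))))
            ⊜ con (+ 1)) x x₃ z b₂ b₄ b₆ b₈ i (quartic on-cubic derivative σ₁) x8z≡1 W*i≡1

    -- 4f(x) = 4x³ V, where V is a unit and x is invertible.
    not-2-torsion : ∀ {y} → y * y ≡ x * x * x + A * x * x + B * x + C → y ≢ 0#
    not-2-torsion {y} on-cubic y≡0 =
      let j , V*j≡1 , _ = Unit-inverse unit-V in
      𝔪⇒¬Unit (subst 𝔪 ((entail 0 (⊢ con (+ 1) :- con (+ 1) ⊜ con (+ 0)))) (residue-- residue-1 residue-1))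
        (subst Unit
          ((entail 6 λ x z b₂ b₄ b₆ j → let ξ = con (+ 8) :* z in
            con (+ 4) :* x :* x :* x :+ b₂ :* x :* x :+ con (+ 2) :* b₄ :* x :+ b₆ ⊜ con (+ 0) by con (+ 2) :* x :* z :* j :* ξ :* ξ :* ξ ⇒
            x :* ξ ⊜ con (+ 1) by con -[1+ 0 ] :- con (+ 2) :* x :* z :* j :*
              (con (+ 4) :* (con (+ 1) :+ x :* ξ :+ x :* ξ :* x :* ξ) :+ b₂ :* ξ :* (con (+ 1) :+ x :* ξ) :+ con (+ 2) :* b₄ :* ξ :* ξ) ⇒
            (con (+ 1) :+ con (+ 2) :* (z :* (b₂ :+ con (+ 16) :* (z :* b₄) :+ con (+ 64) :* (z :* z :* b₆)))) :* j ⊜ con (+ 1)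
              by con -[1+ 7 ] :* x :* z ⇒
            ⊢ con (+ 1) ⊜ con (+ 0)) x z b₂ b₄ b₆ j
            ((entail 8 λ x y A B C b₂ b₄ b₆ →
              y ⊜ con (+ 0) by con (+ 4) :* y ⇒
              y :* y ⊜ x :* x :* x :+ A :* x :* x :+ B :* x :+ C by con -[1+ 3 ] ⇒
              b₂ ⊜ con (+ 4) :* A by x :* x ⇒ b₄ ⊜ con (+ 2) :* B by con (+ 2) :* x ⇒ b₆ ⊜ con (+ 4) :* C by con (+ 1) ⇒
              ⊢ con (+ 4) :* x :* x :* x :+ b₂ :* x :* x :+ con (+ 2) :* b₄ :* x :+ b₆ ⊜ con (+ 0))
              x y A B C b₂ b₄ b₆ y≡0 on-cubic b₂≡ b₄≡ b₆≡)
            x8z≡1 V*j≡1) residue-1)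

-- Change of variables on the completed cubic.

module Rescaling (F : Field) where

  open Field F
  open Identities F

  module Curve
    {A B C A′ B′ C′ : Carrier} (r v : Carrier)
    (A′≡ : A′ ≡ v * v * (A + φ (+ 3) * r))
    (B′≡ : B′ ≡ v * v * v * v * (B + φ (+ 2) * r * A + φ (+ 3) * r * r))
    (C′≡ : C′ ≡ v * v * v * v * v * v * (C + r * B + r * r * A + r * r * r))
    where

    rescale-cubic : ∀ {x y} → y * y ≡ x * x * x + A * x * x + B * x + C →
      let x′ = (x - r) * v * v ; y′ = y * v * v * v in
      y′ * y′ ≡ x′ * x′ * x′ + A′ * x′ * x′ + B′ * x′ + C′
    rescale-cubic {x} {y} on = (entail 10 λ x y r v A B C A′ B′ C′ →
      let v⁴ = v :* v :* v :* v ; v⁶ = v⁴ :* v :* v ; x′ = (x :- r) :* v :* v in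
      y :* y ⊜ x :* x :* x :+ A :* x :* x :+ B :* x :+ C by v⁶ ⇒
      A′ ⊜ v :* v :* (A :+ con (+ 3) :* r) by :- (x′ :* x′) ⇒
      B′ ⊜ v⁴ :* (B :+ con (+ 2) :* r :* A :+ con (+ 3) :* r :* r) by :- x′ ⇒
      C′ ⊜ v⁶ :* (C :+ r :* B :+ r :* r :* A :+ r :* r :* r) by con -[1+ 0 ] ⇒
      ⊢ y :* v :* v :* v :* (y :* v :* v :* v) ⊜ x′ :* x′ :* x′ :+ A′ :* x′ :* x′ :+ B′ :* x′ :+ C′)
      x y r v A B C A′ B′ C′ on A′≡ B′≡ C′≡

    rescale-derivative : ∀ {x y m x₃} →
      φ (+ 3) * x * x + φ (+ 2) * A * x + B ≡ φ (+ 2) * y * m + (x - x) * (x - x₃) →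
      let x′ = (x - r) * v * v ; x₃′ = (x₃ - r) * v * v in
      φ (+ 3) * x′ * x′ + φ (+ 2) * A′ * x′ + B′ ≡ φ (+ 2) * (y * v * v * v) * (m * v) + (x′ - x′) * (x′ - x₃′)
    rescale-derivative {x} {y} {m} {x₃} eq = (entail 10 λ x y m x₃ r v A B A′ B′ →
      let v⁴ = v :* v :* v :* v ; x′ = (x :- r) :* v :* v ; x₃′ = (x₃ :- r) :* v :* v in
      con (+ 3) :* x :* x :+ con (+ 2) :* A :* x :+ B ⊜ con (+ 2) :* y :* m :+ (x :- x) :* (x :- x₃) by v⁴ ⇒
      A′ ⊜ v :* v :* (A :+ con (+ 3) :* r) by con (+ 2) :* x′ ⇒
      B′ ⊜ v⁴ :* (B :+ con (+ 2) :* r :* A :+ con (+ 3) :* r :* r) by con (+ 1) ⇒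
      ⊢ con (+ 3) :* x′ :* x′ :+ con (+ 2) :* A′ :* x′ :+ B′
        ⊜ con (+ 2) :* (y :* v :* v :* v) :* (m :* v) :+ (x′ :- x′) :* (x′ :- x₃′))
      x y m x₃ r v A B A′ B′ eq A′≡ B′≡

    rescale-on : ∀ {x y m n} → y ≡ m * x + n → y * v * v * v ≡ m * v * ((x - r) * v * v) + (n + m * r) * v * v * v
    rescale-on {x} {y} {m} {n} = (entail 6 λ x y m n r v → y ⊜ m :* x :+ n by v :* v :* v ⇒
      ⊢ y :* v :* v :* v ⊜ m :* v :* ((x :- r) :* v :* v) :+ (n :+ m :* r) :* v :* v :* v) x y m n r v

    module _ {a b c m n : Carrier} (σ₁ : a + b + c + A ≡ m * m) where

      private
        a′ b′ c′ m′ n′ : Carrier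
        a′ = (a - r) * v * v
        b′ = (b - r) * v * v
        c′ = (c - r) * v * v
        m′ = m * v
        n′ = (n + m * r) * v * v * v

      rescale-σ₁ : a′ + b′ + c′ + A′ ≡ m′ * m′
      rescale-σ₁ = (entail 8 λ a b c m A r v A′ →
        a :+ b :+ c :+ A ⊜ m :* m by v :* v ⇒ A′ ⊜ v :* v :* (A :+ con (+ 3) :* r) by con (+ 1) ⇒
        ⊢ (a :- r) :* v :* v :+ (b :- r) :* v :* v :+ (c :- r) :* v :* v :+ A′ ⊜ m :* v :* (m :* v)) a b c m A r v A′ σ₁ A′≡

      module _ (σ₂ : a * b + b * c + c * a + φ (+ 2) * m * n ≡ B) where

        rescale-σ₂ : a′ * b′ + b′ * c′ + c′ * a′ + φ (+ 2) * m′ * n′ ≡ B′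
        rescale-σ₂ = (entail 10 λ a b c m n A B r v B′ → let v⁴ = v :* v :* v :* v in
          a :+ b :+ c :+ A ⊜ m :* m by con -[1+ 1 ] :* r :* v⁴ ⇒
          a :* b :+ b :* c :+ c :* a :+ con (+ 2) :* m :* n ⊜ B by v⁴ ⇒
          B′ ⊜ v⁴ :* (B :+ con (+ 2) :* r :* A :+ con (+ 3) :* r :* r) by con -[1+ 0 ] ⇒
          ⊢ (a :- r) :* v :* v :* ((b :- r) :* v :* v) :+ (b :- r) :* v :* v :* ((c :- r) :* v :* v)
            :+ (c :- r) :* v :* v :* ((a :- r) :* v :* v)
            :+ con (+ 2) :* (m :* v) :* ((n :+ m :* r) :* v :* v :* v) ⊜ B′) a b c m n A B r v B′ σ₁ σ₂ B′≡

-- The slope μ of the line through (x, y) and the inverse of (x̄, ȳ), in two forms neither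
-- of which divides by a coordinate difference.
module Slope (F : Field) where

  open Field F
  open Identities F

  module Line
    {h a₁ a₂ a₃ a₄ A B x x̄ y ȳ x₃ m n : Carrier}
    (2h≡1 : φ (+ 2) * h ≡ 1#) (A≡ : A ≡ a₂ + h * h * a₁ * a₁) (B≡ : B ≡ a₄ + h * a₁ * a₃)
    (on₁ : y + h * (a₁ * x + a₃) ≡ m * x + n) (on₂ : - (ȳ + h * (a₁ * x̄ + a₃)) ≡ m * x̄ + n)
    (σ₁ : x + x̄ + x₃ + A ≡ m * m) (σ₂ : x * x̄ + x̄ * x₃ + x₃ * x + φ (+ 2) * m * n ≡ B)
    where

    μ : Carrier
    μ = m - h * a₁

    μ-x : (x - x̄) * μ ≡ y + ȳ + a₁ * x̄ + a₃
    μ-x = (entail 9 λ x x̄ y ȳ m n h a₁ a₃ →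
      con (+ 2) :* h ⊜ con (+ 1) by a₁ :* x̄ :+ a₃ ⇒
      y :+ h :* (a₁ :* x :+ a₃) ⊜ m :* x :+ n by con -[1+ 0 ] ⇒
      :- (ȳ :+ h :* (a₁ :* x̄ :+ a₃)) ⊜ m :* x̄ :+ n by con (+ 1) ⇒
      ⊢ (x :- x̄) :* (m :- h :* a₁) ⊜ y :+ ȳ :+ a₁ :* x̄ :+ a₃) x x̄ y ȳ m n h a₁ a₃ 2h≡1 on₁ on₂

    μ-y : (y - ȳ) * μ ≡ x * x + x * x̄ + x̄ * x̄ + a₂ * (x + x̄) + a₄ - a₁ * y
    μ-y = (entail 14 λ x x̄ y ȳ x₃ m n h a₁ a₂ a₃ a₄ A B →
      con (+ 2) :* h ⊜ con (+ 1) by :- (h :* a₁ :* a₃) :- a₁ :* y ⇒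
      A ⊜ a₂ :+ h :* h :* a₁ :* a₁ by x :+ x̄ ⇒
      B ⊜ a₄ :+ h :* a₁ :* a₃ by con (+ 1) ⇒
      y :+ h :* (a₁ :* x :+ a₃) ⊜ m :* x :+ n by m :+ h :* a₁ ⇒
      :- (ȳ :+ h :* (a₁ :* x̄ :+ a₃)) ⊜ m :* x̄ :+ n by m :- h :* a₁ ⇒
      x :+ x̄ :+ x₃ :+ A ⊜ m :* m by :- (x :+ x̄) ⇒
      x :* x̄ :+ x̄ :* x₃ :+ x₃ :* x :+ con (+ 2) :* m :* n ⊜ B by con (+ 1) ⇒
      ⊢ (y :- ȳ) :* (m :- h :* a₁)
        ⊜ x :* x :+ x :* x̄ :+ x̄ :* x̄ :+ a₂ :* (x :+ x̄) :+ a₄ :- a₁ :* y)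
      x x̄ y ȳ x₃ m n h a₁ a₂ a₃ a₄ A B 2h≡1 A≡ B≡ on₁ on₂ σ₁ σ₂

    μ-x₃ : x₃ ≡ μ * μ + a₁ * μ - a₂ - x - x̄
    μ-x₃ = (entail 8 λ x x̄ x₃ m h a₁ a₂ A →
      con (+ 2) :* h ⊜ con (+ 1) by a₁ :* m :- h :* a₁ :* a₁ ⇒
      A ⊜ a₂ :+ h :* h :* a₁ :* a₁ by con -[1+ 0 ] ⇒
      x :+ x̄ :+ x₃ :+ A ⊜ m :* m by con (+ 1) ⇒
      ⊢ x₃ ⊜ (m :- h :* a₁) :* (m :- h :* a₁) :+ a₁ :* (m :- h :* a₁) :- a₂ :- x :- x̄)
      x x̄ x₃ m h a₁ a₂ A 2h≡1 A≡ σ₁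

uncompleted-square : (F : Field) (let open Field F) (let open Identities F) {h a₁ a₂ a₃ a₄ a₆ A B C x Y : Carrier} →
  φ (+ 2) * h ≡ 1# → A ≡ a₂ + h * h * a₁ * a₁ → B ≡ a₄ + h * a₁ * a₃ → C ≡ a₆ + h * h * a₃ * a₃ →
  Y * Y ≡ x * x * x + A * x * x + B * x + C →
  let y = Y - h * (a₁ * x + a₃) in y * y + a₁ * x * y + a₃ * y ≡ x * x * x + a₂ * x * x + a₄ * x + a₆
uncompleted-square F {h} {a₁} {a₂} {a₃} {a₄} {a₆} {A} {B} {C} {x} {Y} = (entail 11 λ x Y h a₁ a₂ a₃ a₄ a₆ A B C →
    let y = Y :- h :* (a₁ :* x :+ a₃) in
    con (+ 2) :* h ⊜ con (+ 1) by :- (y :* (a₁ :* x :+ a₃) :+ h :* a₁ :* a₃ :* x) ⇒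
    A ⊜ a₂ :+ h :* h :* a₁ :* a₁ by x :* x ⇒ B ⊜ a₄ :+ h :* a₁ :* a₃ by x ⇒ C ⊜ a₆ :+ h :* h :* a₃ :* a₃ by con (+ 1) ⇒
    Y :* Y ⊜ x :* x :* x :+ A :* x :* x :+ B :* x :+ C by con (+ 1) ⇒
    ⊢ y :* y :+ a₁ :* x :* y :+ a₃ :* y ⊜ x :* x :* x :+ a₂ :* x :* x :+ a₄ :* x :+ a₆)
    x Y h a₁ a₂ a₃ a₄ a₆ A B C
  where open Identities F

-- 2-adic integrality and parity of rational numbers

open import Defs
open import Data.Nat.Divisibility using (_∣_)
open import Data.Rational as ℚ using (ℚ; mkℚ; 0ℚ; 1ℚ; ≢-nonZero; _+_; _*_; _-_; -_)
import Data.Rational.Properties as ℚₚ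
import Data.Rational.Unnormalised as ℚᵘ
import Data.Rational.Unnormalised.Properties as ℚᵘₚ

private
  toℚᵘ-/1 : ∀ z → ℚ.toℚᵘ (z ℚ./ 1) ℚᵘ.≃ ℚᵘ.mkℚᵘ z 0
  toℚᵘ-/1 z = ℚₚ.toℚᵘ-fromℚᵘ (ℚᵘ.mkℚᵘ z 0)

  /1-+ : ∀ m n → (m ℤ.+ n) ℚ./ 1 ≡ m ℚ./ 1 ℚ.+ n ℚ./ 1
  /1-+ m n = ℚₚ.toℚᵘ-injective (begin
    ℚ.toℚᵘ ((m ℤ.+ n) ℚ./ 1)                    ≈⟨ toℚᵘ-/1 (m ℤ.+ n) ⟩
    ℚᵘ.mkℚᵘ (m ℤ.+ n) 0                         ≈⟨ ℚᵘ.*≡* (over-1 m n) ⟩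
    ℚᵘ.mkℚᵘ m 0 ℚᵘ.+ ℚᵘ.mkℚᵘ n 0                ≈⟨ ℚᵘₚ.+-cong (toℚᵘ-/1 m) (toℚᵘ-/1 n) ⟨
    ℚ.toℚᵘ (m ℚ./ 1) ℚᵘ.+ ℚ.toℚᵘ (n ℚ./ 1)      ≈⟨ ℚₚ.toℚᵘ-homo-+ (m ℚ./ 1) (n ℚ./ 1) ⟨
    ℚ.toℚᵘ (m ℚ./ 1 ℚ.+ n ℚ./ 1)                ∎)
    where
    open import Relation.Binary.Reasoning.Setoid ℚᵘₚ.≃-setoid
    over-1 : ∀ m n → (m ℤ.+ n) ℤ.* (+ 1) ≡ (m ℤ.* (+ 1) ℤ.+ n ℤ.* (+ 1)) ℤ.* (+ 1)
    over-1 = ℤ-Solver.solve-∀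

  /1-* : ∀ m n → (m ℤ.* n) ℚ./ 1 ≡ (m ℚ./ 1) ℚ.* (n ℚ./ 1)
  /1-* m n = ℚₚ.toℚᵘ-injective (begin
    ℚ.toℚᵘ ((m ℤ.* n) ℚ./ 1)                    ≈⟨ toℚᵘ-/1 (m ℤ.* n) ⟩
    ℚᵘ.mkℚᵘ m 0 ℚᵘ.* ℚᵘ.mkℚᵘ n 0                ≈⟨ ℚᵘₚ.*-cong (toℚᵘ-/1 m) (toℚᵘ-/1 n) ⟨
    ℚ.toℚᵘ (m ℚ./ 1) ℚᵘ.* ℚ.toℚᵘ (n ℚ./ 1)      ≈⟨ ℚₚ.toℚᵘ-homo-* (m ℚ./ 1) (n ℚ./ 1) ⟨
    ℚ.toℚᵘ ((m ℚ./ 1) ℚ.* (n ℚ./ 1))                ∎)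
    where open import Relation.Binary.Reasoning.Setoid ℚᵘₚ.≃-setoid

  inv-inverseʳ : ∀ {x} → x ≢ 0ℚ → x ℚ.* inv x ≡ 1ℚ
  inv-inverseʳ {x} x≢0 with x ℚₚ.≟ 0ℚ
  ... | yes x≡0 = ⊥-elim (x≢0 x≡0)
  ... | no  x≢0 = ℚₚ.*-inverseʳ x {{≢-nonZero x≢0}}

ℚ-field : Field
ℚ-field = record
  { _+_ = ℚ._+_ ; _*_ = ℚ._*_ ; _-_ = ℚ._-_ ; -_ = ℚ.-_ ; inv = inv ; φ = λ z → z ℚ./ 1
  ; isCommutativeRing = ℚₚ.+-*-isCommutativeRing
  ; x-y≡x+-y = λ _ _ → refl ; φ-+ = /1-+ ; φ-* = /1-* ; _≟_ = ℚₚ._≟_ ; inverseʳ = inv-inverseʳ }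

open Field ℚ-field public using (φ; φ-+; φ-*) 
open Identities ℚ-field public


φ-injective : ∀ {m n} → φ m ≡ φ n → m ≡ n
φ-injective {m} {n} eq with ℚₚ./-injective-≃ (ℚᵘ.mkℚᵘ m 0) (ℚᵘ.mkℚᵘ n 0) eq
... | ℚᵘ.*≡* eq′ = trans (sym (ℤₚ.*-identityʳ m)) (trans eq′ (ℤₚ.*-identityʳ n))

*-denominator : ∀ q → q * φ (ℚ.↧ q) ≡ φ (ℚ.↥ q)
*-denominator q@(mkℚ n d-1 _) = ℚₚ.toℚᵘ-injective (begin
  ℚ.toℚᵘ (q * φ (ℚ.↧ q))                           ≈⟨ ℚₚ.toℚᵘ-homo-* q (φ (ℚ.↧ q)) ⟩
  ℚᵘ.mkℚᵘ n d-1 ℚᵘ.* ℚ.toℚᵘ (φ (ℚ.↧ q))            ≈⟨ ℚᵘₚ.*-congˡ {ℚᵘ.mkℚᵘ n d-1} (toℚᵘ-/1 (ℚ.↧ q)) ⟩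
  ℚᵘ.mkℚᵘ n d-1 ℚᵘ.* ℚᵘ.mkℚᵘ (ℚ.↧ q) 0             ≈⟨ ℚᵘ.*≡* cross ⟩
  ℚᵘ.mkℚᵘ n 0                                      ≈⟨ toℚᵘ-/1 n ⟨
  ℚ.toℚᵘ (φ n)                                     ∎)
  where
  open import Relation.Binary.Reasoning.Setoid ℚᵘₚ.≃-setoid
  cross : (n ℤ.* + (ℕ.suc d-1)) ℤ.* (+ 1) ≡ n ℤ.* + (ℕ.suc d-1 ℕ.* 1)
  cross = trans (ℤₚ.*-identityʳ _) (cong (λ k → n ℤ.* + k) (sym (ℕₚ.*-identityʳ (ℕ.suc d-1))))

halves : ∀ z → ∃ λ w → z ≡ (+ 2) ℤ.* w ⊎ z ≡ (+ 1) ℤ.+ (+ 2) ℤ.* w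
halves z with z ℤDM.% (+ 2) | a≡a%n+[a/n]*n z (+ 2) | n%d<d z (+ 2)
... | 0 | eq | _ = z ℤDM./ (+ 2) , inj₁ (trans eq (trans (ℤₚ.+-identityˡ (z ℤDM./ (+ 2) ℤ.* (+ 2))) (ℤₚ.*-comm (z ℤDM./ (+ 2)) (+ 2))))
... | 1 | eq | _ = z ℤDM./ (+ 2) , inj₂ (trans eq (cong (λ w → (+ 1) ℤ.+ w) (ℤₚ.*-comm (z ℤDM./ (+ 2)) (+ 2))))
... | ℕ.suc (ℕ.suc _) | _ | ℕ.s≤s (ℕ.s≤s ())

2∣⇒double : ∀ z → 2 ℕD.∣ ∣ z ∣ → ∃ λ w → z ≡ (+ 2) ℤ.* w
2∣⇒double z 2∣z with ∣ᵤ⇒∣ {+ 2} {z} 2∣z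
... | divides w eq = w , trans eq (ℤₚ.*-comm w (+ 2))

∤2⇒odd : ∀ z → ¬ 2 ℕD.∣ ∣ z ∣ → ∃ λ w → z ≡ (+ 1) ℤ.+ (+ 2) ℤ.* w
∤2⇒odd z 2∤z with halves z
... | w , inj₂ eq   = w , eq
... | w , inj₁ refl = ⊥-elim (2∤z (ℕD.divides ∣ w ∣ (trans (ℤₚ.abs-* (+ 2) w) (ℕₚ.*-comm 2 ∣ w ∣))))

odd≢0 : ∀ w → (+ 1) ℤ.+ (+ 2) ℤ.* w ≢ + 0
odd≢0 (+ ℕ.zero)    ()
odd≢0 (+ ℕ.suc n)   ()
odd≢0 -[1+ n ] eq = ℕₚ.even≢odd (ℕ.suc n) 0 (ℤₚ.+-injective (begin
  + (2 ℕ.* ℕ.suc n)                          ≡⟨ cong (λ k → ℤ.- k) (lemma ((+ 2) ℤ.* -[1+ n ])) ⟩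
  ℤ.- ((+ 1) ℤ.+ (+ 2) ℤ.* -[1+ n ] ℤ.+ -[1+ 0 ])  ≡⟨ cong (λ k → ℤ.- (k ℤ.+ -[1+ 0 ])) eq ⟩
  + 1                                        ∎))
  where
  open ≡-Reasoning
  lemma : ∀ k → k ≡ (+ 1) ℤ.+ k ℤ.+ -[1+ 0 ]
  lemma = ℤ-Solver.solve-∀

φ-odd : ∀ w → φ ((+ 1) ℤ.+ (+ 2) ℤ.* w) ≡ 1# + φ (+ 2) * φ w
φ-odd w = trans (φ-+ (+ 1) ((+ 2) ℤ.* w)) (cong (λ k → 1# + k) (φ-* (+ 2) w))

-- q = num / (1 + 2 den) lies in the localisation of ℤ at 2.
record Int (q : ℚ) : Set where
  constructor fraction
  field
    num den : ℤ
    eq      : q * (1# + φ (+ 2) * φ den) ≡ φ num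

-- The quotient by 2 is stored, so that the laws of parity become polynomial identities in the
-- halves.
record Parity (b : Bool) (q : ℚ) : Set where
  constructor parity
  field
    half : ℚ
    int  : Int half
    eq   : q ≡ φ (if b then + 1 else + 0) + φ (+ 2) * half

Even Odd : ℚ → Set
Even = Parity false
Odd  = Parity true

Int-φ : ∀ z → Int (φ z)
Int-φ z = fraction z (+ 0) ((entail 1 λ z → ⊢ z :* (con (+ 1) :+ con (+ 2) :* con (+ 0)) ⊜ z) (φ z))

private
  -- 1 + 2(k + l + 2kl) = (1 + 2k)(1 + 2l)
  den-* : ℤ → ℤ → ℤ
  den-* k l = k ℤ.+ l ℤ.+ (+ 2) ℤ.* (k ℤ.* l)

  φ-den-* : ∀ k l → φ (den-* k l) ≡ φ k + φ l + φ (+ 2) * (φ k * φ l)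
  φ-den-* k l = trans (φ-+ (k ℤ.+ l) _)
    (cong₂ _+_ (φ-+ k l) (trans (φ-* (+ 2) (k ℤ.* l)) (cong (λ x → φ (+ 2) * x) (φ-* k l))))

Int-+ : ∀ {p q} → Int p → Int q → Int (p + q)
Int-+ {p} {q} (fraction m k eq) (fraction n l eq′) =
  fraction (m ℤ.* ((+ 1) ℤ.+ (+ 2) ℤ.* l) ℤ.+ n ℤ.* ((+ 1) ℤ.+ (+ 2) ℤ.* k)) (den-* k l)
    ((entail 8 λ p q k l m n kl mn →
      kl ⊜ k :+ l :+ con (+ 2) :* (k :* l) by con (+ 2) :* (p :+ q) ⇒
      mn ⊜ m :* (con (+ 1) :+ con (+ 2) :* l) :+ n :* (con (+ 1) :+ con (+ 2) :* k) by con -[1+ 0 ] ⇒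
      p :* (con (+ 1) :+ con (+ 2) :* k) ⊜ m by con (+ 1) :+ con (+ 2) :* l ⇒
      q :* (con (+ 1) :+ con (+ 2) :* l) ⊜ n by con (+ 1) :+ con (+ 2) :* k ⇒
      ⊢ (p :+ q) :* (con (+ 1) :+ con (+ 2) :* kl) ⊜ mn)
      p q (φ k) (φ l) (φ m) (φ n) _ _ (φ-den-* k l)
      (trans (φ-+ (m ℤ.* ((+ 1) ℤ.+ (+ 2) ℤ.* l)) _)
        (cong₂ _+_ (trans (φ-* m _) (cong (λ x → φ m * x) (φ-odd l)))
                   (trans (φ-* n _) (cong (λ x → φ n * x) (φ-odd k)))))
      eq eq′)

Int-* : ∀ {p q} → Int p → Int q → Int (p * q)
Int-* {p} {q} (fraction m k eq) (fraction n l eq′) = fraction (m ℤ.* n) (den-* k l)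
    ((entail 8 λ p q k l m n kl mn →
      kl ⊜ k :+ l :+ con (+ 2) :* (k :* l) by con (+ 2) :* (p :* q) ⇒
      mn ⊜ m :* n by con -[1+ 0 ] ⇒
      p :* (con (+ 1) :+ con (+ 2) :* k) ⊜ m by q :* (con (+ 1) :+ con (+ 2) :* l) ⇒
      q :* (con (+ 1) :+ con (+ 2) :* l) ⊜ n by m ⇒
      ⊢ (p :* q) :* (con (+ 1) :+ con (+ 2) :* kl) ⊜ mn)
      p q (φ k) (φ l) (φ m) (φ n) _ _ (φ-den-* k l) (φ-* m n) eq eq′)

Int-neg : ∀ {q} → Int q → Int (- q)
Int-neg {q} i = subst Int ((entail 1 λ q → ⊢ con -[1+ 0 ] :* q ⊜ :- q) q) (Int-* (Int-φ -[1+ 0 ]) i)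

Int-- : ∀ {p q} → Int p → Int q → Int (p - q)
Int-- i j = Int-+ i (Int-neg j)

2≢0 : φ (+ 2) ≢ 0#
2≢0 ()

halve : ∀ {x y} → φ (+ 2) * x ≡ φ (+ 2) * y → x ≡ y
halve {x} {y} eq = x-y≡0⇒x≡y (0≢⇒cancel 2≢0
  ((entail 2 λ x y → con (+ 2) :* x ⊜ con (+ 2) :* y by con (+ 1) ⇒
    ⊢ con (+ 2) :* (x :- y) ⊜ con (+ 0)) x y eq))

Int⇒Parity : ∀ {q} → Int q → ∃ λ b → Parity b q
Int⇒Parity {q} (fraction m k eq) with halves m
... | w , inj₁ refl = false , parity (q * ½) (fraction w k (halve
    ((entail 5 λ q h k w m → con (+ 2) :* h ⊜ con (+ 1) by q :* (con (+ 1) :+ con (+ 2) :* k) ⇒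
      q :* (con (+ 1) :+ con (+ 2) :* k) ⊜ m by con (+ 1) ⇒
      m ⊜ con (+ 2) :* w by con (+ 1) ⇒
      ⊢ con (+ 2) :* (q :* h :* (con (+ 1) :+ con (+ 2) :* k)) ⊜ con (+ 2) :* w)
      q ½ (φ k) (φ w) _ refl eq (φ-* (+ 2) w))))
    ((entail 2 λ q h → con (+ 2) :* h ⊜ con (+ 1) by :- q ⇒ ⊢ q ⊜ con (+ 0) :+ con (+ 2) :* (q :* h))
      q ½ refl)
  where ½ = inv (φ (+ 2))
... | w , inj₂ refl = true , parity ((q - 1#) * ½) (fraction (w ℤ.+ ℤ.- k) k (halve
    ((entail 7 λ q h k w m -k w-k → con (+ 2) :* h ⊜ con (+ 1) by (q :- con (+ 1)) :* (con (+ 1) :+ con (+ 2) :* k) ⇒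
      q :* (con (+ 1) :+ con (+ 2) :* k) ⊜ m by con (+ 1) ⇒
      m ⊜ con (+ 1) :+ con (+ 2) :* w by con (+ 1) ⇒
      -k ⊜ con -[1+ 0 ] :* k by con -[1+ 1 ] ⇒
      w-k ⊜ w :+ -k by con -[1+ 1 ] ⇒
      ⊢ con (+ 2) :* ((q :- con (+ 1)) :* h :* (con (+ 1) :+ con (+ 2) :* k)) ⊜ con (+ 2) :* w-k)
      q ½ (φ k) (φ w) _ (φ (ℤ.- k)) _ refl eq (φ-odd w)
      (trans (cong φ (sym (ℤₚ.-1*i≡-i k))) (φ-* -[1+ 0 ] k)) (φ-+ w (ℤ.- k)))))
    ((entail 2 λ q h → con (+ 2) :* h ⊜ con (+ 1) by con (+ 1) :- q ⇒
      ⊢ q ⊜ con (+ 1) :+ con (+ 2) :* ((q :- con (+ 1)) :* h)) q ½ refl)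
  where ½ = inv (φ (+ 2))

Parity⇒Int : ∀ {b q} → Parity b q → Int q
Parity⇒Int {b} (parity r i refl) = Int-+ (Int-φ (if b then + 1 else + 0)) (Int-* (Int-φ (+ 2)) i)

private
  bit : Bool → ℚ
  bit b = φ (if b then + 1 else + 0)

-- For r = m/(1 + 2k), clearing the denominator gives 1 + 2(k - m) = 0 among integers.
1≢2Int : ∀ {r} → Int r → 1# ≢ φ (+ 2) * r
1≢2Int {r} (fraction m k eq) 1≡2r = odd≢0 (k ℤ.+ ℤ.- m) (φ-injective
  (trans (φ-odd (k ℤ.+ ℤ.- m)) ((entail 5 λ r k m -m k-m →
      con (+ 1) ⊜ con (+ 2) :* r by con (+ 1) :+ con (+ 2) :* k ⇒
      r :* (con (+ 1) :+ con (+ 2) :* k) ⊜ m by con (+ 2) ⇒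
      -m ⊜ con -[1+ 0 ] :* m by con (+ 2) ⇒
      k-m ⊜ k :+ -m by con (+ 2) ⇒
      ⊢ con (+ 1) :+ con (+ 2) :* k-m ⊜ con (+ 0)) r (φ k) (φ m) (φ (ℤ.- m)) _ 1≡2r eq
      (trans (cong φ (sym (ℤₚ.-1*i≡-i m))) (φ-* -[1+ 0 ] m)) (φ-+ k (ℤ.- m)))))

Even⇒¬Odd : ∀ {q} → Even q → ¬ Odd q
Even⇒¬Odd {q} (parity r i eq) (parity s j eq′) = 1≢2Int (Int-- i j)
  ((entail 3 λ q r s → q ⊜ con (+ 0) :+ con (+ 2) :* r by con (+ 1) ⇒
    q ⊜ con (+ 1) :+ con (+ 2) :* s by con -[1+ 0 ] ⇒
    ⊢ con (+ 1) ⊜ con (+ 2) :* (r :- s)) q r s eq eq′)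

Parity-+ : ∀ {a b p q} → Parity a p → Parity b q → Parity (a xor b) (p + q)
Parity-+ {false} {b} {p} {q} (parity r i eq) (parity s j eq′) = parity (r + s) (Int-+ i j)
  ((entail 5 λ b p q r s → p ⊜ con (+ 0) :+ con (+ 2) :* r by con (+ 1) ⇒
    q ⊜ b :+ con (+ 2) :* s by con (+ 1) ⇒ ⊢ p :+ q ⊜ b :+ con (+ 2) :* (r :+ s)) (bit b) p q r s eq eq′)
Parity-+ {true} {false} {p} {q} (parity r i eq) (parity s j eq′) = parity (r + s) (Int-+ i j)
  ((entail 4 λ p q r s → p ⊜ con (+ 1) :+ con (+ 2) :* r by con (+ 1) ⇒
    q ⊜ con (+ 0) :+ con (+ 2) :* s by con (+ 1) ⇒ ⊢ p :+ q ⊜ con (+ 1) :+ con (+ 2) :* (r :+ s)) p q r s eq eq′)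
Parity-+ {true} {true} {p} {q} (parity r i eq) (parity s j eq′) = parity (1# + r + s) (Int-+ (Int-+ (Int-φ (+ 1)) i) j)
  ((entail 4 λ p q r s → p ⊜ con (+ 1) :+ con (+ 2) :* r by con (+ 1) ⇒
    q ⊜ con (+ 1) :+ con (+ 2) :* s by con (+ 1) ⇒
    ⊢ p :+ q ⊜ con (+ 0) :+ con (+ 2) :* (con (+ 1) :+ r :+ s)) p q r s eq eq′)

Parity-* : ∀ {a b p q} → Parity a p → Parity b q → Parity (a ∧ b) (p * q)
Parity-* {false} {b} {p} {q} (parity r i eq) pq = parity (r * q) (Int-* i (Parity⇒Int pq))
  ((entail 3 λ p q r → p ⊜ con (+ 0) :+ con (+ 2) :* r by q ⇒
    ⊢ p :* q ⊜ con (+ 0) :+ con (+ 2) :* (r :* q)) p q r eq)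
Parity-* {true} {b} {p} {q} (parity r i eq) pq@(parity s j eq′) = parity (r * q + s) (Int-+ (Int-* i (Parity⇒Int pq)) j)
  ((entail 5 λ b p q r s → p ⊜ con (+ 1) :+ con (+ 2) :* r by q ⇒
    q ⊜ b :+ con (+ 2) :* s by con (+ 1) ⇒
    ⊢ p :* q ⊜ b :+ con (+ 2) :* (r :* q :+ s)) (bit b) p q r s eq eq′)

Parity-neg : ∀ {b q} → Parity b q → Parity b (- q)
Parity-neg {q = q} pq = subst (Parity _) ((entail 1 λ q → ⊢ con -[1+ 0 ] :* q ⊜ :- q) q)
  (Parity-* (parity -1ℚ (Int-φ -[1+ 0 ]) refl) pq)
  where -1ℚ = φ -[1+ 0 ]

Parity-- : ∀ {a b p q} → Parity a p → Parity b q → Parity (a xor b) (p - q)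
Parity-- i j = Parity-+ i (Parity-neg j)

Odd⇒≢0 : ∀ {q} → Odd q → q ≢ 0#
Odd⇒≢0 o refl = Even⇒¬Odd (parity 0# (Int-φ (+ 0)) refl) o

-- For q = 1 + 2r and r = m/(1 + 2k), the inverse is (1 + 2k)/(1 + 2(k + m)), hence integral, and it
-- equals 1 + 2(-r/q).
Odd-inverse : ∀ {q} → Odd q → Odd (inv q)
Odd-inverse {q} o@(parity r i@(fraction m k eq) eq′) = parity (- r * inv q) (Int-* (Int-neg i) int)
  ((entail 3 λ q r q⁻¹ → q :* q⁻¹ ⊜ con (+ 1) by con (+ 1) ⇒
    q ⊜ con (+ 1) :+ con (+ 2) :* r by :- q⁻¹ ⇒
    ⊢ q⁻¹ ⊜ con (+ 1) :+ con (+ 2) :* ((:- r) :* q⁻¹)) q r (inv q) (inv-inverseʳ (Odd⇒≢0 o)) eq′)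
  where
  int : Int (inv q)
  int = fraction ((+ 1) ℤ.+ (+ 2) ℤ.* k) (k ℤ.+ m)
    ((entail 7 λ q q⁻¹ r k m k+m d → q :* q⁻¹ ⊜ con (+ 1) by con (+ 1) :+ con (+ 2) :* k ⇒
      q ⊜ con (+ 1) :+ con (+ 2) :* r by :- (con (+ 1) :+ con (+ 2) :* k) :* q⁻¹ ⇒
      r :* (con (+ 1) :+ con (+ 2) :* k) ⊜ m by con -[1+ 1 ] :* q⁻¹ ⇒
      k+m ⊜ k :+ m by con (+ 2) :* q⁻¹ ⇒
      d ⊜ con (+ 1) :+ con (+ 2) :* k by con -[1+ 0 ] ⇒
      ⊢ q⁻¹ :* (con (+ 1) :+ con (+ 2) :* k+m) ⊜ d)
      q (inv q) r (φ k) (φ m) _ _ (inv-inverseʳ (Odd⇒≢0 o)) eq′ eq (φ-+ k m) (φ-odd k))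

φ-Odd : ∀ z → ¬ 2 ℕD.∣ ∣ z ∣ → Odd (φ z)
φ-Odd z 2∤z = let w , eq = ∤2⇒odd z 2∤z in parity (φ w) (Int-φ w) (trans (cong φ eq) (φ-odd w))

φ-Even : ∀ z → 2 ℕD.∣ ∣ z ∣ → Even (φ z)
φ-Even z 2∣z = let w , eq = 2∣⇒double z 2∣z in
  parity (φ w) (Int-φ w) (trans (cong φ eq) (trans (φ-* (+ 2) w) (sym (+-identityˡ (φ (+ 2) * φ w)))))

odd-denominator : ∀ q → ¬ 2 ℕD.∣ ℚ.↧ₙ q → Int q
odd-denominator q 2∤den = subst Int
  ((entail 4 λ q n d d⁻¹ → q :* d ⊜ n by :- d⁻¹ ⇒ d :* d⁻¹ ⊜ con (+ 1) by q ⇒ ⊢ n :* d⁻¹ ⊜ q)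
    q (φ (ℚ.↥ q)) (φ (ℚ.↧ q)) (inv (φ (ℚ.↧ q))) (*-denominator q) (inv-inverseʳ (Odd⇒≢0 odd-den)))
  (Int-* (Int-φ (ℚ.↥ q)) (Parity⇒Int (Odd-inverse odd-den)))
  where
  odd-den : Odd (φ (ℚ.↧ q))
  odd-den = φ-Odd (ℚ.↧ q) 2∤den

odd-numerator : ∀ q → ¬ 2 ℕD.∣ ℚ.↧ₙ q → ¬ 2 ℕD.∣ ∣ ℚ.↥ q ∣ → Odd q
odd-numerator q 2∤den 2∤num = decide (Int⇒Parity (odd-denominator q 2∤den))
  where
  decide : (∃ λ b → Parity b q) → Odd q
  decide (true  , o) = o
  decide (false , e) = ⊥-elim (Even⇒¬Odd
    (subst Even (*-denominator q) (Parity-* e (proj₂ (Int⇒Parity (Int-φ (ℚ.↧ q))))))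
    (φ-Odd (ℚ.↥ q) 2∤num))

Int-or-inverse : ∀ q → Int q ⊎ (q ≢ 0# × Even (inv q))
Int-or-inverse q with 2 ℕD.∣? ℚ.↧ₙ q
... | no  2∤den = inj₁ (odd-denominator q 2∤den)
... | yes 2∣den = inj₂ (q≢0 , subst Even eq (Parity-* (φ-Even (ℚ.↧ q) 2∣den) (Odd-inverse odd-num)))
  where
  2∤num : ∀ q → 2 ℕD.∣ ℚ.↧ₙ q → ¬ 2 ℕD.∣ ∣ ℚ.↥ q ∣
  2∤num (mkℚ n d-1 coprime) 2∣den 2∣num = Irrelevant.⊥-elim (2≢1 (coprime (2∣num , 2∣den)))
    where
    2≢1 : 2 ≢ 1
    2≢1 ()
  odd-num : Odd (φ (ℚ.↥ q))
  odd-num = φ-Odd (ℚ.↥ q) (2∤num q 2∣den)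
  q≢0 : q ≢ 0#
  q≢0 q≡0 = Odd⇒≢0 odd-num
    (trans (sym (*-denominator q)) (trans (cong (λ x → x * φ (ℚ.↧ q)) q≡0) (zeroˡ (φ (ℚ.↧ q)))))
  eq : φ (ℚ.↧ q) * inv (φ (ℚ.↥ q)) ≡ inv q
  eq = (entail 5 λ q q⁻¹ n n⁻¹ d → q :* q⁻¹ ⊜ con (+ 1) by :- d :* n⁻¹ ⇒
      n :* n⁻¹ ⊜ con (+ 1) by q⁻¹ ⇒ q :* d ⊜ n by q⁻¹ :* n⁻¹ ⇒ ⊢ d :* n⁻¹ ⊜ q⁻¹)
    q (inv q) (φ (ℚ.↥ q)) (inv (φ (ℚ.↥ q))) (φ (ℚ.↧ q))
    (inv-inverseʳ q≢0) (inv-inverseʳ (Odd⇒≢0 odd-num)) (*-denominator q)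

-- The quadratic field

module Ramified (d : ℤ) (e : ℚ) (odd-e : Odd e) (d≡2e : ℤ→ℚ d ≡ φ (+ 2) * e) where

  open QuadField d
  open K

  D : ℚ
  D = ℤ→ℚ d

  even-D : Even D
  even-D = parity e (Parity⇒Int odd-e) (trans d≡2e (sym (+-identityˡ _)))

  even-2 : Even (φ (+ 2))
  even-2 = parity 1ℚ (Int-φ (+ 1)) refl

  private
    Int-nonsquare : ∀ {r} → Int r → r * r ≢ D
    Int-nonsquare {r} i r²≡D with Int⇒Parity i
    ... | true  , o = Even⇒¬Odd (subst Even (sym r²≡D) even-D) (Parity-* o o)
    ... | false , parity s j r≡2s = Even⇒¬Odd
      (parity (s * s) (Int-* j j) (halve
        ((entail 4 λ r s e D → r :* r ⊜ D by con -[1+ 0 ] ⇒ D ⊜ con (+ 2) :* e by con -[1+ 0 ] ⇒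
          r ⊜ con (+ 0) :+ con (+ 2) :* s by r :+ con (+ 2) :* s ⇒
          ⊢ con (+ 2) :* e ⊜ con (+ 2) :* (con (+ 0) :+ con (+ 2) :* (s :* s))) r s e D r²≡D d≡2e r≡2s)))
      odd-e

    -- D has 2-adic valuation 1. An integral r would be even, and 4s² = 2e contradicts that e is
    -- odd; otherwise 1/r is even, and so would be r⁻² D = 1.
    D-nonsquare : ∀ r → r * r ≢ D
    D-nonsquare r r²≡D with Int-or-inverse r
    ... | inj₁ i = Int-nonsquare i r²≡D
    ... | inj₂ (r≢0 , even) = Even⇒¬Odd
      (subst Even
        ((entail 3 λ r r⁻¹ D → r :* r⁻¹ ⊜ con (+ 1) by con (+ 1) :+ r :* r⁻¹ ⇒
          r :* r ⊜ D by :- r⁻¹ :* r⁻¹ ⇒ ⊢ r⁻¹ :* r⁻¹ :* D ⊜ con (+ 1)) r (inv r) D (inverseʳ r≢0) r²≡D)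
        (Parity-* (Parity-* even even) even-D))
      (parity 0ℚ (Int-φ (+ 0)) refl)
      where open Field ℚ-field using (inverseʳ)

  norm : K d → ℚ
  norm (a +√ b) = a * a - D * b * b

  norm≡0⇒≡0 : ∀ x → norm x ≡ 0ℚ → x ≡ ι 0ℚ
  norm≡0⇒≡0 (a +√ b) n≡0 with b ℚ≟ 0ℚ
    where open Field ℚ-field using () renaming (_≟_ to _ℚ≟_)
  ... | no b≢0 = ⊥-elim (D-nonsquare (a * inv b)
    ((entail 4 λ a b b⁻¹ D → b :* b⁻¹ ⊜ con (+ 1) by D :* (b :* b⁻¹ :+ con (+ 1)) ⇒
      a :* a :- D :* b :* b ⊜ con (+ 0) by b⁻¹ :* b⁻¹ ⇒
      ⊢ (a :* b⁻¹) :* (a :* b⁻¹) ⊜ D) a b (inv b) D (inverseʳ b≢0) n≡0))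
    where open Field ℚ-field using (inverseʳ)
  ... | yes refl with a ℚ≟ 0ℚ
    where open Field ℚ-field using () renaming (_≟_ to _ℚ≟_)
  ...   | yes refl = refl
  ...   | no a≢0   = ⊥-elim (a≢0 (0≢⇒cancel a≢0
    (trans ((entail 2 λ a D → ⊢ a :* a ⊜ a :* a :- D :* con (+ 0) :* con (+ 0)) a D) n≡0)))

  neg : K d → K d
  neg (a +√ b) = (- a) +√ (- b)

  private
    K-+-assoc : ∀ x y z → (x ⊕ y) ⊕ z ≡ x ⊕ (y ⊕ z)
    K-+-assoc (a +√ b) (a′ +√ b′) (a″ +√ b″) = cong₂ _+√_ (+-assoc a a′ a″) (+-assoc b b′ b″)

    K-+-comm : ∀ x y → x ⊕ y ≡ y ⊕ x
    K-+-comm (a +√ b) (a′ +√ b′) = cong₂ _+√_ (+-comm a a′) (+-comm b b′)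

    K-+-identityˡ : ∀ x → ι 0ℚ ⊕ x ≡ x
    K-+-identityˡ (a +√ b) = cong₂ _+√_ (+-identityˡ a) (+-identityˡ b)

    K-+-inverseˡ : ∀ x → neg x ⊕ x ≡ ι 0ℚ
    K-+-inverseˡ (a +√ b) = cong₂ _+√_ (-‿inverseˡ a) (-‿inverseˡ b)

    K-*-assoc : ∀ x y z → (x ⊗ y) ⊗ z ≡ x ⊗ (y ⊗ z)
    K-*-assoc (a +√ b) (a′ +√ b′) (a″ +√ b″) = cong₂ _+√_
      ((entail 7 λ D a b a′ b′ a″ b″ →
        ⊢ (a :* a′ :+ D :* b :* b′) :* a″ :+ D :* (a :* b′ :+ b :* a′) :* b″
          ⊜ a :* (a′ :* a″ :+ D :* b′ :* b″) :+ D :* b :* (a′ :* b″ :+ b′ :* a″)) D a b a′ b′ a″ b″)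
      ((entail 7 λ D a b a′ b′ a″ b″ →
        ⊢ (a :* a′ :+ D :* b :* b′) :* b″ :+ (a :* b′ :+ b :* a′) :* a″
          ⊜ a :* (a′ :* b″ :+ b′ :* a″) :+ b :* (a′ :* a″ :+ D :* b′ :* b″)) D a b a′ b′ a″ b″)

    K-*-comm : ∀ x y → x ⊗ y ≡ y ⊗ x
    K-*-comm (a +√ b) (a′ +√ b′) = cong₂ _+√_
      ((entail 5 λ D a b a′ b′ → ⊢ a :* a′ :+ D :* b :* b′ ⊜ a′ :* a :+ D :* b′ :* b) D a b a′ b′)
      ((entail 4 λ a b a′ b′ → ⊢ a :* b′ :+ b :* a′ ⊜ a′ :* b :+ b′ :* a) a b a′ b′)

    K-*-identityˡ : ∀ x → ι 1ℚ ⊗ x ≡ x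
    K-*-identityˡ (a +√ b) = cong₂ _+√_
      ((entail 3 λ D a b → ⊢ con (+ 1) :* a :+ D :* con (+ 0) :* b ⊜ a) D a b)
      ((entail 2 λ a b → ⊢ con (+ 1) :* b :+ con (+ 0) :* a ⊜ b) a b)

    K-distribˡ : ∀ x y z → x ⊗ (y ⊕ z) ≡ x ⊗ y ⊕ x ⊗ z
    K-distribˡ (a +√ b) (a′ +√ b′) (a″ +√ b″) = cong₂ _+√_
      ((entail 7 λ D a b a′ b′ a″ b″ →
        ⊢ a :* (a′ :+ a″) :+ D :* b :* (b′ :+ b″)
          ⊜ (a :* a′ :+ D :* b :* b′) :+ (a :* a″ :+ D :* b :* b″)) D a b a′ b′ a″ b″)
      ((entail 6 λ a b a′ b′ a″ b″ →
        ⊢ a :* (b′ :+ b″) :+ b :* (a′ :+ a″) ⊜ (a :* b′ :+ b :* a′) :+ (a :* b″ :+ b :* a″)) a b a′ b′ a″ b″)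

    ι-+ : ∀ p q → ι (p + q) ≡ ι p ⊕ ι q
    ι-+ p q = cong₂ _+√_ refl (sym (+-identityˡ 0ℚ))

    ι-* : ∀ p q → ι (p * q) ≡ ι p ⊗ ι q
    ι-* p q = cong₂ _+√_
      ((entail 3 λ D p q → ⊢ p :* q ⊜ p :* q :+ D :* con (+ 0) :* con (+ 0)) D p q)
      ((entail 2 λ p q → ⊢ con (+ 0) ⊜ p :* con (+ 0) :+ con (+ 0) :* q) p q)

    kinv-inverseʳ : ∀ {x} → x ≢ ι 0ℚ → x ⊗ kinv x ≡ ι 1ℚ
    kinv-inverseʳ {x@(a +√ b)} x≢0 = cong₂ _+√_
      (trans ((entail 4 λ a b n D → ⊢ a :* (a :* n) :+ D :* b :* (:- (b :* n)) ⊜ (a :* a :- D :* b :* b) :* n)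
         a b (inv (norm x)) D)
        (Field.inverseʳ ℚ-field (λ n≡0 → x≢0 (norm≡0⇒≡0 x n≡0))))
      ((entail 3 λ a b n → ⊢ a :* (:- (b :* n)) :+ b :* (a :* n) ⊜ con (+ 0)) a b (inv (norm x)))

  K-field : Field
  K-field = record
    { Carrier = K d ; _+_ = _⊕_ ; _*_ = _⊗_ ; _-_ = _⊖_ ; -_ = neg ; inv = kinv ; φ = λ z → ι (φ z)
    ; isCommutativeRing = record
      { isRing = record
        { +-isAbelianGroup = record
          { isGroup = record
            { isMonoid = record
              { isSemigroup = record
                { isMagma = record { isEquivalence = isEquivalence ; ∙-cong = cong₂ _⊕_ }
                ; assoc = K-+-assoc }
              ; identity = comm∧idˡ⇒id K-+-comm K-+-identityˡ }
            ; inverse = comm∧invˡ⇒inv K-+-comm K-+-inverseˡ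
            ; ⁻¹-cong = cong neg }
          ; comm = K-+-comm }
        ; *-cong = cong₂ _⊗_
        ; *-assoc = K-*-assoc
        ; *-identity = comm∧idˡ⇒id K-*-comm K-*-identityˡ
        ; distrib = K-distribˡ , comm∧distrˡ⇒distrʳ K-*-comm K-distribˡ }
      ; *-comm = K-*-comm }
    ; x-y≡x+-y = λ _ _ → refl
    ; φ-+ = λ m n → trans (cong ι (φ-+ m n)) (ι-+ (φ m) (φ n))
    ; φ-* = λ m n → trans (cong ι (φ-* m n)) (ι-* (φ m) (φ n))
    ; _≟_ = _≟K_ ; inverseʳ = kinv-inverseʳ }

  module 𝕂 where
    open Identities K-field public

  conj : K d → K d
  conj (a +√ b) = a +√ (- b)

  conj-⊕ : ∀ x y → conj (x ⊕ y) ≡ conj x ⊕ conj y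
  conj-⊕ (a +√ b) (a′ +√ b′) = cong ((a + a′) +√_) ((entail 2 λ b b′ → ⊢ :- (b :+ b′) ⊜ :- b :+ :- b′) b b′)

  conj-neg : ∀ x → conj (neg x) ≡ neg (conj x)
  conj-neg (a +√ b) = refl

  conj-⊗ : ∀ x y → conj (x ⊗ y) ≡ conj x ⊗ conj y
  conj-⊗ (a +√ b) (a′ +√ b′) = cong₂ _+√_
    ((entail 5 λ D a b a′ b′ → ⊢ a :* a′ :+ D :* b :* b′ ⊜ a :* a′ :+ D :* (:- b) :* (:- b′)) D a b a′ b′)
    ((entail 4 λ a b a′ b′ → ⊢ :- (a :* b′ :+ b :* a′) ⊜ a :* (:- b′) :+ (:- b) :* a′) a b a′ b′)

  conj-involutive : ∀ x → conj (conj x) ≡ x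
  conj-involutive (a +√ b) = cong (a +√_) ((entail 1 λ b → ⊢ :- (:- b) ⊜ b) b)

  module ι-Hom = Homomorphism ℚ-field K-field ι ι-+ ι-* (λ _ → refl) (λ _ → refl)
  module conj-Hom = Homomorphism K-field K-field conj conj-⊕ conj-⊗ conj-neg (λ _ → refl)

  conj-fixed : ∀ x → conj x ≡ x → im x ≡ 0ℚ
  conj-fixed (a +√ b) eq = 0≢⇒cancel 2≢0
    ((entail 1 λ b → :- b ⊜ b by con -[1+ 0 ] ⇒ ⊢ con (+ 2) :* b ⊜ con (+ 0)) b (cong im eq))

  -- Reduction modulo the prime √d of ℤ₍₂₎[√d], whose residue field is 𝔽₂.
  record Residue (r : Bool) (x : K d) : Set where
    constructor reduces
    field
      re-parity : Parity r (re x)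
      im-int    : Int (im x)

  𝒪 𝔪 Unit : K d → Set
  𝒪 x  = ∃ λ r → Residue r x
  𝔪    = Residue false
  Unit = Residue true

  𝒪-intro : ∀ {x} → Int (re x) → Int (im x) → 𝒪 x
  𝒪-intro i j = let r , p = Int⇒Parity i in r , reduces p j

  Residue-ι : ∀ {r q} → Parity r q → Residue r (ι q)
  Residue-ι p = reduces p (Int-φ (+ 0))

  Residue-⊕ : ∀ {r s x y} → Residue r x → Residue s y → Residue (r xor s) (x ⊕ y)
  Residue-⊕ {x = _ +√ _} {_ +√ _} (reduces p i) (reduces q j) = reduces (Parity-+ p q) (Int-+ i j)

  Residue-⊖ : ∀ {r s x y} → Residue r x → Residue s y → Residue (r xor s) (x ⊖ y)
  Residue-⊖ {x = _ +√ _} {_ +√ _} (reduces p i) (reduces q j) = reduces (Parity-- p q) (Int-- i j)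

  Residue-⊗ : ∀ {r s x y} → Residue r x → Residue s y → Residue (r ∧ s) (x ⊗ y)
  Residue-⊗ {r} {s} {x = a +√ b} {a′ +√ b′} (reduces p i) (reduces q j) = reduces
    -- The product of the irrational parts enters with the even factor D and leaves the residue
    -- unchanged.
    (subst (λ t → Parity t (a * a′ + D * b * b′)) (xor-identityʳ (r ∧ s))
      (Parity-+ (Parity-* p q)
        (Parity-* (Parity-* even-D (proj₂ (Int⇒Parity i))) (proj₂ (Int⇒Parity j)))))
    (Int-+ (Int-* (Parity⇒Int p) j) (Int-* i (Parity⇒Int q)))

  Residue-conj : ∀ {r x} → Residue r x → Residue r (conj x)
  Residue-conj {x = _ +√ _} (reduces p i) = reduces p (Int-neg i)

  𝔪⇒¬Unit : ∀ {x} → 𝔪 x → ¬ Unit x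
  𝔪⇒¬Unit (reduces p _) (reduces q _) = Even⇒¬Odd p q

  Unit-inverse : ∀ {x} → Unit x → ∃ λ y → x ⊗ y ≡ ι 1ℚ × Unit y
  Unit-inverse {x@(a +√ b)} (reduces p i) =
    kinv x , 𝕂-inverse , reduces (Parity-* p odd-n⁻¹) (Int-neg (Int-* i (Parity⇒Int odd-n⁻¹)))
    where
    odd-n : Odd (norm x)
    odd-n = Parity-- (Parity-* p p) (Parity-* (Parity-* even-D (proj₂ (Int⇒Parity i))) (proj₂ (Int⇒Parity i)))
    odd-n⁻¹ : Odd (inv (norm x))
    odd-n⁻¹ = Odd-inverse odd-n
    𝕂-inverse : x ⊗ kinv x ≡ ι 1ℚ
    𝕂-inverse = kinv-inverseʳ λ x≡0 → Odd⇒≢0 p (cong re x≡0)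

  private
    -- The rational part dominates: for τ = β/α the inverse is A(1 - τ√d)/(1 - dτ²), and this
    -- denominator is odd.
    inverse-via-re : ∀ α β A → α * A ≡ 1ℚ → Even A → Int (β * A) →
                     ∃ λ y → (α +√ β) ⊗ y ≡ ι 1ℚ × 𝔪 y
    inverse-via-re α β A αA≡1 even-A int-τ =
      (A * w) +√ (- (τ * A * w)) ,
      cong₂ _+√_
        ((entail 5 λ D α β A w → α :* A ⊜ con (+ 1) by w ⇒
          (con (+ 1) :- D :* (β :* A) :* (β :* A)) :* w ⊜ con (+ 1) by con (+ 1) ⇒
          ⊢ α :* (A :* w) :+ D :* β :* (:- ((β :* A) :* A :* w)) ⊜ con (+ 1))
          D α β A w αA≡1 n*w≡1)
        ((entail 4 λ α β A w → α :* A ⊜ con (+ 1) by :- β :* A :* w ⇒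
          ⊢ α :* (:- ((β :* A) :* A :* w)) :+ β :* (A :* w) ⊜ con (+ 0)) α β A w αA≡1) ,
      reduces (Parity-* even-A odd-w)
        (Int-neg (Int-* (Int-* int-τ (Parity⇒Int even-A)) (Parity⇒Int odd-w)))
      where
      τ = β * A
      n = 1ℚ - D * τ * τ
      odd-n : Odd n
      odd-n = Parity-- (parity 0ℚ (Int-φ (+ 0)) refl)
        (Parity-* (Parity-* even-D (proj₂ (Int⇒Parity int-τ))) (proj₂ (Int⇒Parity int-τ)))
      w = inv n
      odd-w = Odd-inverse odd-n
      n*w≡1 : n * w ≡ 1ℚ
      n*w≡1 = Field.inverseʳ ℚ-field (Odd⇒≢0 odd-n)

    -- The irrational part dominates: for κ = α/β = 2s the inverse is B(κ - √d)/(κ² - d). The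
    -- denominator is 2(2s² - e), whose 2 cancels against B = 2t and leaves an odd number.
    inverse-via-im : ∀ α β B → β * B ≡ 1ℚ → Even B → Even (α * B) →
                     ∃ λ y → (α +√ β) ⊗ y ≡ ι 1ℚ × 𝔪 y
    inverse-via-im α β B βB≡1 (parity t int-t B≡2t) even-κ@(parity s int-s κ≡2s) =
      (κ * t * w) +√ (- (t * w)) ,
      cong₂ _+√_
        ((entail 8 λ D e α β B t s w →
          β :* B ⊜ con (+ 1) by con (+ 1) :- con (+ 2) :* s :* t :* w :* α ⇒
          D ⊜ con (+ 2) :* e by :- (β :* t :* w) ⇒
          B ⊜ con (+ 0) :+ con (+ 2) :* t by :- β ⇒
          α :* B ⊜ con (+ 0) :+ con (+ 2) :* s by t :* w :* (α :+ con (+ 2) :* s :* β) ⇒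
          (con (+ 2) :* s :* s :- e) :* w ⊜ con (+ 1) by con (+ 2) :* β :* t ⇒
          ⊢ α :* ((α :* B) :* t :* w) :+ D :* β :* (:- (t :* w)) ⊜ con (+ 1))
          D e α β B t s w βB≡1 d≡2e B≡2t κ≡2s n*w≡1)
        ((entail 5 λ α β B t w → β :* B ⊜ con (+ 1) by t :* w :* α ⇒
          ⊢ α :* (:- (t :* w)) :+ β :* ((α :* B) :* t :* w) ⊜ con (+ 0)) α β B t w βB≡1) ,
      reduces (Parity-* (Parity-* even-κ (proj₂ (Int⇒Parity int-t))) odd-w)
        (Int-neg (Int-* int-t (Parity⇒Int odd-w)))
      where
      κ = α * B
      n = φ (+ 2) * s * s - e
      odd-n : Odd n
      odd-n = Parity-- (Parity-* (Parity-* even-2 (proj₂ (Int⇒Parity int-s)))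
                                 (proj₂ (Int⇒Parity int-s))) odd-e
      w = inv n
      odd-w = Odd-inverse odd-n
      n*w≡1 : n * w ≡ 1ℚ
      n*w≡1 = Field.inverseʳ ℚ-field (Odd⇒≢0 odd-n)

  -- ℤ₍₂₎[√d] is a valuation ring because d is twice a unit.
  𝒪-or-inverse : ∀ x → 𝒪 x ⊎ ∃ λ y → x ⊗ y ≡ ι 1ℚ × 𝔪 y
  𝒪-or-inverse (α +√ β) = on-im (Int-or-inverse β) (Int-or-inverse α)
    where
    open Field ℚ-field using (inverseʳ)

    -- The valuations of α and β√d have different parity, so one term dominates: β√d exactly when
    -- α/β is even.
    big-β : β ≢ 0ℚ → Even (inv β) → Int (α * inv β) ⊎ (α * inv β ≢ 0ℚ × Even (inv (α * inv β))) →
            ∃ λ y → (α +√ β) ⊗ y ≡ ι 1ℚ × 𝔪 y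
    big-β-odd : β ≢ 0ℚ → Even (inv β) → α * inv β ≢ 0ℚ → Int (inv (α * inv β)) →
                ∃ λ y → (α +√ β) ⊗ y ≡ ι 1ℚ × 𝔪 y
    big-β β≢0 even-B (inj₁ int) with Int⇒Parity int
    ... | false , even = inverse-via-im α β (inv β) (inverseʳ β≢0) even-B even
    ... | true  , odd  = big-β-odd β≢0 even-B (Odd⇒≢0 odd) (Parity⇒Int (Odd-inverse odd))
    big-β β≢0 even-B (inj₂ (κ≢0 , even)) = big-β-odd β≢0 even-B κ≢0 (Parity⇒Int even)
    big-β-odd β≢0 even-B κ≢0 int = inverse-via-re α β (inv κ * inv β)
      ((entail 3 λ α B k → (α :* B) :* k ⊜ con (+ 1) by con (+ 1) ⇒ ⊢ α :* (k :* B) ⊜ con (+ 1))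
        α (inv β) (inv κ) (inverseʳ κ≢0))
      (subst Even (*-comm (inv β) (inv κ)) (Parity-* even-B (proj₂ (Int⇒Parity int))))
      (subst Int ((entail 3 λ β B k → β :* B ⊜ con (+ 1) by :- k ⇒ ⊢ k ⊜ β :* (k :* B))
        β (inv β) (inv κ) (inverseʳ β≢0)) int)
      where κ = α * inv β

    on-im : Int β ⊎ (β ≢ 0ℚ × Even (inv β)) → Int α ⊎ (α ≢ 0ℚ × Even (inv α)) →
            𝒪 (α +√ β) ⊎ ∃ λ y → (α +√ β) ⊗ y ≡ ι 1ℚ × 𝔪 y
    on-im (inj₁ int-β) (inj₁ int-α) = inj₁ (𝒪-intro int-α int-β)
    on-im (inj₁ int-β) (inj₂ (α≢0 , even)) =
      inj₂ (inverse-via-re α β (inv α) (inverseʳ α≢0) even (Int-* int-β (Parity⇒Int even)))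
    on-im (inj₂ (β≢0 , even)) _ = inj₂ (big-β β≢0 even (Int-or-inverse (α * inv β)))

  √d : K d
  √d = 0ℚ +√ 1ℚ

  x-conj : ∀ {x} → 𝒪 x → ∃ λ z → 𝒪 z × x ⊖ conj x ≡ ι (φ (+ 2)) ⊗ √d ⊗ z
  x-conj {a +√ b} (_ , reduces p i) = ι b , 𝒪-intro i (Int-φ (+ 0)) , cong₂ _+√_
    ((entail 3 λ a b D → ⊢ a :- a ⊜ (con (+ 2) :* con (+ 0) :+ D :* con (+ 0) :* con (+ 1)) :* b
      :+ D :* (con (+ 2) :* con (+ 1) :+ con (+ 0) :* con (+ 0)) :* con (+ 0)) a b D)
    ((entail 3 λ a b D → ⊢ b :- :- b ⊜ (con (+ 2) :* con (+ 0) :+ D :* con (+ 0) :* con (+ 1)) :* con (+ 0)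
      :+ (con (+ 2) :* con (+ 1) :+ con (+ 0) :* con (+ 0)) :* b) a b D)

  𝔪-uniformizer : ∀ {x} → 𝔪 x → ∃ λ z → 𝒪 z × x ≡ √d ⊗ z
  𝔪-uniformizer {a +√ b} (reduces (parity s int-s a≡2s) i) =
    -- Since d = 2e, the even part 2s is d · (s/e), from which one √d is taken out.
    b +√ (s * inv e) , 𝒪-intro i (Int-* int-s (Parity⇒Int (Odd-inverse odd-e))) , cong₂ _+√_
      ((entail 6 λ a b s e e⁻¹ D → a ⊜ con (+ 0) :+ con (+ 2) :* s by con (+ 1) ⇒
        D ⊜ con (+ 2) :* e by :- s :* e⁻¹ ⇒ e :* e⁻¹ ⊜ con (+ 1) by con -[1+ 1 ] :* s ⇒
        ⊢ a ⊜ con (+ 0) :* b :+ D :* con (+ 1) :* (s :* e⁻¹)) a b s e (inv e) D a≡2s d≡2e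
        (Field.inverseʳ ℚ-field (Odd⇒≢0 odd-e)))
      ((entail 2 λ b k → ⊢ b ⊜ con (+ 0) :* k :+ con (+ 1) :* b) b (s * inv e))

  private
    -- Here a is odd. Writing a = 1 + 2s in a² - d b² = 1 gives e b² = 2(s + s²), so b is even as
    -- well and the congruence holds modulo 2, not merely modulo √d.
    norm-one : ∀ {r} → 𝒪 r → r ⊗ conj r ≡ ι 1ℚ → ∃ λ z → 𝒪 z × ι 1ℚ ⊖ r ≡ ι (φ (+ 2)) ⊗ z
    norm-one {a +√ b} (false , reduces p i) eq = ⊥-elim (Even⇒¬Odd
      (subst Even (cong re eq) (Parity-+ (Parity-* p p)
        (Parity-* (Parity-* even-D (proj₂ (Int⇒Parity i))) (proj₂ (Int⇒Parity (Int-neg i))))))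
      (parity 0ℚ (Int-φ (+ 0)) refl))
    norm-one {a +√ b} (true , reduces (parity s int-s a≡1+2s) i) eq with Int⇒Parity i
    ... | true  , odd-b = ⊥-elim (Even⇒¬Odd
      (parity (s + s * s) (Int-+ int-s (Int-* int-s int-s)) (halve
        ((entail 5 λ a b s e D → a ⊜ con (+ 1) :+ con (+ 2) :* s by a :+ con (+ 1) :+ con (+ 2) :* s ⇒
          D ⊜ con (+ 2) :* e by :- b :* b ⇒
          a :* a :+ D :* b :* (:- b) ⊜ con (+ 1) by con -[1+ 0 ] ⇒
          ⊢ con (+ 2) :* (e :* b :* b) ⊜ con (+ 2) :* (con (+ 0) :+ con (+ 2) :* (s :+ s :* s)))
          a b s e D a≡1+2s d≡2e (cong re eq))))
      (Parity-* (Parity-* odd-e odd-b) odd-b))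
    ... | false , parity h int-h b≡2h = (- s) +√ (- h) , 𝒪-intro (Int-neg int-s) (Int-neg int-h) , cong₂ _+√_
      ((entail 4 λ a s h D → a ⊜ con (+ 1) :+ con (+ 2) :* s by con -[1+ 0 ] ⇒
        ⊢ con (+ 1) :- a ⊜ con (+ 2) :* (:- s) :+ D :* con (+ 0) :* (:- h)) a s h D a≡1+2s)
      ((entail 3 λ b s h → b ⊜ con (+ 0) :+ con (+ 2) :* h by con -[1+ 0 ] ⇒
        ⊢ con (+ 0) :- b ⊜ con (+ 2) :* (:- h) :+ con (+ 0) :* (:- s)) b s h b≡2h)

  -- The ratio of two conjugates is a unit of norm 1, hence 1 modulo 2.
  conj-ratio : ∀ {y} → y ≢ ι 0ℚ → ∃ λ z → 𝒪 z × conj y ≡ y ⊗ (ι 1ℚ ⊖ ι (φ (+ 2)) ⊗ z)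
  conj-ratio {y} y≢0 = z , 𝒪-z ,
    (𝕂.entail 5 λ y y⁻¹ ȳ z r → y :* y⁻¹ ⊜ con (+ 1) by :- ȳ ⇒ con (+ 1) :- ȳ :* y⁻¹ ⊜ con (+ 2) :* z by :- y ⇒
      ⊢ ȳ ⊜ y :* (con (+ 1) :- con (+ 2) :* z)) y (kinv y) (conj y) z r y*y⁻¹≡1 1-r≡2z
    where
    y*y⁻¹≡1 : y ⊗ kinv y ≡ ι 1ℚ
    y*y⁻¹≡1 = Field.inverseʳ K-field y≢0

    r = conj y ⊗ kinv y

    r*r̄≡1 : r ⊗ conj r ≡ ι 1ℚ
    r*r̄≡1 = begin
      r ⊗ conj r                                      ≡⟨ cong (r ⊗_) (conj-⊗ (conj y) (kinv y)) ⟩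
      r ⊗ (conj (conj y) ⊗ conj (kinv y))             ≡⟨ cong (λ u → r ⊗ (u ⊗ conj (kinv y))) (conj-involutive y) ⟩
      conj y ⊗ kinv y ⊗ (y ⊗ conj (kinv y))           ≡⟨ (𝕂.entail 4 λ y y⁻¹ ȳ ȳ⁻¹ →
                                                           ⊢ ȳ :* y⁻¹ :* (y :* ȳ⁻¹) ⊜ (y :* y⁻¹) :* (ȳ :* ȳ⁻¹))
                                                           y (kinv y) (conj y) (conj (kinv y)) ⟩
      (y ⊗ kinv y) ⊗ (conj y ⊗ conj (kinv y))         ≡⟨ cong ((y ⊗ kinv y) ⊗_) (sym (conj-⊗ y (kinv y))) ⟩
      (y ⊗ kinv y) ⊗ conj (y ⊗ kinv y)                ≡⟨ cong (λ u → u ⊗ conj u) y*y⁻¹≡1 ⟩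
      ι 1ℚ ⊗ conj (ι 1ℚ)                              ≡⟨ 𝕂.*-identityˡ (ι 1ℚ) ⟩
      ι 1ℚ                                            ∎
      where open ≡-Reasoning

    𝒪-r : 𝒪 r
    𝒪-r with 𝒪-or-inverse r
    ... | inj₁ o = o
    -- The inverse of r is r̄, and 𝔪 is stable under conjugation, so r is integral in this case too.
    ... | inj₂ (v , r*v≡1 , 𝔪-v) = false , subst 𝔪 (trans (cong conj v≡r̄) (conj-involutive r)) (Residue-conj 𝔪-v)
      where
      v≡r̄ : v ≡ conj r
      v≡r̄ = (𝕂.entail 3 λ r r̄ v → r :* v ⊜ con (+ 1) by r̄ ⇒ r :* r̄ ⊜ con (+ 1) by :- v ⇒ ⊢ v ⊜ r̄)
        r (conj r) v r*v≡1 r*r̄≡1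

    z,1-r≡2z = norm-one 𝒪-r r*r̄≡1
    z = proj₁ z,1-r≡2z
    𝒪-z = proj₁ (proj₂ z,1-r≡2z)
    1-r≡2z = proj₂ (proj₂ z,1-r≡2z)

-- Elliptic curves over the quadratic field

½ : ℚ
½ = inv (φ (+ 2))

-- Completing the square turns W into y² = x³ + A x² + B x + C.
module Coefficients (W : Weierstrass) where
  open Weierstrass W public

  A B C : ℚ
  A = a2 + ½ * ½ * a1 * a1
  B = a4 + ½ * a1 * a3
  C = a6 + ½ * ½ * a3 * a3

discriminant : ℚ → ℚ → ℚ → ℚ
discriminant A B C = φ (+ 16) * (A * A * B * B - φ (+ 4) * A * A * A * C - φ (+ 4) * B * B * B
                                 - φ (+ 27) * C * C + φ (+ 18) * A * B * C)

b2≡ : ∀ W → let open Coefficients W in b2 W ≡ φ (+ 4) * A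
b2≡ W = (entail 3 λ a1 a2 h → con (+ 2) :* h ⊜ con (+ 1) by :- (con (+ 1) :+ con (+ 2) :* h) :* a1 :* a1 ⇒
  ⊢ a1 :* a1 :+ con (+ 4) :* a2 ⊜ con (+ 4) :* (a2 :+ h :* h :* a1 :* a1)) a1 a2 ½ refl
  where open Coefficients W

b4≡ : ∀ W → let open Coefficients W in b4 W ≡ φ (+ 2) * B
b4≡ W = (entail 4 λ a1 a3 a4 h → con (+ 2) :* h ⊜ con (+ 1) by :- (a1 :* a3) ⇒
  ⊢ con (+ 2) :* a4 :+ a1 :* a3 ⊜ con (+ 2) :* (a4 :+ h :* a1 :* a3)) a1 a3 a4 ½ refl
  where open Coefficients W

b6≡ : ∀ W → let open Coefficients W in b6 W ≡ φ (+ 4) * C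
b6≡ W = (entail 3 λ a3 a6 h → con (+ 2) :* h ⊜ con (+ 1) by :- (con (+ 1) :+ con (+ 2) :* h) :* a3 :* a3 ⇒
  ⊢ a3 :* a3 :+ con (+ 4) :* a6 ⊜ con (+ 4) :* (a6 :+ h :* h :* a3 :* a3)) a3 a6 ½ refl
  where open Coefficients W

4b8≡b2b6-b4² : ∀ W → φ (+ 4) * b8 W ≡ b2 W * b6 W - b4 W * b4 W
4b8≡b2b6-b4² (mkW a1 a2 a3 a4 a6) = (entail 5 λ a1 a2 a3 a4 a6 →
  ⊢ con (+ 4) :* (a1 :* a1 :* a6 :+ con (+ 4) :* a2 :* a6 :- a1 :* a3 :* a4 :+ a2 :* a3 :* a3 :- a4 :* a4)
  ⊜ (a1 :* a1 :+ con (+ 4) :* a2) :* (a3 :* a3 :+ con (+ 4) :* a6)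
    :- (con (+ 2) :* a4 :+ a1 :* a3) :* (con (+ 2) :* a4 :+ a1 :* a3)) a1 a2 a3 a4 a6

b8≡ : ∀ W → let open Coefficients W in b8 W ≡ φ (+ 4) * A * C - B * B
b8≡ W = halve (halve (trans
  ((entail 1 λ x → ⊢ con (+ 2) :* (con (+ 2) :* x) ⊜ con (+ 4) :* x) (b8 W))
  (trans (4b8≡b2b6-b4² W) ((entail 6 λ A B C p q r →
    p ⊜ con (+ 4) :* A by q ⇒ q ⊜ con (+ 4) :* C by con (+ 4) :* A ⇒ r ⊜ con (+ 2) :* B by :- (r :+ con (+ 2) :* B) ⇒
    ⊢ p :* q :- r :* r ⊜ con (+ 2) :* (con (+ 2) :* (con (+ 4) :* A :* C :- B :* B)))
    A B C (b2 W) (b6 W) (b4 W) (b2≡ W) (b6≡ W) (b4≡ W)))))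
  where open Coefficients W

Δ≡discriminant : ∀ W → let open Coefficients W in Δ W ≡ discriminant A B C
Δ≡discriminant W = trans
  (expr-cong (b2≡ W) (b4≡ W) (b6≡ W) (b8≡ W))
    ((entail 3 λ A B C →
      ⊢ :- ((con (+ 4) :* A) :* (con (+ 4) :* A) :* (con (+ 4) :* A :* C :- B :* B))
        :- con (+ 8) :* (con (+ 2) :* B) :* (con (+ 2) :* B) :* (con (+ 2) :* B)
        :- con (+ 27) :* (con (+ 4) :* C) :* (con (+ 4) :* C)
        :+ con (+ 9) :* (con (+ 4) :* A) :* (con (+ 2) :* B) :* (con (+ 4) :* C)
      ⊜ con (+ 16) :* (A :* A :* B :* B :- con (+ 4) :* A :* A :* A :* C :- con (+ 4) :* B :* B :* B
                       :- con (+ 27) :* C :* C :+ con (+ 18) :* A :* B :* C)) A B C)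
  where
  open Coefficients W
  expr : ℚ → ℚ → ℚ → ℚ → ℚ
  expr b2 b4 b6 b8 = - (b2 * b2 * b8) - c 8 * b4 * b4 * b4 - c 27 * b6 * b6 + c 9 * b2 * b4 * b6
  expr-cong : ∀ {p q r s p′ q′ r′ s′} → p ≡ p′ → q ≡ q′ → r ≡ r′ → s ≡ s′ → expr p q r s ≡ expr p′ q′ r′ s′
  expr-cong refl refl refl refl = refl

-- The abelian group of points over K.

module MordellWeil (d : ℤ) (e : ℚ) (odd-e : Odd e) (d≡2e : ℤ→ℚ d ≡ φ (+ 2) * e)
                   (W : Weierstrass) (Δ≢0 : Δ W ≢ 0ℚ) where

  open Ramified d e odd-e d≡2e
  open QuadField d
  open Coefficients W

  private
    ι-discriminant : ι (discriminant A B C) ≡ _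
    ι-discriminant = ι-Hom.transport 3 (λ A B C →
      con (+ 16) :* (A :* A :* B :* B :- con (+ 4) :* A :* A :* A :* C :- con (+ 4) :* B :* B :* B
                     :- con (+ 27) :* C :* C :+ con (+ 18) :* A :* B :* C)) A B C

  smooth : ∀ x → x ⊗ x ⊗ x ⊕ ι A ⊗ x ⊗ x ⊕ ι B ⊗ x ⊕ ι C ≡ ι 0ℚ →
           ι (φ (+ 3)) ⊗ x ⊗ x ⊕ ι (φ (+ 2)) ⊗ ι A ⊗ x ⊕ ι B ≢ ι 0ℚ
  smooth x f≡0 f′≡0 = Δ≢0 (trans (Δ≡discriminant W) (cong K.re (trans ι-discriminant
    (Discriminant.double-root K-field {x} {ι A} {ι B} {ι C} f≡0 f′≡0))))

  open ChordTangent.Curve K-field (λ eq → 2≢0 (cong K.re eq)) (ι A) (ι B) (ι C) smooth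
    (ι ½) (ι a1) (ι a2) (ι a3) (ι a4) (ι a6)
    (sym (ι-Hom.transport 1 (λ h → con (+ 2) :* h) ½))
    (ι-Hom.transport 3 (λ a1 a2 h → a2 :+ h :* h :* a1 :* a1) a1 a2 ½)
    (ι-Hom.transport 4 (λ a1 a3 a4 h → a4 :+ h :* a1 :* a3) a1 a3 a4 ½)
    (ι-Hom.transport 3 (λ a3 a6 h → a6 :+ h :* h :* a3 :* a3) a3 a6 ½) public

  θ : Pt → Point
  θ O        = ∞
  θ (af x y) = aff (complete x y)

  θ-injective : ∀ P Q → θ P ≡ θ Q → P ≡ Q
  θ-injective O        O          eq = refl
  θ-injective (af x y) (af x′ y′) eq = cong₂ af (proj₁ equal) (proj₂ equal)
    where
    aff-injective : ∀ {P Q} → aff P ≡ aff Q → P ≡ Q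
    aff-injective refl = refl
    equal : x ≡ x′ × y ≡ y′
    equal = complete-injective {x} {y} {x′} {y′} (aff-injective eq)

  OnCurve⇒ : ∀ P → OnCurve W P → OnAffine (θ P)
  OnCurve⇒ O        _  = tt
  OnCurve⇒ (af x y) on = OnWeierstrass⇒OnCubic {x} {y} on

  OnCurve⇐ : ∀ P → OnAffine (θ P) → OnCurve W P
  OnCurve⇐ O        _  = tt
  OnCurve⇐ (af x y) on = OnCubic⇒OnWeierstrass {x} {y} on

  infixl 6 _+E_
  _+E_ : Pt → Pt → Pt
  _+E_ = _⊞_ W

  -E_ : Pt → Pt
  -E O      = O
  -E af x y = af x (ι 0ℚ ⊖ y ⊖ ι a1 ⊗ x ⊖ ι a3)

  θ-neg : ∀ P → θ (-E P) ≡ opp (θ P)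
  θ-neg O        = refl
  θ-neg (af x y) = cong aff (complete-opposite x y)

  private
    -- Conversion checking on K d unfolds to components, so the formulas of the group law are
    -- first recorded as equations between variables.
    data Sum (x₁ y₁ x₂ y₂ : K d) : Pt → Set where
      vertical-sum : x₁ ≡ x₂ → y₁ ⊕ y₂ ⊕ ι a1 ⊗ x₂ ⊕ ι a3 ≡ ι 0ℚ → Sum x₁ y₁ x₂ y₂ O
      chord-sum    : ∀ {x₃ y₃} μ ν → x₁ ≢ x₂ →
                     μ ≡ (y₂ ⊖ y₁) ⊗ kinv (x₂ ⊖ x₁) → ν ≡ (y₁ ⊗ x₂ ⊖ y₂ ⊗ x₁) ⊗ kinv (x₂ ⊖ x₁) →
                     x₃ ≡ μ ⊗ μ ⊕ ι a1 ⊗ μ ⊖ ι a2 ⊖ x₁ ⊖ x₂ → y₃ ≡ ι 0ℚ ⊖ (μ ⊕ ι a1) ⊗ x₃ ⊖ ν ⊖ ι a3 →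
                     Sum x₁ y₁ x₂ y₂ (af x₃ y₃)
      tangent-sum  : ∀ {x₃ y₃} μ ν → x₁ ≡ x₂ → y₁ ⊕ y₂ ⊕ ι a1 ⊗ x₂ ⊕ ι a3 ≢ ι 0ℚ →
                     let den = kinv (ι (c 2) ⊗ y₁ ⊕ ι a1 ⊗ x₁ ⊕ ι a3) in
                     μ ≡ (ι (c 3) ⊗ x₁ ⊗ x₁ ⊕ ι (c 2) ⊗ ι a2 ⊗ x₁ ⊕ ι a4 ⊖ ι a1 ⊗ y₁) ⊗ den →
                     ν ≡ (ι 0ℚ ⊖ x₁ ⊗ x₁ ⊗ x₁ ⊕ ι a4 ⊗ x₁ ⊕ ι (c 2) ⊗ ι a6 ⊖ ι a3 ⊗ y₁) ⊗ den →
                     x₃ ≡ μ ⊗ μ ⊕ ι a1 ⊗ μ ⊖ ι a2 ⊖ x₁ ⊖ x₂ → y₃ ≡ ι 0ℚ ⊖ (μ ⊕ ι a1) ⊗ x₃ ⊖ ν ⊖ ι a3 →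
                     Sum x₁ y₁ x₂ y₂ (af x₃ y₃)

    sum-view : ∀ x₁ y₁ x₂ y₂ → Sum x₁ y₁ x₂ y₂ (af x₁ y₁ +E af x₂ y₂)
    sum-view x₁ y₁ x₂ y₂ with x₁ ≟K x₂
    ... | no x₁≢x₂ = chord-sum _ _ x₁≢x₂ refl refl refl refl
    ... | yes x₁≡x₂ with (y₁ ⊕ y₂ ⊕ ι a1 ⊗ x₂ ⊕ ι a3) ≟K ι 0ℚ
    ...   | yes eq = vertical-sum x₁≡x₂ eq
    ...   | no  ≢0 = tangent-sum _ _ x₁≡x₂ ≢0 refl refl refl refl

    Sum⇒SumsToO : ∀ {x₁ y₁ x₂ y₂ R} → OnCurve W (af x₁ y₁) → OnCurve W (af x₂ y₂) → Sum x₁ y₁ x₂ y₂ R →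
                  SumsToO (θ (af x₁ y₁)) (θ (af x₂ y₂)) (opp (θ R))
    Sum⇒SumsToO {x₁} {y₁} {x₂} {y₂} p q (vertical-sum refl eq) = cong aff (vertical {x₁} {y₁} {y₂} eq)
    Sum⇒SumsToO {x₁} {y₁} {x₂} {y₂} p q (chord-sum {x₃} {y₃} μ ν x₁≢x₂ μ≡ ν≡ x₃≡ y₃≡) =
      chord {x₁} {y₁} {x₂} {y₂} μ ν x₃ y₃ p q x₁≢x₂
        (Field.inverseʳ K-field (λ eq → x₁≢x₂ (sym (𝕂.x-y≡0⇒x≡y eq)))) μ≡ ν≡ x₃≡ y₃≡
    Sum⇒SumsToO {x₁} {y₁} {x₂} {y₂} p q (tangent-sum {x₃} {y₃} μ ν refl ≢0 μ≡ ν≡ x₃≡ y₃≡) =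
      at-same-point (same-y {x₁} {y₁} {y₂} p q ≢0) ≢0
      where
      at-same-point : y₁ ≡ y₂ → y₁ ⊕ y₂ ⊕ ι a1 ⊗ x₁ ⊕ ι a3 ≢ ι 0ℚ →
                      complete x₁ y₁ ∼ complete x₁ y₂ ∼ opposite (complete x₃ y₃)
      at-same-point refl ≢0 = tangent {x₁} {y₁} μ ν x₃ y₃ p
        (Field.inverseʳ K-field (doubling-denominator {x₁} {y₁} ≢0)) μ≡ ν≡ x₃≡ y₃≡

  -- As the third point is unique, this characterises the addition: each group axiom, and
  -- compatibility with conjugation, follows from a property of `SumsToO` without another look at
  -- the formulas.
  +E-sums : ∀ P Q → OnCurve W P → OnCurve W Q → SumsToO (θ P) (θ Q) (opp (θ (P +E Q)))
  +E-sums O          Q          p q = refl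
  +E-sums (af x₁ y₁) O          p q = refl
  +E-sums (af x₁ y₁) (af x₂ y₂) p q = Sum⇒SumsToO p q (sum-view x₁ y₁ x₂ y₂)

  OnCurve-+E : ∀ P Q → OnCurve W P → OnCurve W Q → OnCurve W (P +E Q)
  OnCurve-+E P Q p q = OnCurve⇐ (P +E Q) (subst OnAffine (opp-involutive (θ (P +E Q)))
    (OnAffine-opp (opp (θ (P +E Q)))
      (SumsToO⇒OnAffine (θ P) (θ Q) (opp (θ (P +E Q))) (OnCurve⇒ P p) (OnCurve⇒ Q q) (+E-sums P Q p q))))

  OnCurve-neg : ∀ P → OnCurve W P → OnCurve W (-E P)
  OnCurve-neg P p = OnCurve⇐ (-E P) (subst OnAffine (sym (θ-neg P)) (OnAffine-opp (θ P) (OnCurve⇒ P p)))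

  opp-θ-injective : ∀ P Q → opp (θ P) ≡ opp (θ Q) → P ≡ Q
  opp-θ-injective P Q eq = θ-injective P Q
    (trans (sym (opp-involutive (θ P))) (trans (cong opp eq) (opp-involutive (θ Q))))

  +E-comm : ∀ P Q → OnCurve W P → OnCurve W Q → P +E Q ≡ Q +E P
  +E-comm P Q p q = opp-θ-injective (P +E Q) (Q +E P)
    (SumsToO-unique (θ P) (θ Q) _ _ (+E-sums P Q p q) (SumsToO-swap (θ Q) (θ P) _ (+E-sums Q P q p)))

  +E-assoc : ∀ P Q R → OnCurve W P → OnCurve W Q → OnCurve W R → (P +E Q) +E R ≡ P +E (Q +E R)
  +E-assoc P Q R p q r = opp-θ-injective ((P +E Q) +E R) (P +E (Q +E R))
    (SumsToO-unique (θ P) (θ (Q +E R)) _ _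
      (subst (λ U → SumsToO (θ P) U (opp (θ ((P +E Q) +E R)))) (opp-involutive (θ (Q +E R)))
        (SumsToO-assoc (θ P) (θ Q) (θ R) (+E-sums P Q p q)
          (subst (λ S → SumsToO S (θ R) (opp (θ ((P +E Q) +E R)))) (sym (opp-involutive (θ (P +E Q))))
            (+E-sums (P +E Q) R (OnCurve-+E P Q p q) r))
          (+E-sums Q R q r)))
      (+E-sums P (Q +E R) p (OnCurve-+E Q R q r)))

  +E-inverse : ∀ P → OnCurve W P → P +E (-E P) ≡ O
  +E-inverse P p = opp-θ-injective (P +E (-E P)) O
    (SumsToO-unique (θ P) (θ (-E P)) _ _ (+E-sums P (-E P) p (OnCurve-neg P p))
      (subst (λ Q → SumsToO (θ P) Q ∞) (sym (θ-neg P)) (SumsToO-inverse (θ P))))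

  E-group : AbelianGroup 0ℓ 0ℓ
  E-group = record
    { Carrier = Σ Pt (OnCurve W)
    ; _≈_ = λ P Q → proj₁ P ≡ proj₁ Q
    ; _∙_ = λ (P , p) (Q , q) → P +E Q , OnCurve-+E P Q p q
    ; ε = O , tt
    ; _⁻¹ = λ (P , p) → -E P , OnCurve-neg P p
    ; isAbelianGroup = record
      { isGroup = record
        { isMonoid = record
          { isSemigroup = record
            { isMagma = record
              { isEquivalence = record { refl = refl ; sym = sym ; trans = trans }
              ; ∙-cong = cong₂ _+E_ }
            ; assoc = λ (P , p) (Q , q) (R , r) → +E-assoc P Q R p q r }
          ; identity = (λ _ → refl) , λ (P , p) → +E-comm P O p tt }
        ; inverse = (λ (P , p) → trans (+E-comm (-E P) P (OnCurve-neg P p) p) (+E-inverse P p))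
                  , λ (P , p) → +E-inverse P p
        ; ⁻¹-cong = cong -E_ }
      ; comm = λ (P , p) (Q , q) → +E-comm P Q p q } }
--

module _ (u r s t : ℚ) where

  private v = inv u

  -- Completing the square absorbs s and t: between the completed cubics the substitution is x = u²
  -- x′ + r, y = u³ y′.
  transform-A : ∀ W → Coefficients.A (transform W u r s t) ≡ v * v * (Coefficients.A W + φ (+ 3) * r)
  transform-A (mkW a1 a2 a3 a4 a6) = (entail 6 λ a1 a2 r s v h →
    con (+ 2) :* h ⊜ con (+ 1) by v :* v :* (s :* a1 :+ s :* s) :* (con (+ 2) :* h :+ con (+ 1)) ⇒
    ⊢ v :* (v :* con (+ 1)) :* (a2 :- s :* a1 :+ con (+ 3) :* r :- s :* s)
      :+ h :* h :* (v :* con (+ 1) :* (a1 :+ con (+ 2) :* s)) :* (v :* con (+ 1) :* (a1 :+ con (+ 2) :* s))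
      ⊜ v :* v :* (a2 :+ h :* h :* a1 :* a1 :+ con (+ 3) :* r)) a1 a2 r s v ½ refl

  transform-B : ∀ W → let open Coefficients W in
    Coefficients.B (transform W u r s t) ≡ v * v * v * v * (B + φ (+ 2) * r * A + φ (+ 3) * r * r)
  transform-B (mkW a1 a2 a3 a4 a6) = (entail 9 λ a1 a2 a3 a4 r s t v h →
    con (+ 2) :* h ⊜ con (+ 1) by v :* v :* v :* v :* (s :* a3 :+ t :* a1 :+ r :* s :* a1 :+ con (+ 2) :* s :* t :- h :* r :* a1 :* a1) ⇒
    ⊢ v :* (v :* (v :* (v :* con (+ 1)))) :*
        (a4 :- s :* a3 :+ con (+ 2) :* r :* a2 :- (t :+ r :* s) :* a1 :+ con (+ 3) :* r :* r :- con (+ 2) :* s :* t)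
      :+ h :* (v :* con (+ 1) :* (a1 :+ con (+ 2) :* s)) :* (v :* (v :* (v :* con (+ 1))) :* (a3 :+ r :* a1 :+ con (+ 2) :* t))
      ⊜ v :* v :* v :* v :* (a4 :+ h :* a1 :* a3 :+ con (+ 2) :* r :* (a2 :+ h :* h :* a1 :* a1) :+ con (+ 3) :* r :* r))
    a1 a2 a3 a4 r s t v ½ refl

  transform-C : ∀ W → let open Coefficients W in
    Coefficients.C (transform W u r s t) ≡ v * v * v * v * v * v * (C + r * B + r * r * A + r * r * r)
  transform-C (mkW a1 a2 a3 a4 a6) = (entail 10 λ a1 a2 a3 a4 a6 r s t v h →
    con (+ 2) :* h ⊜ con (+ 1) by v :* v :* v :* v :* v :* v :*
      ((con (+ 2) :* h :+ con (+ 1)) :* (t :* t :+ t :* a3 :+ r :* t :* a1) :+ h :* r :* a1 :* a3) ⇒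
    ⊢ v :* (v :* (v :* (v :* (v :* (v :* con (+ 1)))))) :*
        (a6 :+ r :* a4 :+ r :* r :* a2 :+ r :* r :* r :- t :* a3 :- t :* t :- r :* t :* a1)
      :+ h :* h :* (v :* (v :* (v :* con (+ 1))) :* (a3 :+ r :* a1 :+ con (+ 2) :* t))
               :* (v :* (v :* (v :* con (+ 1))) :* (a3 :+ r :* a1 :+ con (+ 2) :* t))
      ⊜ v :* v :* v :* v :* v :* v :*
        (a6 :+ h :* h :* a3 :* a3 :+ r :* (a4 :+ h :* a1 :* a3) :+ r :* r :* (a2 :+ h :* h :* a1 :* a1) :+ r :* r :* r))
    a1 a2 a3 a4 a6 r s t v ½ refl

-- `Δ` modulo 2, term by term: `false` stands for the coefficients 2, 4 and 8, `true` for 9 and 27.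
-- The shape is that of the parity inferred in `parity-Δ`.
discriminant-residue : (r₁ r₂ r₃ r₄ r₆ : Bool) → Bool
discriminant-residue r₁ r₂ r₃ r₄ r₆ =
  ((((B₂ ∧ B₂) ∧ B₈) xor (((false ∧ B₄) ∧ B₄) ∧ B₄)) xor ((true ∧ B₆) ∧ B₆)) xor (((true ∧ B₂) ∧ B₄) ∧ B₆)
  where
  B₂ = (r₁ ∧ r₁) xor (false ∧ r₂)
  B₄ = (false ∧ r₄) xor (r₁ ∧ r₃)
  B₆ = (r₃ ∧ r₃) xor (false ∧ r₆)
  B₈ = (((((r₁ ∧ r₁) ∧ r₆) xor ((false ∧ r₂) ∧ r₆)) xor ((r₁ ∧ r₃) ∧ r₄)) xor ((r₂ ∧ r₃) ∧ r₃)) xor (r₄ ∧ r₄)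

-- Over 𝔽₂ a singular point forces the discriminant to vanish: all 2⁷ cases are checked.
nonsingular : ∀ r₁ r₂ r₃ r₄ r₆ X Y → discriminant-residue r₁ r₂ r₃ r₄ r₆ ≡ true →
  equation-residue r₁ r₂ r₃ r₄ r₆ X Y ≡ false → ∂y-residue r₁ r₂ r₃ r₄ r₆ X Y ≡ false →
  ∂x-residue r₁ r₂ r₃ r₄ r₆ X Y ≡ false → ⊥
nonsingular r₁ r₂ r₃ r₄ r₆ X Y δ w wy wx =
  refute δ w wy wx (every 7 check tt (r₁ ∷ r₂ ∷ r₃ ∷ r₄ ∷ r₆ ∷ X ∷ Y ∷ []))
  where
  all : ∀ n → (Vec Bool n → Bool) → Bool
  all ℕ.zero    P = P []
  all (ℕ.suc n) P = all n (λ bs → P (true ∷ bs)) ∧ all n (λ bs → P (false ∷ bs))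

  every : ∀ n P → T (all n P) → ∀ bs → T (P bs)
  every ℕ.zero    P p []           = p
  every (ℕ.suc n) P p (true ∷ bs)  = every n (λ bs → P (true ∷ bs)) (proj₁ (Equivalence.to T-∧ p)) bs
  every (ℕ.suc n) P p (false ∷ bs) = every n (λ bs → P (false ∷ bs)) (proj₂ (Equivalence.to T-∧ p)) bs

  check : Vec Bool 7 → Bool
  check (r₁ ∷ r₂ ∷ r₃ ∷ r₄ ∷ r₆ ∷ X ∷ Y ∷ []) =
    not (discriminant-residue r₁ r₂ r₃ r₄ r₆) ∨ equation-residue r₁ r₂ r₃ r₄ r₆ X Y
    ∨ ∂y-residue r₁ r₂ r₃ r₄ r₆ X Y ∨ ∂x-residue r₁ r₂ r₃ r₄ r₆ X Y

  refute : ∀ {a b c d} → a ≡ true → b ≡ false → c ≡ false → d ≡ false → T (not a ∨ b ∨ c ∨ d) → ⊥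
  refute refl refl refl refl ()

even-4 : Even (φ (+ 4))
even-4 = parity (φ (+ 2)) (Int-φ (+ 2)) refl

module _ {r₁ r₂ r₃ r₄ r₆ : Bool} (W : Weierstrass)
         (p₁ : Parity r₁ (Weierstrass.a1 W)) (p₂ : Parity r₂ (Weierstrass.a2 W))
         (p₃ : Parity r₃ (Weierstrass.a3 W)) (p₄ : Parity r₄ (Weierstrass.a4 W))
         (p₆ : Parity r₆ (Weierstrass.a6 W))
         where

  parity-b2 : Parity ((r₁ ∧ r₁) xor (false ∧ r₂)) (b2 W)
  parity-b2 = Parity-+ (Parity-* p₁ p₁) (Parity-* even-4 p₂)

  parity-b4 : Parity ((false ∧ r₄) xor (r₁ ∧ r₃)) (b4 W)
  parity-b4 = Parity-+ (Parity-* {false} (parity (φ (+ 1)) (Int-φ (+ 1)) refl) p₄) (Parity-* p₁ p₃)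

  parity-b6 : Parity ((r₃ ∧ r₃) xor (false ∧ r₆)) (b6 W)
  parity-b6 = Parity-+ (Parity-* p₃ p₃) (Parity-* even-4 p₆)

  parity-b8 : Parity _ (b8 W)
  parity-b8 = Parity-- (Parity-+ (Parity-- (Parity-+ (Parity-* (Parity-* p₁ p₁) p₆)
    (Parity-* (Parity-* even-4 p₂) p₆)) (Parity-* (Parity-* p₁ p₃) p₄)) (Parity-* (Parity-* p₂ p₃) p₃))
    (Parity-* p₄ p₄)

  parity-Δ : Parity (discriminant-residue r₁ r₂ r₃ r₄ r₆) (Δ W)
  parity-Δ = Parity-+ (Parity-- (Parity-- (Parity-neg (Parity-* (Parity-* parity-b2 parity-b2) parity-b8))
    -- The halves supplied come from 8 = 2 · 4, 27 = 1 + 2 · 13 and 9 = 1 + 2 · 4.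
    (Parity-* (Parity-* (Parity-* {false} (parity (φ (+ 4)) (Int-φ (+ 4)) refl) parity-b4) parity-b4) parity-b4))
    (Parity-* (Parity-* {true} (parity (φ (+ 13)) (Int-φ (+ 13)) refl) parity-b6) parity-b6))
    (Parity-* (Parity-* (Parity-* {true} (parity (φ (+ 4)) (Int-φ (+ 4)) refl) parity-b2) parity-b4) parity-b6)

module _ (d : ℤ) (e : ℚ) (odd-e : Odd e) (d≡2e : ℤ→ℚ d ≡ φ (+ 2) * e) where

  open Ramified d e odd-e d≡2e
  open QuadField d

  K-ramified : RamifiedConjugation K-field
  K-ramified = record
    { conj = conj ; Residue = Residue
    ; residue-+ = Residue-⊕ ; residue-- = Residue-⊖ ; residue-* = Residue-⊗ ; residue-conj = Residue-conj
    ; residue-1 = Residue-ι (parity 0ℚ (Int-φ (+ 0)) refl)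
    ; residue-2 = Residue-ι even-2
    ; 𝒪-φ = λ n → 𝒪-intro (Int-φ n) (Int-φ (+ 0))
    ; 𝔪⇒¬Unit = 𝔪⇒¬Unit ; Unit-inverse = Unit-inverse ; 𝒪-or-inverse = 𝒪-or-inverse
    ; π = √d ; ε = ι e
    ; π²≡2ε = cong₂ _+√_
        ((entail 2 λ e D → D ⊜ con (+ 2) :* e by con (+ 1) ⇒
          ⊢ con (+ 0) :* con (+ 0) :+ D :* con (+ 1) :* con (+ 1) ⊜ con (+ 2) :* e :+ D :* con (+ 0) :* con (+ 0)) e D d≡2e)
        ((entail 1 λ e → ⊢ con (+ 0) :* con (+ 1) :+ con (+ 1) :* con (+ 0) ⊜ con (+ 2) :* con (+ 0) :+ con (+ 0) :* e) e)
    ; 𝒪-ε = true , Residue-ι odd-e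
    ; 𝔪-π = reduces (parity 0ℚ (Int-φ (+ 0)) refl) (Int-φ (+ 1))
    ; 𝔪⇒π∣ = 𝔪-uniformizer ; x-conj = x-conj ; conj-ratio = conj-ratio }

-- Depth in the kernel of reduction, measured on a model with good reduction at 2.

module GoodModel (d : ℤ) (e : ℚ) (odd-e : Odd e) (d≡2e : ℤ→ℚ d ≡ φ (+ 2) * e)
                 (W : Weierstrass) (Δ≢0 : Δ W ≢ 0ℚ) (u r s t : ℚ)
                
                 {r₁ r₂ r₃ r₄ r₆ : Bool}
                 (p₁ : Parity r₁ (Weierstrass.a1 (transform W u r s t))) (p₂ : Parity r₂ (Weierstrass.a2 (transform W u r s t))) (p₃ : Parity r₃ (Weierstrass.a3 (transform W u r s t)))
                 (p₄ : Parity r₄ (Weierstrass.a4 (transform W u r s t))) (p₆ : Parity r₆ (Weierstrass.a6 (transform W u r s t)))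
                 (odd-Δ : Odd (Δ (transform W u r s t))) where

  open Ramified d e odd-e d≡2e
  open QuadField d
  open MordellWeil d e odd-e d≡2e W Δ≢0
  open Coefficients W using (A; B; C)
  private
    W′ = transform W u r s t
    module W′ = Weierstrass W′
    module C′ = Coefficients W′

    v : ℚ
    v = inv u

    A′≡ : ι C′.A ≡ ι v ⊗ ι v ⊗ (ι A ⊕ ι (φ (+ 3)) ⊗ ι r)
    A′≡ = trans (cong ι (transform-A u r s t W))
      (ι-Hom.transport 3 (λ v A r → v :* v :* (A :+ con (+ 3) :* r)) v A r)

    B′≡ : ι C′.B ≡ ι v ⊗ ι v ⊗ ι v ⊗ ι v ⊗ (ι B ⊕ ι (φ (+ 2)) ⊗ ι r ⊗ ι A ⊕ ι (φ (+ 3)) ⊗ ι r ⊗ ι r)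
    B′≡ = trans (cong ι (transform-B u r s t W))
      (ι-Hom.transport 4 (λ v A B r → v :* v :* v :* v :* (B :+ con (+ 2) :* r :* A :+ con (+ 3) :* r :* r)) v A B r)

    C′≡ : ι C′.C ≡ ι v ⊗ ι v ⊗ ι v ⊗ ι v ⊗ ι v ⊗ ι v ⊗ (ι C ⊕ ι r ⊗ ι B ⊕ ι r ⊗ ι r ⊗ ι A ⊕ ι r ⊗ ι r ⊗ ι r)
    C′≡ = trans (cong ι (transform-C u r s t W))
      (ι-Hom.transport 5 (λ v A B C r → v :* v :* v :* v :* v :* v :* (C :+ r :* B :+ r :* r :* A :+ r :* r :* r)) v A B C r)

    open Rescaling.Curve K-field {ι A} {ι B} {ι C} {ι C′.A} {ι C′.B} {ι C′.C} (ι r) (ι v) A′≡ B′≡ C′≡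

    2½≡1 : ι (φ (+ 2)) ⊗ ι ½ ≡ ι 1ℚ
    2½≡1 = sym (ι-Hom.transport 1 (λ h → con (+ 2) :* h) ½)

    A′-square : ι C′.A ≡ ι W′.a2 ⊕ ι ½ ⊗ ι ½ ⊗ ι W′.a1 ⊗ ι W′.a1
    A′-square = ι-Hom.transport 3 (λ a1 a2 h → a2 :+ h :* h :* a1 :* a1) W′.a1 W′.a2 ½

    B′-square : ι C′.B ≡ ι W′.a4 ⊕ ι ½ ⊗ ι W′.a1 ⊗ ι W′.a3
    B′-square = ι-Hom.transport 4 (λ a1 a3 a4 h → a4 :+ h :* a1 :* a3) W′.a1 W′.a3 W′.a4 ½

    C′-square : ι C′.C ≡ ι W′.a6 ⊕ ι ½ ⊗ ι ½ ⊗ ι W′.a3 ⊗ ι W′.a3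
    C′-square = ι-Hom.transport 3 (λ a3 a6 h → a6 :+ h :* h :* a3 :* a3) W′.a3 W′.a6 ½

    δ≡true : discriminant-residue r₁ r₂ r₃ r₄ r₆ ≡ true
    δ≡true = Parity-true (parity-Δ W′ p₁ p₂ p₃ p₄ p₆) odd-Δ
      where
      Parity-true : ∀ {b q} → Parity b q → Odd q → b ≡ true
      Parity-true {true}  _ _ = refl
      Parity-true {false} e o = ⊥-elim (Even⇒¬Odd e o)

  x′ : K d → K d
  x′ x = (x ⊖ ι r) ⊗ ι v ⊗ ι v

  -- The point lies in the third step of the kernel of reduction: 1/x is divisible by 8.
  data Deep (z : K d) : Pt → Set where
    deep : ∀ {x y} → 𝒪 z → x′ x ⊗ (ι (φ (+ 8)) ⊗ z) ≡ ι 1ℚ → Deep z (af x y)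

  private
    Y′ y′ : K d → K d → K d
    Y′ x y = Affine.y (complete x y) ⊗ ι v ⊗ ι v ⊗ ι v
    y′ x y = Y′ x y ⊖ ι ½ ⊗ (ι W′.a1 ⊗ x′ x ⊕ ι W′.a3)

    conj-x′ : ∀ x → conj (x′ x) ≡ x′ (conj x)
    conj-x′ x = conj-Hom.transport 3 (λ x r v → (x :- r) :* v :* v) x (ι r) (ι v)

    conj-y′ : ∀ x y → conj (y′ x y) ≡ y′ (conj x) (conj y)
    conj-y′ x y = conj-Hom.transport 9 (λ x y r v h a1 a3 a1′ a3′ →
        (y :+ h :* (a1 :* x :+ a3)) :* v :* v :* v :- h :* (a1′ :* ((x :- r) :* v :* v) :+ a3′))
      x y (ι r) (ι v) (ι ½) (ι (Weierstrass.a1 W)) (ι (Weierstrass.a3 W)) (ι W′.a1) (ι W′.a3)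

  -- The point (x₃, y₃) is P - P̄. Its line is rescaled on the completed cubics, and the square is
  -- then undone on the model with good reduction, where the coefficients are integral. The change
  -- of variables is rational, so it commutes with conjugation.
  difference-deep : ∀ {x y x₃ y₃} →
    complete x y ∼ opposite (complete (conj x) (conj y)) ∼ opposite (complete x₃ y₃) →
    ∃ λ z → Deep z (af x₃ y₃)
  difference-deep {x} {y} {x₃} {y₃} l@(line m n on₁ on₂ on₃ σ₁ σ₂ σ₃) =
    let z , 𝒪-z , eq = ConjugateDifference.Curve.conjugate-difference K-field (K-ramified d e odd-e d≡2e)
          (ι W′.a1) (ι W′.a2) (ι W′.a3) (ι W′.a4) (ι W′.a6)
          (Residue-ι p₁) (Residue-ι p₂) (Residue-ι p₃) (Residue-ι p₄) (Residue-ι p₆)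
          (λ X Y → nonsingular r₁ r₂ r₃ r₄ r₆ X Y δ≡true) {x′ x} {y′ x y}
          (uncompleted-square K-field {ι ½} {ι W′.a1} {ι W′.a2} {ι W′.a3} {ι W′.a4} {ι W′.a6}
            {ι C′.A} {ι C′.B} {ι C′.C} {x′ x} {Y′ x y} 2½≡1 A′-square B′-square C′-square (rescale-cubic {x} {Affine.y (complete x y)} (∼⇒OnCubic l)))
          {μ} {x′ x₃}
          (subst₂ (λ a b → (x′ x ⊖ a) ⊗ μ ≡ y′ x y ⊕ b ⊕ ι W′.a1 ⊗ a ⊕ ι W′.a3)
            (sym (conj-x′ x)) (sym (conj-y′ x y)) μ-x)
          (subst₂ (λ a b → (y′ x y ⊖ b) ⊗ μ ≡
              x′ x ⊗ x′ x ⊕ x′ x ⊗ a ⊕ a ⊗ a ⊕ ι W′.a2 ⊗ (x′ x ⊕ a) ⊕ ι W′.a4 ⊖ ι W′.a1 ⊗ y′ x y)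
            (sym (conj-x′ x)) (sym (conj-y′ x y)) μ-y)
          (subst (λ a → x′ x₃ ≡ μ ⊗ μ ⊕ ι W′.a1 ⊗ μ ⊖ ι W′.a2 ⊖ x′ x ⊖ a) (sym (conj-x′ x)) μ-x₃)
    in z , deep 𝒪-z eq
    where
    add-back : ∀ Y k → (Y ⊖ k) ⊕ k ≡ Y
    add-back = 𝕂.entail 2 λ Y k → ⊢ (Y :- k) :+ k ⊜ Y
    open Slope.Line K-field {ι ½} {ι W′.a1} {ι W′.a2} {ι W′.a3} {ι W′.a4} {ι C′.A} {ι C′.B}
      {x′ x} {x′ (conj x)} {y′ x y} {y′ (conj x) (conj y)} {x′ x₃} {m ⊗ ι v} {(n ⊕ m ⊗ ι r) ⊗ ι v ⊗ ι v ⊗ ι v}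
      2½≡1 A′-square B′-square
      (trans (add-back (Y′ x y) _) (rescale-on {x} {Affine.y (complete x y)} {m} {n} on₁))
      (trans (cong neg (add-back (Y′ (conj x) (conj y)) _))
        (trans ((𝕂.entail 2 λ y v → ⊢ :- (y :* v :* v :* v) ⊜ (:- y) :* v :* v :* v)
                 (Affine.y (complete (conj x) (conj y))) (ι v))
          (rescale-on {conj x} {neg (Affine.y (complete (conj x) (conj y)))} {m} {n} on₂)))
      (rescale-σ₁ {x} {conj x} {x₃} {m} {n} σ₁) (rescale-σ₂ {x} {conj x} {x₃} {m} {n} σ₁ σ₂)

  private
    b₂≡ : ι (b2 W′) ≡ ι (φ (+ 4)) ⊗ ι C′.A
    b₂≡ = trans (cong ι (b2≡ W′)) (ι-Hom.transport 1 (λ A → con (+ 4) :* A) C′.A)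

    b₄≡ : ι (b4 W′) ≡ ι (φ (+ 2)) ⊗ ι C′.B
    b₄≡ = trans (cong ι (b4≡ W′)) (ι-Hom.transport 1 (λ B → con (+ 2) :* B) C′.B)

    b₆≡ : ι (b6 W′) ≡ ι (φ (+ 4)) ⊗ ι C′.C
    b₆≡ = trans (cong ι (b6≡ W′)) (ι-Hom.transport 1 (λ C → con (+ 4) :* C) C′.C)

    b₈≡ : ι (b8 W′) ≡ ι (φ (+ 4)) ⊗ ι C′.A ⊗ ι C′.C ⊖ ι C′.B ⊗ ι C′.B
    b₈≡ = trans (cong ι (b8≡ W′)) (ι-Hom.transport 3 (λ A B C → con (+ 4) :* A :* C :- B :* B) C′.A C′.B C′.C)

    open module Double {x z : K d} = Doubling.Curve K-field (K-ramified d e odd-e d≡2e)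
      {ι C′.A} {ι C′.B} {ι C′.C} {ι (b2 W′)} {ι (b4 W′)} {ι (b6 W′)} {ι (b8 W′)} b₂≡ b₄≡ b₆≡ b₈≡
      (_ , Residue-ι (parity-b2 W′ p₁ p₂ p₃ p₄ p₆)) (_ , Residue-ι (parity-b4 W′ p₁ p₂ p₃ p₄ p₆))
      (_ , Residue-ι (parity-b6 W′ p₁ p₂ p₃ p₄ p₆)) (_ , Residue-ι (parity-b8 W′ p₁ p₂ p₃ p₄ p₆)) {x} {z}

    deep-tangent : ∀ {x y z x₃ y₃} → Deep z (af x y) →
      complete x y ∼ complete x y ∼ opposite (complete x₃ y₃) →
      ∃ λ r → 𝒪 r × Deep (z ⊗ (ι (φ (+ 2)) ⊗ r)) (af x₃ y₃)
    deep-tangent {x} {y} {z} {x₃} {y₃} (deep 𝒪-z eq) l@(line m n on₁ on₂ on₃ σ₁ σ₂ σ₃) =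
      let r , 𝒪-r , eq′ = double {x′ x} {z} 𝒪-z eq {Y′ x y} {m ⊗ ι v} {x′ x₃}
            (rescale-cubic {x} {Affine.y (complete x y)} (∼⇒OnCubic l))
            (rescale-derivative {x} {Affine.y (complete x y)} {m} {x₃} (derivative l))
            (rescale-σ₁ {x} {x} {x₃} {m} {n} σ₁)
      in r , 𝒪-r , deep (_ , Residue-⊗ (proj₂ 𝒪-z) (Residue-⊗ (Residue-ι even-2) (proj₂ 𝒪-r))) eq′

    deep⇒not-2-torsion : ∀ {x y z} → OnCurve W (af x y) → Deep z (af x y) →
      complete x y ≢ opposite (complete x y)
    deep⇒not-2-torsion {x} {y} {z} on (deep 𝒪-z eq) eq-opp = not-2-torsion {x′ x} {z} 𝒪-z eq {Y′ x y}
      (rescale-cubic {x} {Affine.y (complete x y)} (OnWeierstrass⇒OnCubic {x} {y} on))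
      ((𝕂.entail 3 λ y v h → con (+ 2) :* h ⊜ con (+ 1) by :- (y :* v :* v :* v) ⇒
        y ⊜ :- y by h :* v :* v :* v ⇒ ⊢ y :* v :* v :* v ⊜ con (+ 0))
        (Affine.y (complete x y)) (ι v) (ι ½) 2½≡1 (cong Affine.y eq-opp))

  deep-double : ∀ {z} P → OnCurve W P → Deep z P → ∃ λ r → 𝒪 r × Deep (z ⊗ (ι (φ (+ 2)) ⊗ r)) (P +E P)
  deep-double {z} (af x y) on D = by-sum (af x y +E af x y) (+E-sums (af x y) (af x y) on on)
    where
    aff-injective : ∀ {P Q} → aff P ≡ aff Q → P ≡ Q
    aff-injective refl = refl
    by-sum : ∀ R → SumsToO (θ (af x y)) (θ (af x y)) (opp (θ R)) → ∃ λ r → 𝒪 r × Deep (z ⊗ (ι (φ (+ 2)) ⊗ r)) R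
    -- A sum equal to O would make the point its own opposite, with vanishing ordinate on the
    -- completed cubic.
    by-sum O          eq = ⊥-elim (deep⇒not-2-torsion on D (aff-injective eq))
    by-sum (af x₃ y₃) l  = deep-tangent D l

  -- The abscissa determines z, so 2r would equal 1 although 2r lies in 𝔪.
  deep-unique : ∀ {z r P} → Deep z P → 𝒪 r → ¬ Deep (z ⊗ (ι (φ (+ 2)) ⊗ r)) P
  deep-unique {z} {r} (deep {x} _ eq) 𝒪-r (deep _ eq′) = 𝔪⇒¬Unit
    (subst 𝔪 ((𝕂.entail 3 λ x z r → x :* (con (+ 8) :* z) ⊜ con (+ 1) by con -[1+ 1 ] :* r ⇒
      x :* (con (+ 8) :* (z :* (con (+ 2) :* r))) ⊜ con (+ 1) by con (+ 1) ⇒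
      ⊢ con (+ 2) :* r ⊜ con (+ 1)) (x′ x) z r eq eq′)
      (Residue-⊗ (Residue-ι even-2) (proj₂ 𝒪-r)))
    (Residue-ι (parity 0ℚ (Int-φ (+ 0)) refl))

-- Iterated doubles of a torsion element.

module RepeatedDoubling (G : AbelianGroup 0ℓ 0ℓ) where
  open AbelianGroup G renaming (refl to ≈-refl; sym to ≈-sym; trans to ≈-trans)
  open Multiples monoid using (×-homo-+; ×-assocˡ; ×-congʳ; ×-congˡ) renaming (_×_ to _·ᴳ_)
  open import Relation.Binary.Reasoning.Setoid setoid

  doubles : ℕ → Carrier → Carrier
  doubles ℕ.zero    x = x
  doubles (ℕ.suc k) x = doubles k (x ∙ x)

  doubles-+ : ∀ k m x → doubles (k ℕ.+ m) x ≡ doubles m (doubles k x)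
  doubles-+ ℕ.zero    m x = refl
  doubles-+ (ℕ.suc k) m x = doubles-+ k m (x ∙ x)

  n·ε≈ε : ∀ n → n ·ᴳ ε ≈ ε
  n·ε≈ε ℕ.zero    = ≈-refl
  n·ε≈ε (ℕ.suc n) = ≈-trans (identityˡ _) (n·ε≈ε n)

  doubles≈2^ : ∀ k x → doubles k x ≈ (2 ℕ.^ k) ·ᴳ x
  doubles≈2^ ℕ.zero    x = ≈-sym (identityʳ x)
  doubles≈2^ (ℕ.suc k) x = begin
    doubles k (x ∙ x)             ≈⟨ doubles≈2^ k (x ∙ x) ⟩
    (2 ℕ.^ k) ·ᴳ (x ∙ x)          ≈⟨ ×-congʳ (2 ℕ.^ k) (∙-congˡ (identityʳ x)) ⟨
    (2 ℕ.^ k) ·ᴳ (2 ·ᴳ x)         ≈⟨ ×-assocˡ x (2 ℕ.^ k) 2 ⟩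
    (2 ℕ.^ k ℕ.* 2) ·ᴳ x          ≈⟨ ×-congˡ {x} (ℕₚ.*-comm (2 ℕ.^ k) 2) ⟩
    (2 ℕ.^ ℕ.suc k) ·ᴳ x          ∎

  module _ (n : ℕ) .{{_ : ℕ.NonZero n}} (x : Carrier) (n·x≈ε : n ·ᴳ x ≈ ε) where

    ·-mod : ∀ m → m ·ᴳ x ≈ (m ℕDM.% n) ·ᴳ x
    ·-mod m = begin
      m ·ᴳ x                                            ≈⟨ ×-congˡ {x} (ℕDM.m≡m%n+[m/n]*n m n) ⟩
      (m ℕDM.% n ℕ.+ m ℕDM./ n ℕ.* n) ·ᴳ x              ≈⟨ ×-homo-+ x (m ℕDM.% n) (m ℕDM./ n ℕ.* n) ⟩
      (m ℕDM.% n) ·ᴳ x ∙ (m ℕDM./ n ℕ.* n) ·ᴳ x         ≈⟨ ∙-congˡ (×-assocˡ x (m ℕDM./ n) n) ⟨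
      (m ℕDM.% n) ·ᴳ x ∙ (m ℕDM./ n) ·ᴳ (n ·ᴳ x)        ≈⟨ ∙-congˡ (×-congʳ (m ℕDM./ n) n·x≈ε) ⟩
      (m ℕDM.% n) ·ᴳ x ∙ (m ℕDM./ n) ·ᴳ ε               ≈⟨ ∙-congˡ (n·ε≈ε (m ℕDM./ n)) ⟩
      (m ℕDM.% n) ·ᴳ x ∙ ε                              ≈⟨ identityʳ _ ⟩
      (m ℕDM.% n) ·ᴳ x                                  ∎

    -- Two of the n + 1 powers 2⁰, ..., 2ⁿ agree modulo n, whatever the parity of n.
    doubles-collide : ∃₂ λ i k → doubles i x ≈ doubles (ℕ.suc k) (doubles i x)
    doubles-collide with pigeonhole (ℕₚ.n<1+n n) (λ i → fromℕ< (ℕDM.m%n<n (2 ℕ.^ toℕ i) n))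
    -- The witness is k = j - (i + 1), so that `suc k` doublings, at least one, lead from 2ⁱx to
    -- 2ʲx.
    ... | i , j , i<j , eq = toℕ i , toℕ j ℕ.∸ ℕ.suc (toℕ i) , (begin
      doubles (toℕ i) x                             ≈⟨ doubles≈2^ (toℕ i) x ⟩
      (2 ℕ.^ toℕ i) ·ᴳ x                            ≈⟨ ·-mod (2 ℕ.^ toℕ i) ⟩
      (2 ℕ.^ toℕ i ℕDM.% n) ·ᴳ x                    ≈⟨ ×-congˡ {x} same-residue ⟩
      (2 ℕ.^ toℕ j ℕDM.% n) ·ᴳ x                    ≈⟨ ·-mod (2 ℕ.^ toℕ j) ⟨
      (2 ℕ.^ toℕ j) ·ᴳ x                            ≈⟨ doubles≈2^ (toℕ j) x ⟨
      doubles (toℕ j) x                             ≡⟨ cong (λ k → doubles k x) (sym j≡) ⟩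
      doubles (toℕ i ℕ.+ ℕ.suc (toℕ j ℕ.∸ ℕ.suc (toℕ i))) x ≡⟨ doubles-+ (toℕ i) _ x ⟩
      doubles (ℕ.suc (toℕ j ℕ.∸ ℕ.suc (toℕ i))) (doubles (toℕ i) x) ∎)
      where
      same-residue : 2 ℕ.^ toℕ i ℕDM.% n ≡ 2 ℕ.^ toℕ j ℕDM.% n
      same-residue = trans (sym (toℕ-fromℕ< _)) (trans (cong toℕ eq) (toℕ-fromℕ< _))
      j≡ : toℕ i ℕ.+ ℕ.suc (toℕ j ℕ.∸ ℕ.suc (toℕ i)) ≡ toℕ j
      j≡ = trans (ℕₚ.+-suc (toℕ i) _) (ℕₚ.m+[n∸m]≡n i<j)

-- Galois conjugation on torsion points, and the conclusion.

module _ (d : ℤ) (e : ℚ) (odd-e : Odd e) (d≡2e : ℤ→ℚ d ≡ φ (+ 2) * e)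
         (W : Weierstrass) (Δ≢0 : Δ W ≢ 0ℚ) where

  open Ramified d e odd-e d≡2e
  open QuadField d
  open MordellWeil d e odd-e d≡2e W Δ≢0
  open AbelianGroup E-group using (monoid; group; commutativeMonoid; _∙_; ε; _⁻¹; _≈_) renaming (Carrier to G)
  open Automorphism conj conj-⊕ conj-⊗ conj-neg (λ _ → refl) refl refl refl refl refl refl
  open Multiples monoid using () renaming (_×_ to _·ᴳ_)
  open RepeatedDoubling E-group

  conjₚ : Pt → Pt
  conjₚ O        = O
  conjₚ (af x y) = af (conj x) (conj y)

  θ-conj : ∀ P → applyₚ (θ P) ≡ θ (conjₚ P)
  θ-conj O        = refl
  θ-conj (af x y) = cong aff (apply-complete x y)

  OnCurve-conj : ∀ P → OnCurve W P → OnCurve W (conjₚ P)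
  OnCurve-conj P p = OnCurve⇐ (conjₚ P) (subst OnAffine (θ-conj P) (applyₚ-OnAffine (θ P) (OnCurve⇒ P p)))

  conj-+E : ∀ P Q → OnCurve W P → OnCurve W Q → conjₚ (P +E Q) ≡ conjₚ P +E conjₚ Q
  conj-+E P Q p q = opp-θ-injective (conjₚ (P +E Q)) (conjₚ P +E conjₚ Q)
    (SumsToO-unique (θ (conjₚ P)) (θ (conjₚ Q)) _ _
      (subst₂ (λ P′ Q′ → SumsToO P′ Q′ (opp (θ (conjₚ (P +E Q))))) (θ-conj P) (θ-conj Q)
        (subst (SumsToO (applyₚ (θ P)) (applyₚ (θ Q)))
          (trans (applyₚ-opp (θ (P +E Q))) (cong opp (θ-conj (P +E Q))))
          (applyₚ-SumsToO (θ P) (θ Q) (opp (θ (P +E Q))) (+E-sums P Q p q))))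
      (+E-sums (conjₚ P) (conjₚ Q) (OnCurve-conj P p) (OnCurve-conj Q q)))

  conjᴳ : G → G
  conjᴳ (P , p) = conjₚ P , OnCurve-conj P p

  conj-· : ∀ n x → n ·ᴳ conjᴳ x ≈ conjᴳ (n ·ᴳ x)
  conj-· ℕ.zero    x = refl
  conj-· (ℕ.suc n) x@(P , p) = trans (cong (conjₚ P +E_) (conj-· n x))
    (sym (conj-+E P (proj₁ (n ·ᴳ x)) p (proj₂ (n ·ᴳ x))))

  ·-proj₁ : ∀ n x → proj₁ (n ·ᴳ x) ≡ _·_ W n (proj₁ x)
  ·-proj₁ ℕ.zero    x = refl
  ·-proj₁ (ℕ.suc n) x = cong (proj₁ x +E_) (·-proj₁ n x)

  difference : G → G
  difference x = x ∙ conjᴳ x ⁻¹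

  difference-torsion : ∀ n x → n ·ᴳ x ≈ ε → n ·ᴳ difference x ≈ ε
  difference-torsion n x n·x≈ε = begin
    n ·ᴳ (x ∙ conjᴳ x ⁻¹)                  ≈⟨ CommutativeMultiples.×-distrib-+ commutativeMonoid x (conjᴳ x ⁻¹) n ⟩
    n ·ᴳ x ∙ n ·ᴳ (conjᴳ x ⁻¹)             ≈⟨ ∙-congʳ {n ·ᴳ (conjᴳ x ⁻¹)} {n ·ᴳ x} {ε} n·x≈ε ⟩
    ε ∙ n ·ᴳ (conjᴳ x ⁻¹)                  ≈⟨ ∙-congʳ {n ·ᴳ (conjᴳ x ⁻¹)} {n ·ᴳ conjᴳ x} {ε} (trans (conj-· n x) (cong conjₚ n·x≈ε)) ⟨
    n ·ᴳ conjᴳ x ∙ n ·ᴳ (conjᴳ x ⁻¹)       ≈⟨ CommutativeMultiples.×-distrib-+ commutativeMonoid (conjᴳ x) (conjᴳ x ⁻¹) n ⟨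
    n ·ᴳ (conjᴳ x ∙ conjᴳ x ⁻¹)            ≈⟨ Multiples.×-congʳ monoid n (inverseʳ (conjᴳ x)) ⟩
    n ·ᴳ ε                                 ≈⟨ n·ε≈ε n ⟩
    ε                                      ∎
    where
    open AbelianGroup E-group using (∙-congʳ; inverseʳ; setoid)
    open import Relation.Binary.Reasoning.Setoid setoid

  fixed⇒Rational : ∀ P → conjₚ P ≡ P → Rational W P
  fixed⇒Rational O        _  = tt
  fixed⇒Rational (af x y) eq = conj-fixed x (cong abscissa eq) , conj-fixed y (cong ordinate eq)
    where
    abscissa ordinate : Pt → K d
    -- The values at O are defaults; the projections are applied to affine points only.
    abscissa O = x
    abscissa (af x _) = x
    ordinate O = y
    ordinate (af _ y) = y

  module _ (u r s t : ℚ)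
           {r₁ r₂ r₃ r₄ r₆ : Bool}
           (p₁ : Parity r₁ (Weierstrass.a1 (transform W u r s t))) (p₂ : Parity r₂ (Weierstrass.a2 (transform W u r s t))) (p₃ : Parity r₃ (Weierstrass.a3 (transform W u r s t)))
           (p₄ : Parity r₄ (Weierstrass.a4 (transform W u r s t))) (p₆ : Parity r₆ (Weierstrass.a6 (transform W u r s t))) (odd-Δ : Odd (Δ (transform W u r s t))) where

    open GoodModel d e odd-e d≡2e W Δ≢0 u r s t p₁ p₂ p₃ p₄ p₆ odd-Δ

    -- The factors compose as 2r · 2q = 2(r · 2q). At least one doubling takes place, so z really
    -- acquires a factor in 𝔪, as `deep-unique` requires.
    deep-doubles : ∀ k {z} x → Deep z (proj₁ x) →
      ∃ λ r → 𝒪 r × Deep (z ⊗ (ι (φ (+ 2)) ⊗ r)) (proj₁ (doubles (ℕ.suc k) x))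
    deep-doubles ℕ.zero        (P , p)   D = deep-double P p D
    deep-doubles (ℕ.suc k) {z} x@(P , p) D =
      let r , 𝒪-r , D′ = deep-double P p D
          q , 𝒪-q , D″ = deep-doubles k (x ∙ x) D′
      in r ⊗ (ι (φ (+ 2)) ⊗ q) ,
         (_ , Residue-⊗ (proj₂ 𝒪-r) (Residue-⊗ (Residue-ι even-2) (proj₂ 𝒪-q))) ,
         subst (λ z → Deep z (proj₁ (doubles (ℕ.suc (ℕ.suc k)) x)))
           ((𝕂.entail 3 λ z r q → ⊢ z :* (con (+ 2) :* r) :* (con (+ 2) :* q) ⊜ z :* (con (+ 2) :* (r :* (con (+ 2) :* q)))) z r q)
           D″

    deep-doubles₀ : ∀ k {z} x → Deep z (proj₁ x) → ∃ λ z′ → Deep z′ (proj₁ (doubles k x))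
    deep-doubles₀ ℕ.zero    x D = _ , D
    deep-doubles₀ (ℕ.suc k) x D = _ , proj₂ (proj₂ (deep-doubles k x D))

    deep⇒¬torsion : ∀ n .{{_ : ℕ.NonZero n}} {z} x → Deep z (proj₁ x) → ¬ (n ·ᴳ x ≈ ε)
    deep⇒¬torsion n x D n·x≈ε =
      let i , k , eq = doubles-collide n x n·x≈ε
          _ , D′ = deep-doubles₀ i x D
          _ , 𝒪-r , D″ = deep-doubles k (doubles i x) D′
      in deep-unique D′ 𝒪-r (subst (Deep _) (sym eq) D″)

    torsion⇒Rational : ∀ n .{{_ : ℕ.NonZero n}} x → n ·ᴳ x ≈ ε → Rational W (proj₁ x)
    torsion⇒Rational n (O , _) _ = tt
    torsion⇒Rational n x@(P@(af a b) , p) n·x≈ε =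
      by-difference (proj₁ (difference x)) refl (+E-sums P (-E conjₚ P) p (OnCurve-neg (conjₚ P) (OnCurve-conj P p)))
      where
      by-difference : ∀ Q → proj₁ (difference x) ≡ Q →
                      SumsToO (θ P) (θ (-E conjₚ P)) (opp (θ (proj₁ (difference x)))) → Rational W P
      by-difference O eq _ = fixed⇒Rational P (sym (GroupProperties.x∙y⁻¹≈ε⇒x≈y group x (conjᴳ x) eq))
      by-difference Q@(af x₃ y₃) eq l = ⊥-elim (deep⇒¬torsion n (difference x)
        (subst (Deep _) (sym eq) (proj₂ (difference-deep {a} {b} {x₃} {y₃}
          (subst₂ (SumsToO (θ P)) (θ-neg (conjₚ P)) (cong (λ Q → opp (θ Q)) eq) l))))
        (difference-torsion n x n·x≈ε))

theorem1p5 : (E : EllipticCurve) (d : ℤ) → SquareFree d → d ≢ + 1 →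
    TorsionGrows d E → 2 ∣ ∣ d ∣ → DividesConductor 2 E
theorem1p5 (mkE W Δ≢0) d squarefree _ (P , p , (n , n>0 , n·P≡O) , ¬rational) 2∣d
           (u , r , s , t , _ , i₁ , i₂ , i₃ , i₄ , i₆ , iΔ , uΔ) =
  ¬rational (torsion⇒Rational d (φ w) odd-w d≡2w W Δ≢0 u r s t
    (proj₂ (Int⇒Parity (odd-denominator _ i₁))) (proj₂ (Int⇒Parity (odd-denominator _ i₂)))
    (proj₂ (Int⇒Parity (odd-denominator _ i₃))) (proj₂ (Int⇒Parity (odd-denominator _ i₄)))
    (proj₂ (Int⇒Parity (odd-denominator _ i₆))) (odd-numerator _ iΔ uΔ)
    n {{ℕ.>-nonZero n>0}} (P , p) (trans (·-proj₁ d (φ w) odd-w d≡2w W Δ≢0 n (P , p)) n·P≡O))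
  where
  w = proj₁ (2∣⇒double d 2∣d)
  d≡ : d ≡ (+ 2) ℤ.* w
  d≡ = proj₂ (2∣⇒double d 2∣d)
  d≡2w : ℤ→ℚ d ≡ φ (+ 2) * φ w
  d≡2w = trans (cong φ d≡) (φ-* (+ 2) w)
  odd-w : Odd (φ w)
  -- With d = 2w, an even w would make 4 = 2 · 2 divide d, against squarefreeness. This is what
  -- makes 2 ramify with √d as uniformiser.
  odd-w = φ-Odd w λ 2∣w → 2≢1 (squarefree 2 (subst (4 ℕD.∣_)
    (sym (trans (cong ∣_∣ d≡) (ℤₚ.abs-* (+ 2) w))) (ℕD.*-monoʳ-∣ 2 2∣w)))
    where
    2≢1 : 2 ≢ 1
    2≢1 ()
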